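{- Let $G$ be the dodecahedron graph and let $F$ be a circuit of $G$ of length five. Let $H$ be a cyclically five-connected cubic graph such that $F$ is a subgraph of $H$, and suppose that (i) $H$ $F$-contains no jump extension of $(G,F)$, and (ii) for every $X\subseteq V(H)\setminus V(F)$ with $|\delta_H(X)|=5$ and $X\ne V(H)\setminus V(F)$, there is no homeomorphic embedding $\eta$ of $G$ in $H$ fixing $F$ such that $\eta(v)\in X$ for all $v\in V(G)\setminus V(F)$. Then $H$ $F$-contains no hop extension of $(G,F)$.
   Context: All graphs finite and simple. $\delta_H(X)$ is the set of edges with exactly one end in $X$; a cubic graph is cyclically $k$-connected if it has girth $\ge k$ and $|\delta(X)|\ge k$ for all $X$ such that both $X$ and its complement contain the vertex set of a circuit. The dodecahedron graph is the 1-skeleton of the regular dodecahedron (cubic, planar, 20 vertices, 12 pentagonal faces); its planar embedding is unique, and its regions are these 12 faces. A homeomorphic embedding of $G$ in $H$ is a map $\eta$: injective on vertices; each edge $e=v_1v_2$ maps to a path $\eta(e)$ with ends $\eta(v_1),\eta(v_2)$; for distinct edges $e_1,e_2$ no edge or internal vertex of $\eta(e_1)$ lies in $\eta(e_2)$; $\eta(v)\in V(\eta(e))$ iff $v$ is an end of $e$. If $F$ is a subgraph of both $G'$ and $H$, $\eta$ fixes $F$ if $\eta(e)=e$, $\eta(v)=v$ for all $e\in E(F)$, $v\in V(F)$; $H$ $F$-contains $G'$ if some homeomorphic embedding of $G'$ in $H$ fixes $F$. For distinct edges $ab,cd$ of $G$, $G+(ab,cd)$ deletes $ab,cd$ and adds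 new vertices $x,y$ and edges $xa,xb,yc,yd,xy$. Edges $ab,cd$ are diverse in $G$ if $a,b,c,d$ are distinct and neither of $a,b$ is adjacent to $c$ or $d$. A hop extension of $(G,F)$ is $G+(e,f)$ where $e,f\in E(G)\setminus E(F)$, at most one of $e,f$ has an end in $V(F)$, and no region (face) of $G$ is incident with both $e$ and $f$; a jump extension is a hop extension with $e,f$ diverse in $G$. -}

module Defs where

open import Data.Nat using (ℕ; zero; suc; _+_; _*_; _∸_; _≤_; _<ᵇ_; _≡ᵇ_; _%_)
open import Data.Fin using (Fin; zero; suc; toℕ; _≟_)
open import Data.Bool using (Bool; true; false; _∧_; _∨_; not; if_then_else_)
open import Data.List using (List; []; _∷_; _++_; _∷ʳ_; length; reverse; map; allFin)
open import Data.Nat.ListAction using (sum)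
open import Data.List.Membership.Propositional using (_∈_)
open import Data.List.Relation.Unary.Unique.Propositional using (Unique)
open import Data.List.Relation.Unary.All using (All)
open import Data.Product using (Σ; _×_; _,_)
open import Data.Sum using (_⊎_)
open import Data.Unit using (⊤)
open import Relation.Nullary using (¬_)
open import Relation.Nullary.Decidable using (⌊_⌋)
open import Relation.Binary.PropositionalEquality using (_≡_)

Graph : ℕ → Set
Graph n = Fin n → Fin n → Bool

Adj : ∀ {n} → Graph n → Fin n → Fin n → Set
Adj g u v = g u v ≡ true

IsSimple : ∀ {n} → Graph n → Set
IsSimple g = (∀ u v → g u v ≡ g v u) × (∀ u → g u u ≡ false)

SameEdge : ∀ {n} → Fin n → Fin n → Fin n → Fin n → Set
SameEdge u v u' v' = (u ≡ u' × v ≡ v') ⊎ (u ≡ v' × v ≡ u')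

countTrue : List Bool → ℕ
countTrue [] = 0
countTrue (true ∷ bs) = suc (countTrue bs)
countTrue (false ∷ bs) = countTrue bs

degree : ∀ {n} → Graph n → Fin n → ℕ
degree {n} g u = countTrue (map (g u) (allFin n))

IsCubic : ∀ {n} → Graph n → Set
IsCubic g = ∀ u → degree g u ≡ 3

-- |δ(X)| : number of edges with exactly one end in X
-- (each such edge counted once, via its orientation from X to the complement)
cutSize : ∀ {n} → Graph n → (Fin n → Bool) → ℕ
cutSize {n} g X =
  sum (map (λ u → countTrue (map (λ v → g u v ∧ X u ∧ not (X v)) (allFin n))) (allFin n))

Chain : ∀ {n} → Graph n → List (Fin n) → Set
Chain g [] = ⊤
Chain g (x ∷ []) = ⊤
Chain g (x ∷ y ∷ r) = Adj g x y × Chain g (y ∷ r)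

IsPath : ∀ {n} → Graph n → Fin n → Fin n → List (Fin n) → Set
IsPath g a b p =
  Unique p × Chain g p
  × Σ (List _) (λ r → p ≡ a ∷ r)
  × Σ (List _) (λ r → p ≡ r ∷ʳ b)

IsCircuit : ∀ {n} → Graph n → List (Fin n) → Set
IsCircuit g p =
  3 ≤ length p × Unique p
  × Σ _ (λ a → Σ (List _) (λ r → p ≡ a ∷ r × Chain g ((a ∷ r) ∷ʳ a)))

GirthAtLeast : ∀ {n} → ℕ → Graph n → Set
GirthAtLeast k g = ∀ p → IsCircuit g p → k ≤ length p

ContainsCircuit : ∀ {n} → Graph n → (Fin n → Bool) → Set
ContainsCircuit g X = Σ _ (λ p → IsCircuit g p × All (λ v → X v ≡ true) p)

IsCyclicallyConnected : ∀ {n} → ℕ → Graph n → Set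
IsCyclicallyConnected k g =
  GirthAtLeast k g ×
  (∀ X → ContainsCircuit g X → ContainsCircuit g (λ v → not (X v)) → k ≤ cutSize g X)

Consec : ∀ {n} → List (Fin n) → Fin n → Fin n → Set
Consec [] a b = Data.Empty.⊥ where import Data.Empty
Consec (x ∷ []) a b = Data.Empty.⊥ where import Data.Empty
Consec (x ∷ y ∷ r) a b = (a ≡ x × b ≡ y) ⊎ Consec (y ∷ r) a b

PathEdge : ∀ {n} → List (Fin n) → Fin n → Fin n → Set
PathEdge p a b = Consec p a b ⊎ Consec p b a

Internal : ∀ {n} → Fin n → Fin n → List (Fin n) → Fin n → Set
Internal a b p x = x ∈ p × ¬ x ≡ a × ¬ x ≡ b

record HomEmb {m n} (g : Graph m) (h : Graph n) : Set where
  field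
    vmap  : Fin m → Fin n
    vinj  : ∀ u v → vmap u ≡ vmap v → u ≡ v
    pmap  : Fin m → Fin m → List (Fin n)
    psym  : ∀ u v → Adj g u v → pmap v u ≡ reverse (pmap u v)
    ppath : ∀ u v → Adj g u v → IsPath h (vmap u) (vmap v) (pmap u v)
    pdisjV : ∀ u v u' v' → Adj g u v → Adj g u' v' → ¬ SameEdge u v u' v' →
             ∀ x → Internal (vmap u) (vmap v) (pmap u v) x → ¬ x ∈ pmap u' v'
    pdisjE : ∀ u v u' v' → Adj g u v → Adj g u' v' → ¬ SameEdge u v u' v' →
             ∀ x y → PathEdge (pmap u v) x y → ¬ PathEdge (pmap u' v') x y
    pends : ∀ w u v → Adj g u v →
             (vmap w ∈ pmap u v → (w ≡ u ⊎ w ≡ v)) × ((w ≡ u ⊎ w ≡ v) → vmap w ∈ pmap u v)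

next5 : Fin 5 → Fin 5
next5 zero = suc zero
next5 (suc zero) = suc (suc zero)
next5 (suc (suc zero)) = suc (suc (suc zero))
next5 (suc (suc (suc zero))) = suc (suc (suc (suc zero)))
next5 (suc (suc (suc (suc zero)))) = zero

IsCircuit5 : ∀ {n} → Graph n → (Fin 5 → Fin n) → Set
IsCircuit5 g c = (∀ i j → c i ≡ c j → i ≡ j) × (∀ i → Adj g (c i) (c (next5 i)))

InEF : ∀ {n} → (Fin 5 → Fin n) → Fin n → Fin n → Set
InEF c u v = Σ (Fin 5) (λ i → SameEdge u v (c i) (c (next5 i)))

InVF : ∀ {n} → (Fin 5 → Fin n) → Fin n → Set
InVF c v = Σ (Fin 5) (λ i → v ≡ c i)

-- η fixes F, where F sits in the source via cG and in the target via cH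
Fixes : ∀ {m n} {g : Graph m} {h : Graph n} → HomEmb g h →
        (Fin 5 → Fin m) → (Fin 5 → Fin n) → Set
Fixes η cG cH =
  (∀ i → HomEmb.vmap η (cG i) ≡ cH i) ×
  (∀ i → HomEmb.pmap η (cG i) (cG (next5 i)) ≡ cH i ∷ cH (next5 i) ∷ [])

FContains : ∀ {m n} → (h : Graph n) → (Fin 5 → Fin n) → (g : Graph m) → (Fin 5 → Fin m) → Set
FContains h cH g cG = Σ (HomEmb g h) (λ η → Fixes η cG cH)

-- G + (ab, cd): vertices x = 0, y = 1, old vertex v = v + 2.

eqb : ∀ {n} → Fin n → Fin n → Bool
eqb u v = ⌊ u ≟ v ⌋

sameb : ∀ {n} → Fin n → Fin n → Fin n → Fin n → Bool
sameb u v a b = (eqb u a ∧ eqb v b) ∨ (eqb u b ∧ eqb v a)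

plus : ∀ {n} → Graph n → Fin n → Fin n → Fin n → Fin n → Graph (suc (suc n))
plus g a b c d zero zero = false
plus g a b c d zero (suc zero) = true
plus g a b c d zero (suc (suc v)) = eqb v a ∨ eqb v b
plus g a b c d (suc zero) zero = true
plus g a b c d (suc zero) (suc zero) = false
plus g a b c d (suc zero) (suc (suc v)) = eqb v c ∨ eqb v d
plus g a b c d (suc (suc u)) zero = eqb u a ∨ eqb u b
plus g a b c d (suc (suc u)) (suc zero) = eqb u c ∨ eqb u d
plus g a b c d (suc (suc u)) (suc (suc v)) =
  g u v ∧ not (sameb u v a b) ∧ not (sameb u v c d)

oldV : ∀ {n} → Fin n → Fin (suc (suc n))
oldV v = suc (suc v)

-- The dodecahedron = generalized Petersen graph GP(10,2):
-- outer vertices u_i = i (0 ≤ i < 10), inner v_i = 10 + i;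
-- edges u_i u_{i+1}, u_i v_i, v_i v_{i+2} (indices mod 10).

dirAdjℕ : ℕ → ℕ → Bool
dirAdjℕ a b =
  ((a <ᵇ 10) ∧ (b <ᵇ 10) ∧ (b ≡ᵇ (suc a % 10)))
  ∨ ((a <ᵇ 10) ∧ (b ≡ᵇ a + 10))
  ∨ (not (a <ᵇ 10) ∧ not (b <ᵇ 10) ∧ (b ≡ᵇ 10 + ((a ∸ 8) % 10)))

dodecahedron : Graph 20
dodecahedron u v = dirAdjℕ (toℕ u) (toℕ v) ∨ dirAdjℕ (toℕ v) (toℕ u)

-- The 12 faces (regions of the unique planar embedding), as cyclic vertex
-- sequences (vertex labels as natural numbers):
--   k < 10 : u_k u_{k+1} u_{k+2} v_{k+2} v_k ;   10 : v_0 v_2 v_4 v_6 v_8 ;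
--   11 : v_1 v_3 v_5 v_7 v_9.
outerFace : ℕ → Fin 5 → ℕ
outerFace k zero = k
outerFace k (suc zero) = suc k % 10
outerFace k (suc (suc zero)) = (2 + k) % 10
outerFace k (suc (suc (suc zero))) = 10 + ((2 + k) % 10)
outerFace k (suc (suc (suc (suc zero)))) = 10 + k

face : Fin 12 → Fin 5 → ℕ
face k i = if (toℕ k <ᵇ 10) then outerFace (toℕ k) i else toℕ k + 2 * toℕ i

FaceIncident : Fin 12 → Fin 20 → Fin 20 → Set
FaceIncident k u v = Σ (Fin 5) (λ i →
  (toℕ u ≡ face k i × toℕ v ≡ face k (next5 i)) ⊎
  (toℕ v ≡ face k i × toℕ u ≡ face k (next5 i)))

HasEndIn : (Fin 5 → Fin 20) → Fin 20 → Fin 20 → Set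
HasEndIn c a b = InVF c a ⊎ InVF c b

IsHop : (Fin 5 → Fin 20) → Fin 20 → Fin 20 → Fin 20 → Fin 20 → Set
IsHop c a b a' b' =
  Adj dodecahedron a b × Adj dodecahedron a' b'
  × ¬ SameEdge a b a' b'
  × ¬ InEF c a b × ¬ InEF c a' b'
  × ¬ (HasEndIn c a b × HasEndIn c a' b')
  × (∀ k → ¬ (FaceIncident k a b × FaceIncident k a' b'))

Diverse : ∀ {n} → Graph n → Fin n → Fin n → Fin n → Fin n → Set
Diverse g a b c d =
  ¬ a ≡ b × ¬ a ≡ c × ¬ a ≡ d × ¬ b ≡ c × ¬ b ≡ d × ¬ c ≡ d
  × ¬ Adj g a c × ¬ Adj g a d × ¬ Adj g b c × ¬ Adj g b d

IsJump : (Fin 5 → Fin 20) → Fin 20 → Fin 20 → Fin 20 → Fin 20 → Set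
IsJump c a b a' b' = IsHop c a b a' b' × Diverse dodecahedron a b a' b'

{-# OPTIONS --safe #-}
module Submission where

-- A hop extension that is not a jump extension is dodecahedron + (ab, cd) for a zigzag path b a c d, so it
-- contains a quadrangle Q through a, c and the two new vertices. Embed it in H. Cyclic connectivity gives a
-- residual walk (in the sense of augmenting paths) from Q to the rest R of the embedded graph, for otherwise
-- the reachable set has at most four boundary edges. If the walk meets one of the four paths leaving Q before
-- R, then Q can be swung so as to absorb the beginning of that path, which shortens the walk. Hence some walk
-- yields an ear from Q to R, and every such ear produces a jump extension: this last claim is a finite check.

-- Q has four leaving edges, one fewer than cyclic connectivity demands of a cut between the circuit
-- of Q and F; this deficit forces the walk. A residual walk may use the leaving paths only against
-- their direction. If it cannot reach R, the set that it reaches is closed under going back along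
-- these paths, so each of the four is left at most once, and no other edge leaves the set. When the
-- walk runs into a leaving path at u, cubicity lets it continue only backwards, into the part that
-- the rotation absorbs; hence the rest of the walk starts on the new quadrangle. Two edges with a
-- common end are cofacial, so a hop that is not a jump has adjacent ends, and a symmetry moves its
-- zigzag to 0 1 2 3. One graph then serves all cases, with F varying over the faces compatible with
-- the hop. All conclusions are refutations, so undecided predicates are split under double
-- negation. An embedding in H keeps the images of distinct vertices and open edges disjoint, so
-- each rerouting certificate is a Boolean computation on names that does not mention H.

open import Defs
open import Data.Nat using (ℕ; zero; suc; _+_; _≤_; _<_; z≤n; s≤s; _≡ᵇ_; _<ᵇ_)
open import Data.Nat.DivMod using (_mod_)
open import Data.Nat.ListAction using (sum)
import Data.Nat.Properties as ℕ
open import Data.Fin using (Fin; toℕ)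
open import Data.Fin.Patterns
import Data.Fin as F
import Data.Fin.Properties as F
open import Data.Bool using (Bool; true; false; _∧_; _∨_; not; if_then_else_; T)
import Data.Bool.Properties as Bool
open import Data.List using (List; []; _∷_; _++_; _∷ʳ_; length; reverse; map; concatMap; filter; allFin; upTo; cartesianProductWith)
import Data.List.Properties as List
open import Data.List.Membership.Propositional using (_∈_; _∉_)
open import Data.List.Membership.Propositional.Properties
import Data.List.Membership.DecPropositional as DecMembership
open import Data.List.Relation.Unary.Any using (Any; here; there)
import Data.List.Relation.Unary.Any.Properties as Any
open import Data.List.Relation.Unary.All as All using (All; []; _∷_)
import Data.List.Relation.Unary.All.Properties as All
open import Data.List.Relation.Unary.AllPairs using ([]; _∷_)
open import Data.List.Relation.Unary.Unique.Propositional using (Unique)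
import Data.List.Relation.Unary.Unique.Propositional.Properties as Unique
open import Data.Product as Product using (Σ; ∃; ∃₂; _×_; _,_; proj₁; proj₂)
import Data.Product.Properties as Product
open import Data.Sum as Sum using (_⊎_; inj₁; inj₂; [_,_]′; swap)
open import Data.Empty using (⊥; ⊥-elim)
open import Function using (_∘_)
open import Relation.Binary.Definitions using (tri<; tri≈; tri>)
open import Relation.Binary.PropositionalEquality
open import Relation.Nullary using (¬_; Dec; yes; no; ¬?)
open import Relation.Nullary.Decidable using (toWitness; ⌊_⌋; _×-dec_; _⊎-dec_; decidable-stable)

-- Lists, chains and counting

private variable
  A B : Set
  n : ℕ

-- Constructive because the goal is absurd; case distinctions on `Occupied`, `Reach` and `InQ` are
-- made in this form.
excluded-middle : ((A ⊎ ¬ A) → ⊥) → ⊥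
excluded-middle k = k (inj₂ (k ∘ inj₁))

∈-reverse⁺ : ∀ {x : A} {xs} → x ∈ xs → x ∈ reverse xs
∈-reverse⁺ = Any.reverse⁺

∈-reverse⁻ : ∀ {x : A} {xs} → x ∈ reverse xs → x ∈ xs
∈-reverse⁻ {xs = xs} p = subst (_ ∈_) (List.reverse-involutive xs) (Any.reverse⁺ p)

∈-∷ʳ⁻ : ∀ {x y : A} xs → x ∈ xs ∷ʳ y → x ∈ xs ⊎ x ≡ y
∈-∷ʳ⁻ xs p with ∈-++⁻ xs p
... | inj₁ q = inj₁ q
... | inj₂ (here e) = inj₂ e

∈-∷ʳ : ∀ {x : A} xs → x ∈ xs ∷ʳ x
∈-∷ʳ xs = ∈-++⁺ʳ xs (here refl)

∉-head : ∀ {x : A} {xs} → Unique (x ∷ xs) → x ∉ xs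
∉-head = Unique.Unique[x∷xs]⇒x∉xs

unique-∷ : ∀ {x : A} {xs} → x ∉ xs → Unique xs → Unique (x ∷ xs)
unique-∷ {xs = xs} x∉ u = All.tabulate (λ y∈ e → x∉ (subst (_∈ xs) (sym e) y∈)) ∷ u

unique-++⁻ˡ : ∀ (xs {ys} : List A) → Unique (xs ++ ys) → Unique xs
unique-++⁻ˡ [] u = []
unique-++⁻ˡ (x ∷ xs) (p ∷ u) = All.++⁻ˡ xs p ∷ unique-++⁻ˡ xs u

unique-++⁻ʳ : ∀ (xs {ys} : List A) → Unique (xs ++ ys) → Unique ys
unique-++⁻ʳ [] u = u
unique-++⁻ʳ (x ∷ xs) (p ∷ u) = unique-++⁻ʳ xs u

unique-++-disjoint : ∀ (xs {ys} : List A) → Unique (xs ++ ys) → ∀ {x} → x ∈ xs → x ∈ ys → ⊥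
unique-++-disjoint (x ∷ xs) (p ∷ u) (here refl) q = All.lookup (All.++⁻ʳ xs p) q refl
unique-++-disjoint (x ∷ xs) (p ∷ u) (there r) q = unique-++-disjoint xs u r q

unique-∷ʳ : ∀ {x : A} xs → x ∉ xs → Unique xs → Unique (xs ∷ʳ x)
unique-∷ʳ xs x∉ u = Unique.++⁺ u ([] ∷ []) λ { (p , here refl) → x∉ p }

unique-reverse : ∀ {xs : List A} → Unique xs → Unique (reverse xs)
unique-reverse [] = []
unique-reverse {xs = x ∷ xs} (p ∷ u) = subst Unique (sym (List.unfold-reverse x xs))
  (unique-∷ʳ (reverse xs) (∉-head (p ∷ u) ∘ ∈-reverse⁻) (unique-reverse u))

-- Duplicate-freeness of a concatenation packs pairwise disjointness of the blocks into one
-- condition that a Boolean test can decide; this lemma and the next unpack it.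
unique-concatMap-owner : ∀ (f : A → List B) xs → Unique (concatMap f xs) →
  ∀ {a b x} → a ∈ xs → b ∈ xs → x ∈ f a → x ∈ f b → a ≡ b
unique-concatMap-owner f (y ∷ xs) u (here refl) (here refl) p q = refl
unique-concatMap-owner f (y ∷ xs) u (here refl) (there b∈) p q =
  ⊥-elim (unique-++-disjoint (f y) u p (∈-concat⁺′ q (∈-map⁺ f b∈)))
unique-concatMap-owner f (y ∷ xs) u (there a∈) (here refl) p q =
  ⊥-elim (unique-++-disjoint (f y) u q (∈-concat⁺′ p (∈-map⁺ f a∈)))
unique-concatMap-owner f (y ∷ xs) u (there a∈) (there b∈) p q =
  unique-concatMap-owner f xs (unique-++⁻ʳ (f y) u) a∈ b∈ p q

unique-concatMap-local : ∀ (f : A → List B) xs → Unique (concatMap f xs) →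
  ∀ {a} → a ∈ xs → Unique (f a)
unique-concatMap-local f (y ∷ xs) u (here refl) = unique-++⁻ˡ (f y) u
unique-concatMap-local f (y ∷ xs) u (there a∈) = unique-concatMap-local f xs (unique-++⁻ʳ (f y) u) a∈

private
  remove : ∀ {x : A} {xs} → x ∈ xs → List A
  remove {xs = _ ∷ xs} (here _) = xs
  remove {xs = y ∷ _} (there p) = y ∷ remove p

  ∈-remove : ∀ {x y : A} {xs} (p : x ∈ xs) → y ∈ xs → y ≢ x → y ∈ remove p
  ∈-remove (here refl) (here refl) ne = ⊥-elim (ne refl)
  ∈-remove (here refl) (there q) ne = q
  ∈-remove (there p) (here refl) ne = here refl
  ∈-remove (there p) (there q) ne = there (∈-remove p q ne)

  length-remove : ∀ {x : A} {xs} (p : x ∈ xs) → length xs ≡ suc (length (remove p))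
  length-remove (here _) = refl
  length-remove (there p) = cong suc (length-remove p)

pigeonhole : ∀ {xs ys : List A} → Unique xs → (∀ {x} → x ∈ xs → x ∈ ys) → length xs ≤ length ys
pigeonhole [] sub = z≤n
pigeonhole {xs = x ∷ xs} (p ∷ u) sub =
  subst (suc (length xs) ≤_) (sym (length-remove (sub (here refl))))
    (s≤s (pigeonhole u λ y∈ → ∈-remove (sub (here refl)) (sub (there y∈))
      λ e → ∉-head (p ∷ u) (subst (_∈ xs) e y∈)))

module _ (f : A → Bool) where

  trues : List A → List A
  trues [] = []
  trues (x ∷ xs) with f x
  ... | true = x ∷ trues xs
  ... | false = trues xs

  length-trues : ∀ xs → length (trues xs) ≡ countTrue (map f xs)
  length-trues [] = refl
  length-trues (x ∷ xs) with f x
  ... | true = cong suc (length-trues xs)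
  ... | false = length-trues xs

  ∈-trues⁻ : ∀ {x} xs → x ∈ trues xs → x ∈ xs × f x ≡ true
  ∈-trues⁻ (y ∷ xs) p with f y in eq
  ∈-trues⁻ (y ∷ xs) (here refl) | true = here refl , eq
  ∈-trues⁻ (y ∷ xs) (there p) | true = Product.map₁ there (∈-trues⁻ xs p)
  ∈-trues⁻ (y ∷ xs) p | false = Product.map₁ there (∈-trues⁻ xs p)

  ∈-trues⁺ : ∀ {x xs} → x ∈ xs → f x ≡ true → x ∈ trues xs
  ∈-trues⁺ {xs = y ∷ xs} (here refl) e rewrite e = here refl
  ∈-trues⁺ {xs = y ∷ xs} (there p) e with f y
  ... | true = there (∈-trues⁺ p e)
  ... | false = ∈-trues⁺ p e

  unique-trues : ∀ {xs} → Unique xs → Unique (trues xs)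
  unique-trues [] = []
  unique-trues {xs = x ∷ xs} (p ∷ u) with f x
  ... | true = unique-∷ (λ q → ∉-head (p ∷ u) (proj₁ (∈-trues⁻ xs q))) (unique-trues u)
  ... | false = unique-trues u

-- A fourth neighbour would give four distinct entries among the `true` positions of a row that has
-- only three.
cubic-neighbour : ∀ (g : Graph n) → IsCubic g → ∀ {u x y z} → Unique (x ∷ y ∷ z ∷ []) →
  Adj g u x → Adj g u y → Adj g u z → ∀ {w} → Adj g u w → w ∈ x ∷ y ∷ z ∷ []
cubic-neighbour {n} g cubic {u} {x} {y} {z} uniq ax ay az {w} aw with w F.≟ x | w F.≟ y | w F.≟ z
... | yes refl | _ | _ = here refl
... | no _ | yes refl | _ = there (here refl)
... | no _ | no _ | yes refl = there (there (here refl))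
... | no w≢x | no w≢y | no w≢z = ⊥-elim (ℕ.<-irrefl refl 4≤3)
  where
  adjacent : ∀ {v} → v ∈ w ∷ x ∷ y ∷ z ∷ [] → v ∈ trues (g u) (allFin n)
  adjacent (here refl) = ∈-trues⁺ (g u) (∈-allFin _) aw
  adjacent (there (here refl)) = ∈-trues⁺ (g u) (∈-allFin _) ax
  adjacent (there (there (here refl))) = ∈-trues⁺ (g u) (∈-allFin _) ay
  adjacent (there (there (there (here refl)))) = ∈-trues⁺ (g u) (∈-allFin _) az
  4≤3 : 4 ≤ 3
  4≤3 = subst (4 ≤_) (trans (length-trues (g u) (allFin n)) (cubic u))
          (pigeonhole ((w≢x ∷ w≢y ∷ w≢z ∷ []) ∷ uniq) adjacent)

-- The crossing pairs, listed row by row without repetition, number exactly `cutSize g X`; it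
-- remains to fit them into `L`, which may contain repetitions and further pairs.
cutSize-≤ : ∀ (g : Graph n) (X : Fin n → Bool) (L : List (Fin n × Fin n)) →
  (∀ u v → Adj g u v → X u ≡ true → X v ≡ false → (u , v) ∈ L) → cutSize g X ≤ length L
cutSize-≤ {n} g X L cross = subst (_≤ length L) (total (allFin n)) (pigeonhole (uniq (allFin n) (Unique.allFin⁺ n)) sub)
  where
  f : Fin n → Fin n → Bool
  f u v = g u v ∧ X u ∧ not (X v)
  row : Fin n → List (Fin n × Fin n)
  row u = map (u ,_) (trues (f u) (allFin n))
  pairs : List (Fin n) → List (Fin n × Fin n)
  pairs = concatMap row
  total : ∀ us → length (pairs us) ≡ sum (map (λ u → countTrue (map (f u) (allFin n))) us)
  total [] = refl
  total (u ∷ us) = trans (List.length-++ (row u))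
    (cong₂ _+_ (trans (List.length-map (u ,_) (trues (f u) (allFin n))) (length-trues (f u) (allFin n))) (total us))
  row-fst : ∀ {p u} → p ∈ row u → proj₁ p ≡ u
  row-fst q with ∈-map⁻ _ q
  ... | _ , _ , refl = refl
  uniq : ∀ us → Unique us → Unique (pairs us)
  uniq [] _ = []
  uniq (u ∷ us) (p ∷ q) = Unique.++⁺
    (Unique.map⁺ (λ { refl → refl }) (unique-trues (f u) (Unique.allFin⁺ n))) (uniq us q) disjoint
    where
    disjoint : ∀ {r} → ¬ (r ∈ row u × r ∈ pairs us)
    disjoint (i , j) with ∈-concat⁻′ (map row us) j
    ... | _ , k , l with ∈-map⁻ row l
    ... | v , v∈ , refl = ∉-head (p ∷ q) (subst (_∈ us) (trans (sym (row-fst k)) (row-fst i)) v∈)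
  split : ∀ b c d → b ∧ c ∧ not d ≡ true → b ≡ true × c ≡ true × d ≡ false
  split true true false e = refl , refl , refl
  sub : ∀ {p} → p ∈ pairs (allFin n) → p ∈ L
  sub i with ∈-concat⁻′ (map row (allFin n)) i
  ... | _ , k , l with ∈-map⁻ row l
  ... | u , _ , refl with ∈-map⁻ _ k
  ... | v , m , refl with split (g u v) (X u) (X v) (proj₂ (∈-trues⁻ (f u) (allFin n) m))
  ... | a , b , c = cross u v a b c

module _ (g : Graph n) where

  chain-++⁺ : ∀ xs {a ys} → Chain g (xs ∷ʳ a) → Chain g (a ∷ ys) → Chain g (xs ++ a ∷ ys)
  chain-++⁺ [] p q = q
  chain-++⁺ (x ∷ []) (xa , _) q = xa , q
  chain-++⁺ (x ∷ y ∷ xs) (xy , p) q = xy , chain-++⁺ (y ∷ xs) p q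

  chain-++⁻ˡ : ∀ xs {a ys} → Chain g (xs ++ a ∷ ys) → Chain g (xs ∷ʳ a)
  chain-++⁻ˡ [] p = _
  chain-++⁻ˡ (x ∷ []) (xa , p) = xa , _
  chain-++⁻ˡ (x ∷ y ∷ xs) (xy , p) = xy , chain-++⁻ˡ (y ∷ xs) p

  chain-++⁻ʳ : ∀ xs {a ys} → Chain g (xs ++ a ∷ ys) → Chain g (a ∷ ys)
  chain-++⁻ʳ [] p = p
  chain-++⁻ʳ (x ∷ []) (xa , p) = p
  chain-++⁻ʳ (x ∷ y ∷ xs) (xy , p) = chain-++⁻ʳ (y ∷ xs) p

  chain-reverse : (∀ u v → g u v ≡ g v u) → ∀ xs → Chain g xs → Chain g (reverse xs)
  chain-reverse s [] c = _
  chain-reverse s (x ∷ []) c = _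
  chain-reverse s (x ∷ y ∷ xs) (xy , c) =
    subst (Chain g) (sym (trans (List.unfold-reverse x (y ∷ xs)) (trans (cong (_∷ʳ x) (List.unfold-reverse y xs)) (List.++-assoc (reverse xs) _ _))))
      (chain-++⁺ (reverse xs) (subst (Chain g) (List.unfold-reverse y xs) (chain-reverse s (y ∷ xs) c))
        (trans (s y x) xy , _))

reverse-path : ∀ (a b : A) xs → reverse (a ∷ xs ∷ʳ b) ≡ b ∷ reverse xs ∷ʳ a
reverse-path a b xs = trans (List.unfold-reverse a (xs ∷ʳ b)) (cong (_∷ʳ a) (List.reverse-++ xs (b ∷ [])))

consec-++⁻ : ∀ xs {a ys} {x y : Fin n} → Consec (xs ++ a ∷ ys) x y → Consec (xs ∷ʳ a) x y ⊎ Consec (a ∷ ys) x y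
consec-++⁻ [] c = inj₂ c
consec-++⁻ (x ∷ []) (inj₁ e) = inj₁ (inj₁ e)
consec-++⁻ (x ∷ []) (inj₂ c) = inj₂ c
consec-++⁻ (x ∷ y ∷ xs) (inj₁ e) = inj₁ (inj₁ e)
consec-++⁻ (x ∷ y ∷ xs) (inj₂ c) = Sum.map₁ inj₂ (consec-++⁻ (y ∷ xs) c)

consec-++⁺ʳ : ∀ xs {a ys} {x y : Fin n} → Consec (a ∷ ys) x y → Consec (xs ++ a ∷ ys) x y
consec-++⁺ʳ [] c = c
consec-++⁺ʳ (x ∷ []) c = inj₂ c
consec-++⁺ʳ (x ∷ y ∷ xs) c = inj₂ (consec-++⁺ʳ (y ∷ xs) c)

consec-fst : ∀ xs {b} {x y : Fin n} → Consec (xs ∷ʳ b) x y → x ∈ xs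
consec-fst (z ∷ []) (inj₁ (refl , _)) = here refl
consec-fst (z ∷ []) (inj₂ ())
consec-fst (z ∷ w ∷ xs) (inj₁ (refl , _)) = here refl
consec-fst (z ∷ w ∷ xs) (inj₂ c) = there (consec-fst (w ∷ xs) c)

consec-∈₁ : ∀ xs {x y : Fin n} → Consec xs x y → x ∈ xs
consec-∈₁ (z ∷ w ∷ xs) (inj₁ (refl , _)) = here refl
consec-∈₁ (z ∷ w ∷ xs) (inj₂ c) = there (consec-∈₁ (w ∷ xs) c)

consec-∈₂ : ∀ xs {x y : Fin n} → Consec xs x y → y ∈ xs
consec-∈₂ (z ∷ w ∷ xs) (inj₁ (_ , refl)) = there (here refl)
consec-∈₂ (z ∷ w ∷ xs) (inj₂ c) = there (consec-∈₂ (w ∷ xs) c)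

consec-≢ : ∀ xs {x y : Fin n} → Unique xs → Consec xs x y → x ≢ y
consec-≢ (z ∷ w ∷ xs) u (inj₁ (refl , refl)) e = ∉-head u (here e)
consec-≢ (z ∷ w ∷ xs) (_ ∷ u) (inj₂ c) e = consec-≢ (w ∷ xs) u c e

-- Topological embeddings

Edges : Set
Edges = List (ℕ × ℕ)

Edge : Edges → ℕ → ℕ → Set
Edge ES u v = (u , v) ∈ ES ⊎ (v , u) ∈ ES

_≟ₑ_ : (e f : ℕ × ℕ) → Dec (e ≡ f)
_≟ₑ_ = Product.≡-dec ℕ._≟_ ℕ._≟_

open DecMembership _≟ₑ_ using (_∈?_)

subdivide : ℕ → ℕ × ℕ → Edges → Edges
subdivide X (a , b) ES = (a , X) ∷ (X , b) ∷ filter (λ e → ¬? (e ≟ₑ (a , b))) ES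

-- The feet of the ear take the next two numbers, `N` on e and `suc N` on f, so that all old names
-- stay valid.
addEar : ℕ → ℕ × ℕ → ℕ × ℕ → Edges → Edges
addEar N e f ES = (N , suc N) ∷ subdivide (suc N) f (subdivide N e ES)

≡ᵇ-refl : ∀ m → (m ≡ᵇ m) ≡ true
≡ᵇ-refl zero = refl
≡ᵇ-refl (suc m) = ≡ᵇ-refl m

≢⇒≡ᵇ : ∀ m n → m ≢ n → (m ≡ᵇ n) ≡ false
≢⇒≡ᵇ zero zero ne = ⊥-elim (ne refl)
≢⇒≡ᵇ zero (suc n) ne = refl
≢⇒≡ᵇ (suc m) zero ne = refl
≢⇒≡ᵇ (suc m) (suc n) ne = ≢⇒≡ᵇ m n (ne ∘ cong suc)

≡ᵇ⇒≡′ : ∀ m n → (m ≡ᵇ n) ≡ true → m ≡ n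
≡ᵇ⇒≡′ m n e = ℕ.≡ᵇ⇒≡ m n (subst T (sym e) _)

-- The pieces of an embedded graph: branch vertices and open edges. Distinct pieces have disjoint
-- images in `H`, so disjointness of routes becomes inequality of names.
data Atom : Set where
  pt : ℕ → Atom
  seg : ℕ → ℕ → Atom

-- A route may run through an edge in either direction; the smaller end comes first so that both
-- directions get the same name.
at : ℕ → ℕ → Atom
at u v = if u <ᵇ v then seg u v else seg v u

private
  <ᵇ-true : ∀ {m n} → m < n → (m <ᵇ n) ≡ true
  <ᵇ-true {zero} (s≤s p) = refl
  <ᵇ-true {suc m} (s≤s (s≤s p)) = <ᵇ-true (s≤s p)

  <ᵇ-false : ∀ {m n} → n ≤ m → (m <ᵇ n) ≡ false
  <ᵇ-false {zero} z≤n = refl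
  <ᵇ-false {suc m} z≤n = refl
  <ᵇ-false (s≤s p) = <ᵇ-false p

at-sym : ∀ {u v} → u ≢ v → at u v ≡ at v u
at-sym {u} {v} ne with ℕ.<-cmp u v
... | tri< l _ _ rewrite <ᵇ-true l | <ᵇ-false (ℕ.<⇒≤ l) = refl
... | tri≈ _ e _ = ⊥-elim (ne e)
... | tri> _ _ l rewrite <ᵇ-true l | <ᵇ-false (ℕ.<⇒≤ l) = refl

data Route (ES : Edges) : ℕ → ℕ → List ℕ → Set where
  one : ∀ {u v} → Edge ES u v → Route ES u v (u ∷ v ∷ [])
  _∷_ : ∀ {u v w x r} → Edge ES u v → Route ES v w (v ∷ x ∷ r) → Route ES u w (u ∷ v ∷ x ∷ r)

interior : List ℕ → List Atom
interior (u ∷ v ∷ w ∷ r) = at u v ∷ pt v ∷ interior (v ∷ w ∷ r)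
interior (u ∷ v ∷ []) = at u v ∷ []
interior _ = []

image : (ℕ → ℕ) → (ℕ → ℕ → List ℕ) → Atom → List Atom
image φ route (pt v) = pt (φ v) ∷ []
image φ route (seg u v) = interior (route u v)

atoms : ℕ → Edges → List Atom
atoms N ES = map pt (upTo N) ++ map (λ (u , v) → seg u v) ES

-- The combinatorial data showing that the second graph has a subdivision in the first: the edge uv goes to
-- the path route u v.
record Reroute (N : ℕ) (ES : Edges) (N′ : ℕ) (ES′ : Edges) (φ : ℕ → ℕ) (route : ℕ → ℕ → List ℕ) : Set where
  field
    bound : ∀ {u v} → (u , v) ∈ ES′ → u < N′ × v < N′
    loopless : ∀ {u v} → (u , v) ∈ ES′ → u ≢ v
    oriented : ∀ {u v} → (u , v) ∈ ES′ → (v , u) ∉ ES′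
    φ-bound : ∀ {v} → v < N′ → φ v < N
    routes : ∀ {u v} → (u , v) ∈ ES′ → Route ES (φ u) (φ v) (route u v)
    -- This single condition says that branch vertices are distinct, that each route is simple, and
    -- that routes meet neither each other nor branch vertices except at their ends.
    unique : Unique (concatMap (image φ route) (atoms N′ ES′))

pt∈atoms : ∀ {N v} ES → v < N → pt v ∈ atoms N ES
pt∈atoms ES l = ∈-++⁺ˡ (∈-map⁺ pt (∈-upTo⁺ l))

seg∈atoms : ∀ {ES u v} N → (u , v) ∈ ES → seg u v ∈ atoms N ES
seg∈atoms N e = ∈-++⁺ʳ (map pt (upTo N)) (∈-map⁺ _ e)

module Topological {n} (H : Graph n) (H-sym : ∀ u v → H u v ≡ H v u) where

  -- A homeomorphic embedding of the graph with vertices 0 … N-1 and edges ES; sg u v lists the internal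
  -- vertices of the path that represents uv.
  record Embedding (N : ℕ) (ES : Edges) : Set where
    field
      vm : ℕ → Fin n
      sg : ℕ → ℕ → List (Fin n)
      bound : ∀ {u v} → (u , v) ∈ ES → u < N × v < N
      loopless : ∀ {u v} → (u , v) ∈ ES → u ≢ v
      sg-rev : ∀ {u v} → (u , v) ∈ ES → sg v u ≡ reverse (sg u v)
      sg-chain : ∀ {u v} → (u , v) ∈ ES → Chain H (vm u ∷ sg u v ∷ʳ vm v)
      sg-unique : ∀ {u v} → (u , v) ∈ ES → Unique (sg u v)
      vm-inj : ∀ {u v} → u < N → v < N → vm u ≡ vm v → u ≡ v
      vm∉sg : ∀ {w u v} → w < N → (u , v) ∈ ES → vm w ∉ sg u v
      sg-owner : ∀ {u v u′ v′ x} → (u , v) ∈ ES → (u′ , v′) ∈ ES → x ∈ sg u v → x ∈ sg u′ v′ → (u , v) ≡ (u′ , v′)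

    path : ℕ → ℕ → List (Fin n)
    path u v = vm u ∷ sg u v ∷ʳ vm v

    rev : ∀ {u v} → Edge ES u v → sg v u ≡ reverse (sg u v)
    rev (inj₁ e) = sg-rev e
    rev {u} {v} (inj₂ e) = trans (sym (List.reverse-involutive _)) (cong reverse (sym (sg-rev e)))

    path-rev : ∀ {u v} → Edge ES u v → path v u ≡ reverse (path u v)
    path-rev {u} {v} e = trans (cong (λ l → vm v ∷ l ∷ʳ vm u) (rev e)) (sym (reverse-path (vm u) (vm v) (sg u v)))

    path-chain : ∀ {u v} → Edge ES u v → Chain H (path u v)
    path-chain (inj₁ e) = sg-chain e
    path-chain {u} {v} (inj₂ e) = subst (Chain H) (sym (path-rev (inj₁ e))) (chain-reverse H H-sym _ (sg-chain e))

    unique : ∀ {u v} → Edge ES u v → Unique (sg u v)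
    unique (inj₁ e) = sg-unique e
    unique (inj₂ e) = subst Unique (sym (sg-rev e)) (unique-reverse (sg-unique e))

    edge-bound : ∀ {u v} → Edge ES u v → u < N × v < N
    edge-bound (inj₁ e) = bound e
    edge-bound (inj₂ e) = proj₂ (bound e) , proj₁ (bound e)

    edge-≢ : ∀ {u v} → Edge ES u v → u ≢ v
    edge-≢ (inj₁ e) = loopless e
    edge-≢ (inj₂ e) = loopless e ∘ sym

    ∈-flip : ∀ {u v x} → Edge ES u v → x ∈ sg u v → x ∈ sg v u
    ∈-flip e p = subst (_ ∈_) (sym (rev e)) (∈-reverse⁺ p)

    vm∉ : ∀ {w u v} → w < N → Edge ES u v → vm w ∉ sg u v
    vm∉ l (inj₁ e) p = vm∉sg l e p
    vm∉ l (inj₂ e) p = vm∉sg l e (∈-flip (inj₂ e) p)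

    owner : ∀ {u v u′ v′ x} → Edge ES u v → Edge ES u′ v′ → x ∈ sg u v → x ∈ sg u′ v′ → (u ≡ u′ × v ≡ v′) ⊎ (u ≡ v′ × v ≡ u′)
    owner (inj₁ e) (inj₁ f) p q with sg-owner e f p q
    ... | refl = inj₁ (refl , refl)
    owner (inj₁ e) (inj₂ f) p q with sg-owner e f p (∈-flip (inj₂ f) q)
    ... | refl = inj₂ (refl , refl)
    owner (inj₂ e) (inj₁ f) p q with sg-owner e f (∈-flip (inj₂ e) p) q
    ... | refl = inj₂ (refl , refl)
    owner (inj₂ e) (inj₂ f) p q with sg-owner e f (∈-flip (inj₂ e) p) (∈-flip (inj₂ f) q)
    ... | refl = inj₁ (refl , refl)

    path-unique : ∀ {u v} → Edge ES u v → Unique (path u v)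
    path-unique {u} {v} e = unique-∷ notin (unique-∷ʳ (sg u v) (vm∉ (proj₂ (edge-bound e)) e) (unique e))
      where
      notin : vm u ∉ sg u v ∷ʳ vm v
      notin p with ∈-∷ʳ⁻ (sg u v) p
      ... | inj₁ q = vm∉ (proj₁ (edge-bound e)) e q
      ... | inj₂ q = edge-≢ e (vm-inj (proj₁ (edge-bound e)) (proj₂ (edge-bound e)) q)

    Occupied : Fin n → Set
    Occupied x = (∃ λ w → w < N × x ≡ vm w) ⊎ (∃₂ λ u v → (u , v) ∈ ES × x ∈ sg u v)

  module _ {N ES} (ρ : Embedding N ES) where
    open Embedding ρ

    module _ {a b p l₁ l₂} (ab : (a , b) ∈ ES) (eq : sg a b ≡ l₁ ++ p ∷ l₂) where
      private
        vm₁ : ℕ → Fin n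
        vm₁ v = if v ≡ᵇ N then p else vm v

        sg₁ : ℕ → ℕ → List (Fin n)
        sg₁ u v = if v ≡ᵇ N then (if u ≡ᵇ a then l₁ else reverse l₂)
                  else if u ≡ᵇ N then (if v ≡ᵇ a then reverse l₁ else l₂)
                  else sg u v

        old≢ : ∀ {v} → v < N → (v ≡ᵇ N) ≡ false
        old≢ l = ≢⇒≡ᵇ _ _ (ℕ.<⇒≢ l)

        vm-new : vm₁ N ≡ p
        vm-new rewrite ≡ᵇ-refl N = refl

        vm-old : ∀ {v} → v < N → vm₁ v ≡ vm v
        vm-old l rewrite old≢ l = refl

        sg-aX : sg₁ a N ≡ l₁
        sg-aX rewrite ≡ᵇ-refl N | ≡ᵇ-refl a = refl

        sg-Xa : sg₁ N a ≡ reverse l₁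
        sg-Xa rewrite old≢ (proj₁ (bound ab)) | ≡ᵇ-refl N | ≡ᵇ-refl a = refl

        b≢a : (b ≡ᵇ a) ≡ false
        b≢a = ≢⇒≡ᵇ b a (loopless ab ∘ sym)

        sg-Xb : sg₁ N b ≡ l₂
        sg-Xb rewrite old≢ (proj₂ (bound ab)) | ≡ᵇ-refl N | b≢a = refl

        sg-bX : sg₁ b N ≡ reverse l₂
        sg-bX rewrite ≡ᵇ-refl N | b≢a = refl

        sg-old : ∀ {u v} → u < N → v < N → sg₁ u v ≡ sg u v
        sg-old l m rewrite old≢ l | old≢ m = refl

        ES₁ = subdivide N (a , b) ES

        data View : ℕ → ℕ → Set where
          left : View a N
          right : View N b
          old : ∀ {u v} → (u , v) ∈ ES → (u , v) ≢ (a , b) → View u v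

        view : ∀ {u v} → (u , v) ∈ ES₁ → View u v
        view (here refl) = left
        view (there (here refl)) = right
        view (there (there e)) with ∈-filter⁻ (λ e → ¬? (e ≟ₑ (a , b))) {xs = ES} e
        ... | e∈ , ne = old e∈ ne

        uniq : Unique (l₁ ++ p ∷ l₂)
        uniq = subst Unique eq (sg-unique ab)

        l₁⊆ : ∀ {x} → x ∈ l₁ → x ∈ sg a b
        l₁⊆ q = subst (_ ∈_) (sym eq) (∈-++⁺ˡ q)

        l₂⊆ : ∀ {x} → x ∈ l₂ → x ∈ sg a b
        l₂⊆ q = subst (_ ∈_) (sym eq) (∈-++⁺ʳ l₁ (there q))

        p∈ : p ∈ sg a b
        p∈ = subst (_ ∈_) (sym eq) (∈-++⁺ʳ l₁ (here refl))

        whole : Chain H ((vm a ∷ l₁) ++ p ∷ (l₂ ∷ʳ vm b))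
        whole = subst (Chain H) (cong (vm a ∷_) (trans (cong (_∷ʳ vm b) eq) (List.++-assoc l₁ _ _))) (sg-chain ab)

        a<N = proj₁ (bound ab)
        b<N = proj₂ (bound ab)

        -- Each new path lies in the path of one old edge, so disjointness is inherited. Only the
        -- two halves of ab share a parent, and the duplicate-free list `l₁ ++ p ∷ l₂` keeps them
        -- apart.
        parent : ∀ {u v} → View u v → ℕ × ℕ
        parent left = a , b
        parent right = a , b
        parent {u} {v} (old _ _) = u , v

        parent∈ : ∀ {u v} (w : View u v) → parent w ∈ ES
        parent∈ left = ab
        parent∈ right = ab
        parent∈ (old e _) = e

        ∈-parent : ∀ {u v x} (w : View u v) → x ∈ sg₁ u v → x ∈ sg (proj₁ (parent w)) (proj₂ (parent w))
        ∈-parent left q = l₁⊆ (subst (_ ∈_) sg-aX q)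
        ∈-parent right q = l₂⊆ (subst (_ ∈_) sg-Xb q)
        ∈-parent (old e _) q = subst (_ ∈_) (sg-old (proj₁ (bound e)) (proj₂ (bound e))) q

        parent-inj : ∀ {u v u′ v′ x} (w : View u v) (w′ : View u′ v′) → parent w ≡ parent w′ →
          x ∈ sg₁ u v → x ∈ sg₁ u′ v′ → (u , v) ≡ (u′ , v′)
        parent-inj left left _ _ _ = refl
        parent-inj left right _ q r = ⊥-elim (unique-++-disjoint l₁ uniq (subst (_ ∈_) sg-aX q) (there (subst (_ ∈_) sg-Xb r)))
        parent-inj left (old _ ne) e _ _ = ⊥-elim (ne (sym e))
        parent-inj right left _ q r = ⊥-elim (unique-++-disjoint l₁ uniq (subst (_ ∈_) sg-aX r) (there (subst (_ ∈_) sg-Xb q)))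
        parent-inj right right _ _ _ = refl
        parent-inj right (old _ ne) e _ _ = ⊥-elim (ne (sym e))
        parent-inj (old _ ne) left e _ _ = ⊥-elim (ne e)
        parent-inj (old _ ne) right e _ _ = ⊥-elim (ne e)
        parent-inj (old _ _) (old _ _) e _ _ = e

        p∉ : ∀ {u v} → View u v → p ∉ sg₁ u v
        p∉ left q = unique-++-disjoint l₁ uniq (subst (_ ∈_) sg-aX q) (here refl)
        p∉ right q = ∉-head (unique-++⁻ʳ l₁ uniq) (subst (_ ∈_) sg-Xb q)
        p∉ w@(old e ne) q = ne (sg-owner e ab (∈-parent w q) p∈)

        split< : ∀ {v} → v < suc N → v < N ⊎ v ≡ N
        split< l = ℕ.m<1+n⇒m<n∨m≡n l

        up : ∀ {v} → v < N → v < suc N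
        up = ℕ.m<n⇒m<1+n

      subdivided : Embedding (suc N) (subdivide N (a , b) ES)
      subdivided = record
        { vm = vm₁ ; sg = sg₁
        ; bound = λ e → bound₁ (view e)
        ; loopless = λ e → loopless₁ (view e)
        ; sg-rev = λ e → rev₁ (view e)
        ; sg-chain = λ e → chain₁ (view e)
        ; sg-unique = λ e → unique₁ (view e)
        ; vm-inj = λ l m → inj₁′ (split< l) (split< m)
        ; vm∉sg = λ l e → vm∉₁ (split< l) (view e)
        ; sg-owner = λ e f q r → parent-inj (view e) (view f)
            (sg-owner (parent∈ (view e)) (parent∈ (view f)) (∈-parent (view e) q) (∈-parent (view f) r)) q r
        }
        where
        bound₁ : ∀ {u v} → View u v → u < suc N × v < suc N
        bound₁ left = up a<N , ℕ.n<1+n N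
        bound₁ right = ℕ.n<1+n N , up b<N
        bound₁ (old e _) = up (proj₁ (bound e)) , up (proj₂ (bound e))
        loopless₁ : ∀ {u v} → View u v → u ≢ v
        loopless₁ left = ℕ.<⇒≢ a<N
        loopless₁ right = ℕ.<⇒≢ b<N ∘ sym
        loopless₁ (old e _) = loopless e
        rev₁ : ∀ {u v} → View u v → sg₁ v u ≡ reverse (sg₁ u v)
        rev₁ left = trans sg-Xa (cong reverse (sym sg-aX))
        rev₁ right = trans sg-bX (cong reverse (sym sg-Xb))
        rev₁ (old e _) with bound e
        ... | l , m = trans (sg-old m l) (trans (sg-rev e) (cong reverse (sym (sg-old l m))))
        chain₁ : ∀ {u v} → View u v → Chain H (vm₁ u ∷ sg₁ u v ∷ʳ vm₁ v)
        chain₁ left rewrite vm-old a<N | vm-new | sg-aX = chain-++⁻ˡ H (vm a ∷ l₁) whole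
        chain₁ right rewrite vm-old b<N | vm-new | sg-Xb = chain-++⁻ʳ H (vm a ∷ l₁) whole
        chain₁ (old e _) rewrite vm-old (proj₁ (bound e)) | vm-old (proj₂ (bound e))
          | sg-old (proj₁ (bound e)) (proj₂ (bound e)) = sg-chain e
        unique₁ : ∀ {u v} → View u v → Unique (sg₁ u v)
        unique₁ left rewrite sg-aX = unique-++⁻ˡ l₁ uniq
        unique₁ right rewrite sg-Xb with unique-++⁻ʳ l₁ uniq
        ... | _ ∷ u = u
        unique₁ (old e _) rewrite sg-old (proj₁ (bound e)) (proj₂ (bound e)) = sg-unique e
        inj₁′ : ∀ {u v} → u < N ⊎ u ≡ N → v < N ⊎ v ≡ N → vm₁ u ≡ vm₁ v → u ≡ v
        inj₁′ (inj₁ l) (inj₁ m) e = vm-inj l m (trans (sym (vm-old l)) (trans e (vm-old m)))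
        inj₁′ (inj₁ l) (inj₂ refl) e = ⊥-elim (vm∉sg l ab (subst (_∈ sg a b) (trans (sym vm-new) (trans (sym e) (vm-old l))) p∈))
        inj₁′ (inj₂ refl) (inj₁ m) e = ⊥-elim (vm∉sg m ab (subst (_∈ sg a b) (trans (sym vm-new) (trans e (vm-old m))) p∈))
        inj₁′ (inj₂ refl) (inj₂ refl) e = refl
        vm∉₁ : ∀ {w u v} → w < N ⊎ w ≡ N → View u v → vm₁ w ∉ sg₁ u v
        vm∉₁ (inj₁ l) w q = vm∉sg l (parent∈ w) (∈-parent w (subst (_∈ _) (vm-old l) q))
        vm∉₁ (inj₂ refl) w q = p∉ w (subst (_∈ _) vm-new q)

      subdivided-vm : ∀ {v} → v < N → Embedding.vm subdivided v ≡ vm v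
      subdivided-vm = vm-old

      subdivided-vm-new : Embedding.vm subdivided N ≡ p
      subdivided-vm-new = vm-new

      subdivided-sg : ∀ {u v} → u < N → v < N → Embedding.sg subdivided u v ≡ sg u v
      subdivided-sg = sg-old

      subdivided-left : Embedding.sg subdivided a N ≡ l₁
      subdivided-left = sg-aX

      subdivided-right : Embedding.sg subdivided N b ≡ l₂
      subdivided-right = sg-Xb

      -- Subdividing does not enlarge the image, so an ear that avoids the image before still avoids
      -- it afterwards.
      subdivided-occupied : ∀ {x} → Embedding.Occupied subdivided x → Occupied x
      subdivided-occupied (inj₁ (w , l , e)) with split< l
      ... | inj₁ m = inj₁ (w , m , trans e (vm-old m))
      ... | inj₂ refl = inj₂ (a , b , ab , subst (_∈ sg a b) (sym (trans e vm-new)) p∈)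
      subdivided-occupied (inj₂ (u , v , e , q)) = inj₂ (_ , _ , parent∈ (view e) , ∈-parent (view e) q)

    module _ {X Y E} (X<N : X < N) (Y<N : Y < N) (X≢Y : X ≢ Y) (fresh : ¬ Edge ES X Y)
             (chain : Chain H (vm X ∷ E ∷ʳ vm Y)) (uniqE : Unique E) (free : ∀ {x} → x ∈ E → ¬ Occupied x) where
      private
        sg₁ : ℕ → ℕ → List (Fin n)
        sg₁ u v with (u , v) ≟ₑ (X , Y) | (u , v) ≟ₑ (Y , X)
        ... | yes _ | _ = E
        ... | no _ | yes _ = reverse E
        ... | no _ | no _ = sg u v

        sg-XY : sg₁ X Y ≡ E
        sg-XY with (X , Y) ≟ₑ (X , Y) | (X , Y) ≟ₑ (Y , X)
        ... | yes _ | _ = refl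
        ... | no ne | _ = ⊥-elim (ne refl)

        sg-YX : sg₁ Y X ≡ reverse E
        sg-YX with (Y , X) ≟ₑ (X , Y) | (Y , X) ≟ₑ (Y , X)
        ... | yes refl | _ = ⊥-elim (X≢Y refl)
        ... | no _ | yes _ = refl
        ... | no _ | no ne = ⊥-elim (ne refl)

        sg-old : ∀ {u v} → (u , v) ≢ (X , Y) → (u , v) ≢ (Y , X) → sg₁ u v ≡ sg u v
        sg-old {u} {v} ne ne′ with (u , v) ≟ₑ (X , Y) | (u , v) ≟ₑ (Y , X)
        ... | yes e | _ = ⊥-elim (ne e)
        ... | no _ | yes e = ⊥-elim (ne′ e)
        ... | no _ | no _ = refl

        sg-edge : ∀ {u v} → Edge ES u v → sg₁ u v ≡ sg u v
        sg-edge e = sg-old (λ { refl → fresh e }) (λ { refl → fresh (swap e) })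

        rev₁ : ∀ {u v} → (u , v) ∈ (X , Y) ∷ ES → sg₁ v u ≡ reverse (sg₁ u v)
        rev₁ (here refl) = trans sg-YX (cong reverse (sym sg-XY))
        rev₁ (there e) = trans (sg-edge (inj₂ e)) (trans (sg-rev e) (cong reverse (sym (sg-edge (inj₁ e)))))
        chain₁ : ∀ {u v} → (u , v) ∈ (X , Y) ∷ ES → Chain H (vm u ∷ sg₁ u v ∷ʳ vm v)
        chain₁ (here refl) rewrite sg-XY = chain
        chain₁ (there e) rewrite sg-edge (inj₁ e) = sg-chain e
        unique₁ : ∀ {u v} → (u , v) ∈ (X , Y) ∷ ES → Unique (sg₁ u v)
        unique₁ (here refl) rewrite sg-XY = uniqE
        unique₁ (there e) rewrite sg-edge (inj₁ e) = sg-unique e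
        vm∉₁ : ∀ {w u v} → w < N → (u , v) ∈ (X , Y) ∷ ES → vm w ∉ sg₁ u v
        vm∉₁ l (here refl) q = free (subst (_ ∈_) sg-XY q) (inj₁ (_ , l , refl))
        vm∉₁ l (there e) q = vm∉sg l e (subst (_ ∈_) (sg-edge (inj₁ e)) q)
        owner₁ : ∀ {u v u′ v′ x} → (u , v) ∈ (X , Y) ∷ ES → (u′ , v′) ∈ (X , Y) ∷ ES → x ∈ sg₁ u v → x ∈ sg₁ u′ v′ → (u , v) ≡ (u′ , v′)
        owner₁ (here refl) (here refl) q r = refl
        owner₁ (here refl) (there f) q r = ⊥-elim (free (subst (_ ∈_) sg-XY q) (inj₂ (_ , _ , f , subst (_ ∈_) (sg-edge (inj₁ f)) r)))
        owner₁ (there e) (here refl) q r = ⊥-elim (free (subst (_ ∈_) sg-XY r) (inj₂ (_ , _ , e , subst (_ ∈_) (sg-edge (inj₁ e)) q)))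
        owner₁ (there e) (there f) q r = sg-owner e f (subst (_ ∈_) (sg-edge (inj₁ e)) q) (subst (_ ∈_) (sg-edge (inj₁ f)) r)

      -- `fresh` ensures that overwriting the entries for XY and YX touches no old edge, and `free`
      -- that the new path meets nothing old.
      edgeAdded : Embedding N ((X , Y) ∷ ES)
      edgeAdded = record
        { vm = vm ; sg = sg₁
        ; bound = λ { (here refl) → X<N , Y<N ; (there e) → bound e }
        ; loopless = λ { (here refl) → X≢Y ; (there e) → loopless e }
        ; sg-rev = rev₁ ; sg-chain = chain₁ ; sg-unique = unique₁
        ; vm-inj = vm-inj ; vm∉sg = vm∉₁ ; sg-owner = owner₁ }

      edgeAdded-sg : ∀ {u v} → (u , v) ≢ (X , Y) → (u , v) ≢ (Y , X) → Embedding.sg edgeAdded u v ≡ sg u v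
      edgeAdded-sg = sg-old

  -- All that later arguments use of an added ear: where its feet lie, that the rest is unchanged,
  -- and which pieces of the two split paths the four half-edges carry.
  record EarAdded {N ES} (ρ : Embedding N ES) (a b c d : ℕ) (p q : Fin n) (l₁ l₂ m₁ m₂ : List (Fin n)) : Set where
    private module ρ = Embedding ρ
    field
      embedding : Embedding (2 + N) (addEar N (a , b) (c , d) ES)
    open Embedding embedding
    field
      vm-old : ∀ {v} → v < N → vm v ≡ ρ.vm v
      vm-N : vm N ≡ p
      vm-1+N : vm (suc N) ≡ q
      sg-old : ∀ {u v} → u < N → v < N → sg u v ≡ ρ.sg u v
      sg-a : sg a N ≡ l₁
      sg-b : sg N b ≡ l₂
      sg-c : sg c (suc N) ≡ m₁
      sg-d : sg (suc N) d ≡ m₂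

  -- Split ab at `p`, then cd at `q`, then join the feet. The second split is possible because cd is
  -- a different edge and so survives the first.
  earAdded : ∀ {N ES} (ρ : Embedding N ES) {a b c d p q l₁ l₂ m₁ m₂ E} →
    (a , b) ∈ ES → (c , d) ∈ ES → (a , b) ≢ (c , d) →
    Embedding.sg ρ a b ≡ l₁ ++ p ∷ l₂ → Embedding.sg ρ c d ≡ m₁ ++ q ∷ m₂ →
    Chain H (p ∷ E ∷ʳ q) → Unique E → (∀ {x} → x ∈ E → ¬ Embedding.Occupied ρ x) →
    EarAdded ρ a b c d p q l₁ l₂ m₁ m₂
  earAdded {N} {ES} ρ {a} {b} {c} {d} {p} {q} {l₁} {l₂} {m₁} {m₂} {E} ab cd ne eq₁ eq₂ chain uniq free = record
    { embedding = ρ₃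
    ; vm-old = λ l → trans (subdivided-vm ρ₁ cd₁ eq₂′ (up l)) (subdivided-vm ρ ab eq₁ l)
    ; vm-N = trans (subdivided-vm ρ₁ cd₁ eq₂′ (ℕ.n<1+n N)) (subdivided-vm-new ρ ab eq₁)
    ; vm-1+N = subdivided-vm-new ρ₁ cd₁ eq₂′
    ; sg-old = λ l m → trans (old₃ (ℕ.<⇒≢ l ∘ cong proj₁) (ℕ.<⇒≢ m ∘ cong proj₂))
        (trans (subdivided-sg ρ₁ cd₁ eq₂′ (up l) (up m)) (subdivided-sg ρ ab eq₁ l m))
    ; sg-a = trans (old₃ {a} {N} (ℕ.<⇒≢ (proj₁ (bound ab)) ∘ cong proj₁) (ℕ.<⇒≢ (up (proj₁ (bound ab))) ∘ cong proj₁))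
        (trans (subdivided-sg ρ₁ cd₁ eq₂′ (up (proj₁ (bound ab))) (ℕ.n<1+n N)) (subdivided-left ρ ab eq₁))
    ; sg-b = trans (old₃ {N} {b} (ℕ.<⇒≢ (up (proj₂ (bound ab))) ∘ cong proj₂) (ℕ.<⇒≢ (proj₂ (bound ab)) ∘ cong proj₂))
        (trans (subdivided-sg ρ₁ cd₁ eq₂′ (ℕ.n<1+n N) (up (proj₂ (bound ab)))) (subdivided-right ρ ab eq₁))
    ; sg-c = trans (old₃ {c} {suc N} (ℕ.<⇒≢ (proj₁ (bound cd)) ∘ cong proj₁) (ℕ.<⇒≢ (up (proj₁ (bound cd))) ∘ cong proj₁))
        (subdivided-left ρ₁ cd₁ eq₂′)
    ; sg-d = trans (old₃ {suc N} {d} (ℕ.<⇒≢ (up (proj₂ (bound cd))) ∘ cong proj₂) (ℕ.<⇒≢ (proj₂ (bound cd)) ∘ cong proj₂))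
        (subdivided-right ρ₁ cd₁ eq₂′)
    }
    where
    open Embedding ρ
    up : ∀ {v} → v < N → v < suc N
    up = ℕ.m<n⇒m<1+n
    ρ₁ = subdivided ρ ab eq₁
    cd₁ : (c , d) ∈ subdivide N (a , b) ES
    cd₁ = there (there (∈-filter⁺ (λ e → ¬? (e ≟ₑ (a , b))) cd (ne ∘ sym)))
    eq₂′ : Embedding.sg ρ₁ c d ≡ m₁ ++ q ∷ m₂
    eq₂′ = trans (subdivided-sg ρ ab eq₁ (proj₁ (bound cd)) (proj₂ (bound cd))) eq₂
    ρ₂ = subdivided ρ₁ cd₁ eq₂′
    unused : ∀ {u v} → (u , v) ∈ subdivide (suc N) (c , d) (subdivide N (a , b) ES) →
      (u , v) ≢ (N , suc N) × (v , u) ≢ (N , suc N)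
    unused (here refl) = (ℕ.<⇒≢ (proj₁ (bound cd)) ∘ cong proj₁) , (ℕ.<⇒≢ (up (proj₁ (bound cd))) ∘ cong proj₂)
    unused (there (here refl)) = (ℕ.<⇒≢ (up (proj₂ (bound cd))) ∘ cong proj₂) , (ℕ.<⇒≢ (proj₂ (bound cd)) ∘ cong proj₁)
    unused (there (there e)) with Embedding.bound ρ₁ (proj₁ (∈-filter⁻ (λ e → ¬? (e ≟ₑ (c , d))) {xs = subdivide N (a , b) ES} e))
    ... | l , m = (ℕ.<⇒≢ m ∘ cong proj₂) , (ℕ.<⇒≢ l ∘ cong proj₂)
    fresh : ¬ Edge (subdivide (suc N) (c , d) (subdivide N (a , b) ES)) N (suc N)
    fresh (inj₁ e) = proj₁ (unused e) refl
    fresh (inj₂ e) = proj₂ (unused e) refl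
    chain₂ : Chain H (Embedding.vm ρ₂ N ∷ E ∷ʳ Embedding.vm ρ₂ (suc N))
    chain₂ = subst₂ (λ y z → Chain H (y ∷ E ∷ʳ z))
      (sym (trans (subdivided-vm ρ₁ cd₁ eq₂′ (ℕ.n<1+n N)) (subdivided-vm-new ρ ab eq₁)))
      (sym (subdivided-vm-new ρ₁ cd₁ eq₂′)) chain
    free₂ : ∀ {x} → x ∈ E → ¬ Embedding.Occupied ρ₂ x
    free₂ x∈ = free x∈ ∘ subdivided-occupied ρ ab eq₁ ∘ subdivided-occupied ρ₁ cd₁ eq₂′
    N<2+N : N < 2 + N
    N<2+N = ℕ.m<n⇒m<1+n (ℕ.n<1+n N)
    ρ₃ = edgeAdded ρ₂ N<2+N (ℕ.n<1+n (suc N)) (ℕ.<⇒≢ (ℕ.n<1+n N)) fresh chain₂ uniq free₂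
    old₃ : ∀ {u v} → (u , v) ≢ (N , suc N) → (u , v) ≢ (suc N , N) → Embedding.sg ρ₃ u v ≡ Embedding.sg ρ₂ u v
    old₃ = edgeAdded-sg ρ₂ N<2+N (ℕ.n<1+n (suc N)) (ℕ.<⇒≢ (ℕ.n<1+n N)) fresh chain₂ uniq free₂

  module _ {N ES} (ρ : Embedding N ES) where
    open Embedding ρ

    trace : List ℕ → List (Fin n)
    trace (u ∷ v ∷ w ∷ r) = sg u v ++ vm v ∷ trace (v ∷ w ∷ r)
    trace (u ∷ v ∷ []) = sg u v
    trace _ = []

    private
      ex : Atom → List (Fin n)
      ex (pt v) = vm v ∷ []
      ex (seg u v) = sg u v

      data Valid : Atom → Set where
        pt : ∀ {v} → v < N → Valid (pt v)
        on : ∀ {u v} → Edge ES u v → Valid (at u v)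

      to-at : ∀ {u v x} → Edge ES u v → x ∈ sg u v → x ∈ ex (at u v)
      to-at {u} {v} e q with u <ᵇ v
      ... | true = q
      ... | false = ∈-flip e q

      from-at : ∀ {u v x} → Edge ES u v → x ∈ ex (at u v) → x ∈ sg u v
      from-at {u} {v} e q with u <ᵇ v
      ... | true = q
      ... | false = ∈-flip (swap e) q

      -- The reason why comparing names is enough: a vertex of `H` lies in the image of at most one
      -- atom, so routes that meet in `H` already share an atom.
      atom-owner : ∀ {A B x} → Valid A → Valid B → x ∈ ex A → x ∈ ex B → A ≡ B
      atom-owner (pt l) (pt m) (here refl) (here e) = cong pt (vm-inj l m e)
      atom-owner (pt l) (on e) (here refl) q = ⊥-elim (vm∉ l e (from-at e q))
      atom-owner (on e) (pt l) q (here refl) = ⊥-elim (vm∉ l e (from-at e q))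
      atom-owner (on e) (on f) q r with owner e f (from-at e q) (from-at f r)
      ... | inj₁ (refl , refl) = refl
      ... | inj₂ (refl , refl) = at-sym (edge-≢ e)

      valid : ∀ {a b r A} → Route ES a b r → A ∈ interior r → Valid A
      valid (one e) (here refl) = on e
      valid (e ∷ r) (here refl) = on e
      valid (e ∷ r) (there (here refl)) = pt (proj₂ (edge-bound e))
      valid (e ∷ r) (there (there p)) = valid r p

      trace-atom : ∀ {a b r x} → Route ES a b r → x ∈ trace r → ∃ λ A → A ∈ interior r × x ∈ ex A
      trace-atom (one e) q = _ , here refl , to-at e q
      trace-atom {r = u ∷ v ∷ _} (e ∷ r) q with ∈-++⁻ (sg u v) q
      ... | inj₁ q₁ = _ , here refl , to-at e q₁
      ... | inj₂ (here refl) = _ , there (here refl) , here refl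
      ... | inj₂ (there q₂) with trace-atom r q₂
      ... | A , A∈ , x∈ = A , there (there A∈) , x∈

      trace-unique : ∀ {a b r} → Route ES a b r → Unique (interior r) → Unique (trace r)
      trace-unique (one e) _ = unique e
      trace-unique {r = u ∷ v ∷ w ∷ s} (e ∷ r) (p₁ ∷ p₂ ∷ p₃) = Unique.++⁺ (unique e) (unique-∷ v∉ (trace-unique r p₃)) disjoint
        where
        v∉ : vm v ∉ trace (v ∷ w ∷ s)
        v∉ q with trace-atom r q
        ... | A , A∈ , x∈ = ∉-head (p₂ ∷ p₃) (subst (_∈ _) (atom-owner (valid r A∈) (pt (proj₂ (edge-bound e))) x∈ (here refl)) A∈)
        disjoint : ∀ {x} → ¬ (x ∈ sg u v × x ∈ vm v ∷ trace (v ∷ w ∷ s))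
        disjoint (q , here refl) = vm∉ (proj₂ (edge-bound e)) e q
        disjoint (q , there q′) with trace-atom r q′
        ... | A , A∈ , x∈ = ∉-head (p₁ ∷ p₂ ∷ p₃) (there (subst (_∈ _) (atom-owner (valid r A∈) (on e) x∈ (to-at e q)) A∈))

    circuit-unique : ∀ {a r} → a < N → Route ES a a r → Unique (pt a ∷ interior r) → Unique (vm a ∷ trace r)
    circuit-unique {a} {s} l r (p ∷ u) = unique-∷ a∉ (trace-unique r u)
      where
      a∉ : vm a ∉ trace s
      a∉ q with trace-atom r q
      ... | A , A∈ , x∈ = ∉-head (p ∷ u) (subst (_∈ _) (atom-owner (valid r A∈) (pt l) x∈ (here refl)) A∈)

    trace-chain : ∀ {a b r} → Route ES a b r → Chain H (vm a ∷ trace r ∷ʳ vm b)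
    trace-chain (one e) = path-chain e
    trace-chain {a} {b} {r = u ∷ v ∷ _} (e ∷ r) = subst (Chain H)
      (cong (vm u ∷_) (sym (List.++-assoc (sg u v) _ _)))
      (chain-++⁺ H (vm u ∷ sg u v) (path-chain e) (trace-chain r))

    module _ {N′ ES′ φ route} (R : Reroute N ES N′ ES′ φ route) where
      private
        module R = Reroute R

        sg₁ : ℕ → ℕ → List (Fin n)
        sg₁ u v with (u , v) ∈? ES′
        ... | yes _ = trace (route u v)
        ... | no _ = reverse (trace (route v u))

        sg-fwd : ∀ {u v} → (u , v) ∈ ES′ → sg₁ u v ≡ trace (route u v)
        sg-fwd {u} {v} e with (u , v) ∈? ES′
        ... | yes _ = refl
        ... | no ne = ⊥-elim (ne e)

        sg-bwd : ∀ {u v} → (u , v) ∈ ES′ → sg₁ v u ≡ reverse (trace (route u v))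
        sg-bwd {u} {v} e with (v , u) ∈? ES′
        ... | yes f = ⊥-elim (R.oriented e f)
        ... | no _ = refl

        unique₁ : ∀ {A} → A ∈ atoms N′ ES′ → Unique (image φ route A)
        unique₁ = unique-concatMap-local (image φ route) _ R.unique

        owner₁ : ∀ {A B C} → A ∈ atoms N′ ES′ → B ∈ atoms N′ ES′ → C ∈ image φ route A → C ∈ image φ route B → A ≡ B
        owner₁ = unique-concatMap-owner (image φ route) _ R.unique

        atom : ∀ {u v x} → (u , v) ∈ ES′ → x ∈ sg₁ u v → ∃ λ A → A ∈ interior (route u v) × x ∈ ex A
        atom e q = trace-atom (R.routes e) (subst (_ ∈_) (sg-fwd e) q)

      -- Topological containment is transitive. A collision among the new paths comes from an atom
      -- shared by two images or repeated in one, which the field `unique` of `R` forbids.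
      rerouted : Embedding N′ ES′
      rerouted = record
        { vm = λ v → vm (φ v)
        ; sg = sg₁
        ; bound = R.bound
        ; loopless = R.loopless
        ; sg-rev = λ e → trans (sg-bwd e) (cong reverse (sym (sg-fwd e)))
        ; sg-chain = λ {u} {v} e → subst (λ l → Chain H (vm (φ u) ∷ l ∷ʳ vm (φ v))) (sym (sg-fwd e)) (trace-chain (R.routes e))
        ; sg-unique = λ e → subst Unique (sym (sg-fwd e)) (trace-unique (R.routes e) (unique₁ (seg∈atoms N′ e)))
        ; vm-inj = λ l m e → pt-inj (owner₁ (pt∈atoms ES′ l) (pt∈atoms ES′ m) (here refl)
            (here (atom-owner (pt (R.φ-bound l)) (pt (R.φ-bound m)) (here refl) (here e))))
        ; vm∉sg = λ l e q → let A , A∈ , x∈ = atom e q in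
            pt≢seg (owner₁ (pt∈atoms ES′ l) (seg∈atoms N′ e) (here refl)
              (subst (_∈ _) (atom-owner (valid (R.routes e) A∈) (pt (R.φ-bound l)) x∈ (here refl)) A∈))
        ; sg-owner = λ e f q r → let A , A∈ , x∈ = atom e q ; B , B∈ , x∈′ = atom f r in
            seg-inj (owner₁ (seg∈atoms N′ e) (seg∈atoms N′ f) A∈
              (subst (_∈ _) (sym (atom-owner (valid (R.routes e) A∈) (valid (R.routes f) B∈) x∈ x∈′)) B∈))
        }
        where
        pt-inj : ∀ {u v} → pt u ≡ pt v → u ≡ v
        pt-inj refl = refl
        pt≢seg : ∀ {w u v} → pt w ≡ seg u v → ⊥
        pt≢seg ()
        seg-inj : ∀ {u v u′ v′} → seg u v ≡ seg u′ v′ → (u , v) ≡ (u′ , v′)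
        seg-inj refl = refl

      rerouted-sg : ∀ {u v} → (u , v) ∈ ES′ → Embedding.sg rerouted u v ≡ trace (route u v)
      rerouted-sg = sg-fwd

-- Translation between `HomEmb` and `Embedding`

module _ {A : Set} where

  private
    dropLast : List A → List A
    dropLast [] = []
    dropLast (x ∷ []) = []
    dropLast (x ∷ y ∷ r) = x ∷ dropLast (y ∷ r)

    dropLast-∷ʳ : ∀ xs {b} → dropLast (xs ∷ʳ b) ≡ xs
    dropLast-∷ʳ [] = refl
    dropLast-∷ʳ (x ∷ []) = refl
    dropLast-∷ʳ (x ∷ y ∷ xs) = cong (x ∷_) (dropLast-∷ʳ (y ∷ xs))

  dropEnds : List A → List A
  dropEnds [] = []
  dropEnds (x ∷ xs) = dropLast xs

  -- With `a ≢ b` the path has at least two vertices, so both ends can be removed and put back.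
  dropEnds-path : ∀ {a b p r s} → p ≡ a ∷ r → p ≡ s ∷ʳ b → a ≢ b → p ≡ a ∷ dropEnds p ∷ʳ b
  dropEnds-path {s = []} refl refl ne = ⊥-elim (ne refl)
  dropEnds-path {a} {b} {s = x ∷ s} refl refl ne = cong (λ l → a ∷ l ∷ʳ b) (sym (dropLast-∷ʳ s))

relabel : ∀ {m m′ n} {g : Graph m} {g′ : Graph m′} {h : Graph n} (τ : Fin m → Fin m′) →
  (∀ {u v} → τ u ≡ τ v → u ≡ v) → (∀ {u v} → Adj g u v → Adj g′ (τ u) (τ v)) →
  HomEmb g′ h → HomEmb g h
relabel {g = g} τ inj adj η = record
  { vmap = η.vmap ∘ τ
  ; vinj = λ u v e → inj (η.vinj _ _ e)
  ; pmap = λ u v → η.pmap (τ u) (τ v)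
  ; psym = λ u v a → η.psym _ _ (adj a)
  ; ppath = λ u v a → η.ppath _ _ (adj a)
  ; pdisjV = λ u v u′ v′ a a′ ne → η.pdisjV _ _ _ _ (adj a) (adj a′) (ne ∘ same)
  ; pdisjE = λ u v u′ v′ a a′ ne → η.pdisjE _ _ _ _ (adj a) (adj a′) (ne ∘ same)
  ; pends = λ w u v a →
      (λ p → Sum.map inj inj (proj₁ (η.pends (τ w) _ _ (adj a)) p)) ,
      (λ p → proj₂ (η.pends (τ w) _ _ (adj a)) (Sum.map (cong τ) (cong τ) p))
  }
  where
  module η = HomEmb η
  same : ∀ {u v u′ v′} → SameEdge (τ u) (τ v) (τ u′) (τ v′) → SameEdge u v u′ v′
  same = Sum.map (λ (p , q) → inj p , inj q) (λ (p , q) → inj p , inj q)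

-- Applied with `τ` a symmetry of the dodecahedron, the identity when a split edge is reversed, and
-- the exchange of the two new vertices.
FContains-relabel : ∀ {m m′ n} {g : Graph m} {g′ : Graph m′} {h : Graph n} {cH cG cG′} (τ : Fin m → Fin m′) →
  (∀ {u v} → τ u ≡ τ v → u ≡ v) → (∀ {u v} → Adj g u v → Adj g′ (τ u) (τ v)) →
  (∀ i → τ (cG i) ≡ cG′ i) →
  FContains h cH g′ cG′ → FContains h cH g cG
FContains-relabel τ inj adj eq (η , fv , fe) = relabel τ inj adj η ,
  (λ i → trans (cong η.vmap (eq i)) (fv i)) ,
  (λ i → trans (cong₂ η.pmap (eq i) (eq (next5 i))) (fe i))
  where module η = HomEmb η

module _ {n} {H : Graph n} (H-sym : ∀ u v → H u v ≡ H v u) where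
  open Topological H H-sym

  module _ {m N} {g : Graph m} {ES : Edges} (η : HomEmb g H) (lab : ℕ → Fin m)
           (bound : ∀ {u v} → (u , v) ∈ ES → u < N × v < N)
           (loopless : ∀ {u v} → (u , v) ∈ ES → u ≢ v)
           (oriented : ∀ {u v} → (u , v) ∈ ES → (v , u) ∉ ES)
           (lab-inj : ∀ {u v} → u < N → v < N → lab u ≡ lab v → u ≡ v)
           (adj : ∀ {u v} → (u , v) ∈ ES → Adj g (lab u) (lab v)) where
    private
      module η = HomEmb η

      sg₁ : ℕ → ℕ → List (Fin n)
      sg₁ u v with (u , v) ∈? ES
      ... | yes _ = dropEnds (η.pmap (lab u) (lab v))
      ... | no _ = reverse (dropEnds (η.pmap (lab v) (lab u)))

      sg-fwd : ∀ {u v} → (u , v) ∈ ES → sg₁ u v ≡ dropEnds (η.pmap (lab u) (lab v))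
      sg-fwd {u} {v} e with (u , v) ∈? ES
      ... | yes _ = refl
      ... | no ne = ⊥-elim (ne e)

      sg-bwd : ∀ {u v} → (u , v) ∈ ES → sg₁ v u ≡ reverse (dropEnds (η.pmap (lab u) (lab v)))
      sg-bwd {u} {v} e with (v , u) ∈? ES
      ... | yes f = ⊥-elim (oriented e f)
      ... | no _ = refl

      pmap≡ : ∀ {u v} → (u , v) ∈ ES → η.pmap (lab u) (lab v) ≡ η.vmap (lab u) ∷ sg₁ u v ∷ʳ η.vmap (lab v)
      pmap≡ {u} {v} e with η.ppath (lab u) (lab v) (adj e)
      ... | _ , _ , (_ , p) , (_ , q) = trans
        (dropEnds-path p q (λ eq → loopless e (lab-inj (proj₁ (bound e)) (proj₂ (bound e)) (η.vinj _ _ eq))))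
        (cong (λ l → η.vmap (lab u) ∷ l ∷ʳ η.vmap (lab v)) (sym (sg-fwd e)))

      ⊆pmap : ∀ {u v x} → (u , v) ∈ ES → x ∈ sg₁ u v → x ∈ η.pmap (lab u) (lab v)
      ⊆pmap e q = subst (_ ∈_) (sym (pmap≡ e)) (there (∈-++⁺ˡ q))

      unique₁ : ∀ {u v} → (u , v) ∈ ES → Unique (η.vmap (lab u) ∷ sg₁ u v ∷ʳ η.vmap (lab v))
      unique₁ e = subst Unique (pmap≡ e) (proj₁ (η.ppath _ _ (adj e)))

      internal : ∀ {u v x} → (u , v) ∈ ES → x ∈ sg₁ u v → Internal (η.vmap (lab u)) (η.vmap (lab v)) (η.pmap (lab u) (lab v)) x
      internal {u} {v} e q = ⊆pmap e q ,
        (λ { refl → ∉-head (unique₁ e) (∈-++⁺ˡ q) }) ,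
        (λ { refl → unique-++-disjoint (sg₁ u v) (tail (unique₁ e)) q (here refl) })
        where
        tail : ∀ {x : Fin n} {xs} → Unique (x ∷ xs) → Unique xs
        tail (_ ∷ u) = u

      vm∉₁ : ∀ {w u v} → w < N → (u , v) ∈ ES → η.vmap (lab w) ∉ sg₁ u v
      vm∉₁ {w} {u} {v} l e q with internal e q
      ... | p∈ , ne₁ , ne₂ with proj₁ (η.pends (lab w) (lab u) (lab v) (adj e)) p∈
      ... | inj₁ eq = ne₁ (cong η.vmap eq)
      ... | inj₂ eq = ne₂ (cong η.vmap eq)

      owner₁ : ∀ {u v u′ v′ x} → (u , v) ∈ ES → (u′ , v′) ∈ ES → x ∈ sg₁ u v → x ∈ sg₁ u′ v′ → (u , v) ≡ (u′ , v′)
      owner₁ {u} {v} {u′} {v′} e f q r with (u , v) ≟ₑ (u′ , v′)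
      ... | yes eq = eq
      ... | no ne = ⊥-elim (η.pdisjV _ _ _ _ (adj e) (adj f) different _ (internal e q) (⊆pmap f r))
        where
        different : ¬ SameEdge (lab u) (lab v) (lab u′) (lab v′)
        different (inj₁ (p , q)) = ne (cong₂ _,_ (lab-inj (proj₁ (bound e)) (proj₁ (bound f)) p) (lab-inj (proj₂ (bound e)) (proj₂ (bound f)) q))
        different (inj₂ (p , q)) = oriented e (subst (_∈ ES) (cong₂ _,_
          (sym (lab-inj (proj₂ (bound e)) (proj₁ (bound f)) q)) (sym (lab-inj (proj₁ (bound e)) (proj₂ (bound f)) p))) f)

    -- `oriented` makes different entries of `ES` different edges of g, and only for these does
    -- `pdisjV` promise disjoint paths.
    fromHomEmb : Embedding N ES
    fromHomEmb = record
      { vm = η.vmap ∘ lab ; sg = sg₁ ; bound = bound ; loopless = loopless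
      ; sg-rev = λ e → trans (sg-bwd e) (cong reverse (sym (sg-fwd e)))
      ; sg-chain = λ e → subst (Chain H) (pmap≡ e) (proj₁ (proj₂ (η.ppath _ _ (adj e))))
      ; sg-unique = λ { {u} {v} e → unique-++⁻ˡ (sg₁ u v) (unique-++⁻ʳ (η.vmap (lab u) ∷ []) (unique₁ e)) }
      ; vm-inj = λ l m e → lab-inj l m (η.vinj _ _ e)
      ; vm∉sg = vm∉₁ ; sg-owner = owner₁ }

    fromHomEmb-sg : ∀ {u v x y} → (u , v) ∈ ES → η.pmap (lab u) (lab v) ≡ x ∷ y ∷ [] → sg₁ u v ≡ []
    fromHomEmb-sg e eq = trans (sg-fwd e) (cong dropEnds eq)

  module _ {m N} {g : Graph m} {ES : Edges} (ρ : Embedding N ES) (nm : Fin m → ℕ)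
           (nm-bound : ∀ v → nm v < N) (nm-inj : ∀ {u v} → nm u ≡ nm v → u ≡ v)
           (edge : ∀ {u v} → Adj g u v → Edge ES (nm u) (nm v)) where
    open Embedding ρ
    private
      P : Fin m → Fin m → List (Fin n)
      P u v = path (nm u) (nm v)

      ∈P : ∀ {u v x} → x ∈ P u v → x ≡ vm (nm u) ⊎ x ≡ vm (nm v) ⊎ x ∈ sg (nm u) (nm v)
      ∈P (here e) = inj₁ e
      ∈P {u} {v} (there p) with ∈-∷ʳ⁻ (sg (nm u) (nm v)) p
      ... | inj₁ q = inj₂ (inj₂ q)
      ... | inj₂ q = inj₂ (inj₁ q)

      vm-nm-inj : ∀ {u v} → vm (nm u) ≡ vm (nm v) → u ≡ v
      vm-nm-inj e = nm-inj (vm-inj (nm-bound _) (nm-bound _) e)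

      ends : ∀ {w u v} → Adj g u v → vm (nm w) ∈ P u v → w ≡ u ⊎ w ≡ v
      ends a p with ∈P p
      ... | inj₁ e = inj₁ (vm-nm-inj e)
      ... | inj₂ (inj₁ e) = inj₂ (vm-nm-inj e)
      ... | inj₂ (inj₂ q) = ⊥-elim (vm∉ (nm-bound _) (edge a) q)

      same : ∀ {u v u′ v′ x} → Adj g u v → Adj g u′ v′ → x ∈ sg (nm u) (nm v) → x ∈ sg (nm u′) (nm v′) → SameEdge u v u′ v′
      same a a′ p q = Sum.map (λ (s , t) → nm-inj s , nm-inj t) (λ (s , t) → nm-inj s , nm-inj t) (owner (edge a) (edge a′) p q)

      common : ∀ {u v u′ v′ x} → Adj g u v → Adj g u′ v′ → ¬ SameEdge u v u′ v′ → x ∈ P u v → x ∈ P u′ v′ →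
        ∃ λ w → x ≡ vm (nm w) × (w ≡ u ⊎ w ≡ v) × (w ≡ u′ ⊎ w ≡ v′)
      common a a′ ne p q with ∈P p | ∈P q
      ... | inj₁ refl | _ = _ , refl , inj₁ refl , ends a′ q
      ... | inj₂ (inj₁ refl) | _ = _ , refl , inj₂ refl , ends a′ q
      ... | inj₂ (inj₂ _) | inj₁ refl = _ , refl , ends a p , inj₁ refl
      ... | inj₂ (inj₂ _) | inj₂ (inj₁ refl) = _ , refl , ends a p , inj₂ refl
      ... | inj₂ (inj₂ r) | inj₂ (inj₂ s) = ⊥-elim (ne (same a a′ r s))

      two-ends : ∀ {u v u′ v′ w w′ : Fin m} → w ≢ w′ → w ≡ u ⊎ w ≡ v → w ≡ u′ ⊎ w ≡ v′ → w′ ≡ u ⊎ w′ ≡ v → w′ ≡ u′ ⊎ w′ ≡ v′ → SameEdge u v u′ v′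
      two-ends ne (inj₁ refl) _ (inj₁ refl) _ = ⊥-elim (ne refl)
      two-ends ne (inj₂ refl) _ (inj₂ refl) _ = ⊥-elim (ne refl)
      two-ends ne _ (inj₁ refl) _ (inj₁ refl) = ⊥-elim (ne refl)
      two-ends ne _ (inj₂ refl) _ (inj₂ refl) = ⊥-elim (ne refl)
      two-ends ne (inj₁ refl) (inj₁ refl) (inj₂ refl) (inj₂ refl) = inj₁ (refl , refl)
      two-ends ne (inj₁ refl) (inj₂ refl) (inj₂ refl) (inj₁ refl) = inj₂ (refl , refl)
      two-ends ne (inj₂ refl) (inj₁ refl) (inj₁ refl) (inj₂ refl) = inj₂ (refl , refl)
      two-ends ne (inj₂ refl) (inj₂ refl) (inj₁ refl) (inj₁ refl) = inj₁ (refl , refl)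

      disjV : ∀ u v u′ v′ → Adj g u v → Adj g u′ v′ → ¬ SameEdge u v u′ v′ →
        ∀ x → Internal (vm (nm u)) (vm (nm v)) (P u v) x → ¬ x ∈ P u′ v′
      disjV u v u′ v′ a a′ ne x (p , x≢u , x≢v) q with common a a′ ne p q
      ... | w , refl , inj₁ refl , _ = x≢u refl
      ... | w , refl , inj₂ refl , _ = x≢v refl

      edge-∈ : ∀ p {x y : Fin n} → PathEdge p x y → x ∈ p × y ∈ p
      edge-∈ p (inj₁ c) = consec-∈₁ p c , consec-∈₂ p c
      edge-∈ p (inj₂ c) = consec-∈₂ p c , consec-∈₁ p c

      edge-ne : ∀ p {x y : Fin n} → Unique p → PathEdge p x y → x ≢ y
      edge-ne p u (inj₁ c) = consec-≢ p u c
      edge-ne p u (inj₂ c) = consec-≢ p u c ∘ sym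

      -- A shared edge has two distinct ends on both paths; these are branch vertices, each an end
      -- of both edges, so the two edges agree.
      disjE : ∀ u v u′ v′ → Adj g u v → Adj g u′ v′ → ¬ SameEdge u v u′ v′ →
        ∀ x y → PathEdge (P u v) x y → ¬ PathEdge (P u′ v′) x y
      disjE u v u′ v′ a a′ ne x y c c′
        with edge-∈ (P u v) c | edge-∈ (P u′ v′) c′
      ... | x∈ , y∈ | x∈′ , y∈′ with common a a′ ne x∈ x∈′ | common a a′ ne y∈ y∈′
      ... | w , refl , i , j | w′ , refl , i′ , j′ = ne (two-ends (λ { refl → edge-ne (P u v) (path-unique (edge a)) c refl }) i j i′ j′)

    toHomEmb : HomEmb g H
    toHomEmb = record
      { vmap = vm ∘ nm
      ; vinj = λ u v → vm-nm-inj
      ; pmap = P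
      ; psym = λ u v a → path-rev (edge a)
      ; ppath = λ u v a → path-unique (edge a) , path-chain (edge a) , (_ , refl) , (vm (nm u) ∷ sg (nm u) (nm v) , refl)
      ; pdisjV = disjV
      ; pdisjE = disjE
      ; pends = λ w u v a → ends a , λ
          { (inj₁ refl) → here refl
          ; (inj₂ refl) → there (∈-∷ʳ (sg (nm u) (nm v))) }
      }

    toFContains : ∀ {d : Fin 5 → Fin n} {c} → (∀ i → vm (nm (c i)) ≡ d i) →
      (∀ i → sg (nm (c i)) (nm (c (next5 i))) ≡ []) → FContains H d g c
    toFContains fv fe = toHomEmb , fv ,
      λ i → trans (cong (λ l → vm _ ∷ l ∷ʳ vm _) (fe i)) (cong₂ (λ x y → x ∷ y ∷ []) (fv i) (fv (next5 i)))

-- Residual walks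

consec-asym : ∀ {n} (xs : List (Fin n)) {x y} → Unique xs → Consec xs x y → ¬ Consec xs y x
consec-asym (a ∷ b ∷ xs) u (inj₁ (refl , refl)) (inj₁ (e , _)) = ∉-head u (here (sym e))
consec-asym (a ∷ b ∷ xs) u (inj₁ (refl , refl)) (inj₂ c) = ∉-head u (consec-∈₂ (b ∷ xs) c)
consec-asym (a ∷ b ∷ xs) u (inj₂ c) (inj₁ (refl , refl)) = ∉-head u (consec-∈₂ (b ∷ xs) c)
consec-asym (a ∷ b ∷ xs) (_ ∷ u) (inj₂ c) (inj₂ c′) = consec-asym (b ∷ xs) u c c′

-- Finitely many instances of excluded middle may be assumed at once under double negation. This
-- turns `Reach` into a Boolean set, the form that `cutSize` takes.
¬¬-decide : ∀ n (P : Fin n → Set) → ((∀ x → P x ⊎ ¬ P x) → ⊥) → ⊥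
¬¬-decide zero P k = k λ ()
¬¬-decide (suc n) P k = excluded-middle λ p → ¬¬-decide n (P ∘ F.suc) λ f →
  k λ { 0F → p ; (F.suc x) → f x }

circuit5 : ∀ {n} (g : Graph n) (d : Fin 5 → Fin n) → IsCircuit5 g d →
  IsCircuit g (d 0F ∷ d 1F ∷ d 2F ∷ d 3F ∷ d 4F ∷ [])
circuit5 g d (inj , adj) = s≤s (s≤s (s≤s z≤n)) , Unique.map⁺ (inj _ _) (Unique.allFin⁺ 5) ,
  _ , _ , refl , adj 0F , adj 1F , adj 2F , adj 3F , adj 4F , _

-- X is meant to be a set closed under stepping backwards along the list; then the list leaves X at most once.
firstExit : ∀ {n} → (Fin n → Bool) → List (Fin n) → List (Fin n × Fin n)
firstExit X (x ∷ y ∷ xs) = if X y then firstExit X (y ∷ xs) else (x , y) ∷ []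
firstExit X _ = []

length-firstExit : ∀ {n} (X : Fin n → Bool) xs → length (firstExit X xs) ≤ 1
length-firstExit X [] = z≤n
length-firstExit X (x ∷ []) = z≤n
length-firstExit X (x ∷ y ∷ xs) = either (X y) (length-firstExit X (y ∷ xs))
  where
  either : ∀ b {l} → length l ≤ 1 → length (if b then l else (x , y) ∷ []) ≤ 1
  either true le = le
  either false _ = s≤s z≤n

∈-firstExit : ∀ {n} (X : Fin n → Bool) xs → (∀ {x y} → Consec xs x y → X y ≡ true → X x ≡ true) →
  ∀ {x y} → Consec xs x y → X x ≡ true → X y ≡ false → (x , y) ∈ firstExit X xs
∈-firstExit X (a ∷ b ∷ xs) down (inj₁ (refl , refl)) ex ey rewrite ey = here refl
∈-firstExit X (a ∷ b ∷ xs) down {x} (inj₂ c) ex ey with X b in eb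
... | true = ∈-firstExit X (b ∷ xs) (down ∘ inj₂) c ex ey
... | false = ⊥-elim (false≢true (trans (sym (all-out b xs (down ∘ inj₂) (consec-∈₁ (b ∷ xs) c) eb)) ex))
  where
  false≢true : false ≢ true
  false≢true ()
  all-out : ∀ z zs → (∀ {x y} → Consec (z ∷ zs) x y → X y ≡ true → X x ≡ true) → ∀ {x} → x ∈ z ∷ zs → X z ≡ false → X x ≡ false
  all-out z zs dn (here refl) e = e
  all-out z (z′ ∷ zs) dn (there p) e = all-out z′ zs (dn ∘ inj₂) p z′-out
    where
    z′-out : X z′ ≡ false
    z′-out with X z′ in e′
    ... | false = refl
    ... | true = ⊥-elim (false≢true (trans (sym e) (dn (inj₁ (refl , refl)) e′)))

length-concatMap-≤ : ∀ {A B : Set} (f : A → List B) → (∀ x → length (f x) ≤ 1) → ∀ xs → length (concatMap f xs) ≤ length xs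
length-concatMap-≤ f le [] = z≤n
length-concatMap-≤ f le (x ∷ xs) = subst (_≤ suc (length xs)) (sym (List.length-++ (f x))) (ℕ.+-mono-≤ (le x) (length-concatMap-≤ f le xs))

snoc-view : ∀ {A : Set} (x : A) xs → ∃₂ λ ys y → x ∷ xs ≡ ys ∷ʳ y
snoc-view x [] = [] , x , refl
snoc-view x (z ∷ xs) = let ys , y , e = snoc-view z xs in x ∷ ys , y , cong (x ∷_) e

cons-view : ∀ {A : Set} xs (y : A) → ∃₂ λ z zs → xs ∷ʳ y ≡ z ∷ zs
cons-view [] y = y , [] , refl
cons-view (x ∷ xs) y = x , _ , refl

true≢false : true ≢ false
true≢false ()

module Augmentation {n} (H : Graph n) (simple : IsSimple H) (cubic : IsCubic H)
    (N : ℕ) (ES : Edges) (S : ℕ → Bool) where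
  open Topological H (proj₁ simple)

  adj-sym : ∀ {x y} → Adj H x y → Adj H y x
  adj-sym {x} {y} a = trans (proj₁ simple y x) a

  module _ (ρ : Embedding N ES) where
    open Embedding ρ

    -- The image in three parts: Q over `S`, R over the complement, and P, the interiors of the
    -- paths from `S` to the complement. The ends of those paths belong to Q and R.
    InQ InR InP : Fin n → Set
    InQ x = (∃ λ w → w < N × S w ≡ true × x ≡ vm w) ⊎ (∃₂ λ u v → (u , v) ∈ ES × S u ≡ true × S v ≡ true × x ∈ sg u v)
    InR x = (∃ λ w → w < N × S w ≡ false × x ≡ vm w) ⊎ (∃₂ λ u v → (u , v) ∈ ES × S u ≡ false × S v ≡ false × x ∈ sg u v)
    InP x = ∃₂ λ u v → (u , v) ∈ ES × S u ≡ true × S v ≡ false × x ∈ sg u v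

    -- The path is taken with its ends, so its first step out of Q and its last step into R count as
    -- forward.
    Fwd : Fin n → Fin n → Set
    Fwd x y = ∃₂ λ u v → (u , v) ∈ ES × S u ≡ true × S v ≡ false × Consec (path u v) x y

    -- residual walks towards R: the paths leaving Q may only be used backwards
    data Walk : Fin n → List (Fin n) → Set where
      end : ∀ {w} → InR w → Walk w []
      step : ∀ {w x ws} → Adj H w x → ¬ Fwd w x → Walk x ws → Walk w (x ∷ ws)

    Q∩R : ∀ {x} → InQ x → InR x → ⊥
    Q∩R (inj₁ (w , l , s , e)) (inj₁ (w′ , l′ , s′ , e′)) with vm-inj l l′ (trans (sym e) e′)
    ... | refl = true≢false (trans (sym s) s′)
    Q∩R (inj₁ (w , l , s , refl)) (inj₂ (u , v , e , _ , _ , p)) = vm∉sg l e p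
    Q∩R (inj₂ (u , v , e , _ , _ , p)) (inj₁ (w , l , s , refl)) = vm∉sg l e p
    Q∩R (inj₂ (u , v , e , s , _ , p)) (inj₂ (u′ , v′ , e′ , s′ , _ , p′)) with sg-owner e e′ p p′
    ... | refl = true≢false (trans (sym s) s′)

    Q∩P : ∀ {x} → InQ x → InP x → ⊥
    Q∩P (inj₁ (w , l , s , refl)) (u , v , e , _ , _ , p) = vm∉sg l e p
    Q∩P (inj₂ (u , v , e , _ , s , p)) (u′ , v′ , e′ , _ , s′ , p′) with sg-owner e e′ p p′
    ... | refl = true≢false (trans (sym s) s′)

    R∩P : ∀ {x} → InR x → InP x → ⊥
    R∩P (inj₁ (w , l , s , refl)) (u , v , e , _ , _ , p) = vm∉sg l e p
    R∩P (inj₂ (u , v , e , s , _ , p)) (u′ , v′ , e′ , s′ , _ , p′) with sg-owner e e′ p p′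
    ... | refl = true≢false (trans (sym s′) s)

    R-occupied : ∀ {x} → InR x → Occupied x
    R-occupied (inj₁ (w , l , _ , e)) = inj₁ (w , l , e)
    R-occupied (inj₂ (u , v , e , _ , _ , p)) = inj₂ (u , v , e , p)

    P-occupied : ∀ {x} → InP x → Occupied x
    P-occupied (u , v , e , _ , _ , p) = inj₂ (u , v , e , p)

    -- `y` is not the first vertex of one path and not the last of the other, so the two paths
    -- coincide, and a duplicate-free list cannot contain both orders. Hence going back along a
    -- leaving path is always residual.
    fwd-asym : ∀ {x y} → Fwd x y → ¬ Fwd y x
    fwd-asym {x} {y} (u , v , e , s , t , c) (u′ , v′ , e′ , s′ , t′ , c′) with y-shared
      where
      y-init : y ∈ vm u′ ∷ sg u′ v′
      y-init = consec-fst (vm u′ ∷ sg u′ v′) c′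
      x-init : x ∈ vm u ∷ sg u v
      x-init = consec-fst (vm u ∷ sg u v) c
      y-shared : (u , v) ≡ (u′ , v′)
      y-shared with consec-∈₂ (path u v) c
      y-shared | here e₁ = ⊥-elim (consec-≢ (path u v) (path-unique (inj₁ e)) c (sym (first-only x-init e₁)))
        where
        first-only : x ∈ vm u ∷ sg u v → y ≡ vm u → y ≡ x
        first-only _ refl = ⊥-elim (second-not-first (path-unique (inj₁ e)) c)
          where
          second-not-first : ∀ {z zs} → Unique (z ∷ zs) → ¬ Consec (z ∷ zs) x z
          second-not-first {zs = w ∷ zs} q (inj₁ (_ , refl)) = ∉-head q (here refl)
          second-not-first {zs = w ∷ zs} q (inj₂ d) = ∉-head q (consec-∈₂ (w ∷ zs) d)
      y-shared | there p with ∈-∷ʳ⁻ (sg u v) p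
      y-shared | there p | inj₁ q with y-init
      ... | here refl = ⊥-elim (vm∉sg (proj₁ (bound e′)) e q)
      ... | there q′ = sg-owner e e′ q q′
      y-shared | there p | inj₂ refl with y-init
      ... | here q′ = ⊥-elim (true≢false (trans (sym s′) (trans (cong S (sym (vm-inj (proj₂ (bound e)) (proj₁ (bound e′)) q′))) t)))
      ... | there q′ = ⊥-elim (vm∉sg (proj₂ (bound e)) e′ q′)
    ... | refl = consec-asym (path u v) (path-unique (inj₁ e)) c c′

    fwd-adj : ∀ {x y} → Fwd x y → Adj H x y
    fwd-adj (u , v , e , _ , _ , c) = consec-adj (path u v) (sg-chain e) c
      where
      consec-adj : ∀ xs {x y} → Chain H xs → Consec xs x y → Adj H x y
      consec-adj (a ∷ b ∷ xs) (ab , _) (inj₁ (refl , refl)) = ab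
      consec-adj (a ∷ b ∷ xs) (_ , ch) (inj₂ c) = consec-adj (b ∷ xs) ch c

    walk-suffix : ∀ {w ws z} → Walk w ws → Unique (w ∷ ws) → z ∈ w ∷ ws →
      ∃ λ zs → Walk z zs × Unique (z ∷ zs) × length zs ≤ length ws
    walk-suffix wk u (here refl) = _ , wk , u , ℕ.≤-refl
    walk-suffix (step a f wk) (_ ∷ u) (there p) with walk-suffix wk u p
    ... | zs , wk′ , u′ , l = zs , wk′ , u′ , ℕ.m≤n⇒m≤1+n l

    -- Loop erasure. Distinctness later yields a simple ear, and prevents the walk from retracing
    -- its last step when it meets a leaving path.
    walk-unique : ∀ {w ws} → Walk w ws → ∃ λ zs → Walk w zs × Unique (w ∷ zs)
    walk-unique (end r) = [] , end r , [] ∷ []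
    walk-unique {w} (step {x = x} a f wk) with walk-unique wk
    ... | zs , wk′ , u with DecMembership._∈?_ F._≟_ w (x ∷ zs)
    ... | yes p = let zs′ , wk″ , u′ , _ = walk-suffix wk′ u p in zs′ , wk″ , u′
    ... | no np = x ∷ zs , step a f wk′ , unique-∷ np u

    data Reach : Fin n → Set where
      start : ∀ {x} → InQ x → Reach x
      next : ∀ {x y} → Reach x → Adj H x y → ¬ Fwd x y → Reach y

    -- `Reach` grows at its far end and `Walk` at its near end, so the walk serves as an
    -- accumulator.
    reach-walk : ∀ {x ws} → Reach x → Walk x ws → ∃₂ λ w zs → InQ w × Walk w zs
    reach-walk (start q) wk = _ , _ , q , wk
    reach-walk (next r a f) wk = reach-walk r (step a f wk)

    boundary : Edges
    boundary = trues (λ (u , v) → S u ∧ not (S v)) ES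

    boundary⁺ : ∀ {u v} → (u , v) ∈ ES → S u ≡ true → S v ≡ false → (u , v) ∈ boundary
    boundary⁺ e s t = ∈-trues⁺ (λ (u , v) → S u ∧ not (S v)) e (cong₂ (λ a b → a ∧ not b) s t)

    -- An edge out of the set that is not forward would extend it, so every cut edge is a forward
    -- step. The set is closed under predecessors by `fwd-asym`, hence each boundary path
    -- contributes at most one.
    unreachable-cut : (∀ {x} → Reach x → ¬ InR x) → (X : Fin n → Bool) →
      (∀ x → X x ≡ true → Reach x) → (∀ x → X x ≡ false → ¬ Reach x) → cutSize H X ≤ length boundary
    unreachable-cut no-R X sound complete = ℕ.≤-trans
      (cutSize-≤ H X L λ u v a xu xv → decidable-stable (DecMembership._∈?_ (Product.≡-dec F._≟_ F._≟_) (u , v) L)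
        λ ∉L → complete v xv (next (sound u xu) a (∉L ∘ exit xu xv)))
      (length-concatMap-≤ (λ (u , v) → firstExit X (path u v)) (λ (u , v) → length-firstExit X (path u v)) boundary)
      where
      L : List (Fin n × Fin n)
      L = concatMap (λ (u , v) → firstExit X (path u v)) boundary
      closed : ∀ {x y} → Fwd x y → X y ≡ true → X x ≡ true
      closed {x} f xy with X x in eq
      ... | true = refl
      ... | false = ⊥-elim (complete x eq (next (sound _ xy) (adj-sym (fwd-adj f)) (fwd-asym f)))
      exit : ∀ {x y} → X x ≡ true → X y ≡ false → Fwd x y → (x , y) ∈ L
      exit xx xy (u , v , e , s , t , c) = ∈-concat⁺′
        (∈-firstExit X (path u v) (λ c′ → closed (u , v , e , s , t , c′)) c xx xy)
        (∈-map⁺ (λ (u , v) → firstExit X (path u v)) (boundary⁺ e s t))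

    edge-InQ : ∀ {u v x} → Edge ES u v → S u ≡ true → S v ≡ true → x ∈ sg u v → InQ x
    edge-InQ (inj₁ e) s t p = inj₂ (_ , _ , e , s , t , p)
    edge-InQ (inj₂ e) s t p = inj₂ (_ , _ , e , t , s , ∈-flip (inj₂ e) p)

    trace-InQ : ∀ {a b r} → Route ES a b r → All (λ v → S v ≡ true) r → ∀ {x} → x ∈ trace ρ r → InQ x
    trace-InQ (one e) (s ∷ t ∷ []) p = edge-InQ e s t p
    trace-InQ {r = u ∷ v ∷ _} (f ∷ r) (s ∷ t ∷ ss) p with ∈-++⁻ (sg u v) p
    ... | inj₁ q = edge-InQ f s t q
    ... | inj₂ (here refl) = inj₁ (v , proj₂ (edge-bound f) , t , refl)
    ... | inj₂ (there q) = trace-InQ r (t ∷ ss) q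

    -- Counting branch vertices alone: a closed route with four entries repeats its start, and its
    -- three vertices are what `IsCircuit` asks for.
    length-trace : ∀ {a b r} → Route ES a b r → length r ≤ 2 + length (trace ρ r)
    length-trace (one e) = s≤s (s≤s z≤n)
    length-trace {r = u ∷ v ∷ w ∷ s} (e ∷ r) = s≤s (ℕ.≤-trans (length-trace r) (s≤s
      (subst (suc (length (trace ρ (v ∷ w ∷ s))) ≤_) (sym (List.length-++ (sg u v))) (ℕ.m≤n+m _ _))))

    -- Without a walk, the set reached contains the circuit of the route through `S` and misses the
    -- circuit `d` in R, so its cut has at least five edges; but `unreachable-cut` allows only four.
    residual-walk : IsCyclicallyConnected 5 H → length boundary ≤ 4 →
      ∀ {a r} → Route ES a a r → 4 ≤ length r → All (λ v → S v ≡ true) r → Unique (pt a ∷ interior r) →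
      (d : Fin 5 → Fin n) → IsCircuit5 H d → (∀ i → InR (d i)) →
      (∀ w ws → InQ w → Walk w ws → Unique (w ∷ ws) → ⊥) → ⊥
    residual-walk conn four {a} {r} route long inS uniq d dc dR k = ¬¬-decide n Reach cut
      where
      no-R : ∀ {x} → Reach x → ¬ InR x
      no-R rx ir = let w , zs , q , wk = reach-walk rx (end ir) ; zs′ , wk′ , u = walk-unique wk in k w zs′ q wk′ u
      route-head : ∀ {a b r} → Route ES a b r → All (λ v → S v ≡ true) r → a < N × S a ≡ true
      route-head (one e) (s ∷ _) = proj₁ (edge-bound e) , s
      route-head (e ∷ _) (s ∷ _) = proj₁ (edge-bound e) , s
      cut : (∀ x → Reach x ⊎ ¬ Reach x) → ⊥
      cut dec = ℕ.<-irrefl refl (ℕ.≤-trans (proj₂ conn X inside outside)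
        (ℕ.≤-trans (unreachable-cut no-R X sound complete) four))
        where
        X : Fin n → Bool
        X x = [ (λ _ → true) , (λ _ → false) ]′ (dec x)
        sound : ∀ x → X x ≡ true → Reach x
        sound x e with dec x
        ... | inj₁ p = p
        complete : ∀ x → X x ≡ false → ¬ Reach x
        complete x e with dec x
        ... | inj₂ p = p
        in-X : ∀ {x} → Reach x → X x ≡ true
        in-X {x} p with dec x
        ... | inj₁ _ = refl
        ... | inj₂ q = ⊥-elim (q p)
        out-X : ∀ {x} → ¬ Reach x → not (X x) ≡ true
        out-X {x} p with dec x
        ... | inj₁ q = ⊥-elim (p q)
        ... | inj₂ _ = refl
        inside : ContainsCircuit H X
        inside = vm a ∷ trace ρ r ,
          (ℕ.≤-pred (ℕ.≤-trans long (length-trace route)) , circuit-unique ρ (proj₁ (route-head route inS)) route uniq ,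
            _ , _ , refl , trace-chain ρ route) ,
          in-X (start (inj₁ (a , proj₁ (route-head route inS) , proj₂ (route-head route inS) , refl))) ∷
          All.tabulate (in-X ∘ start ∘ trace-InQ route inS)
        outside : ContainsCircuit H (not ∘ X)
        outside = _ , circuit5 H d dc , o 0F ∷ o 1F ∷ o 2F ∷ o 3F ∷ o 4F ∷ []
          where
          o : ∀ i → not (X (d i)) ≡ true
          o i = out-X λ p → no-R p (dR i)

  -- The feet are interior to paths, since a branch vertex already has its three edges in the
  -- embedding.
  NoEar : (Embedding N ES → Set) → Set
  NoEar Fix = ∀ ρ → Fix ρ → let open Embedding ρ in ∀ {a b c d p q E} →
    (a , b) ∈ ES → S a ≡ true → S b ≡ true → p ∈ sg a b →
    (c , d) ∈ ES → S c ≡ false → S d ≡ false → q ∈ sg c d →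
    Chain H (p ∷ E ∷ʳ q) → Unique E → (∀ {x} → x ∈ E → ¬ Occupied x) → ⊥

  -- What the induction asks of a rotation: R keeps its vertices, a new forward step can only start
  -- in the old Q, and the initial piece of the path qt joins Q.
  CanRotate : (Embedding N ES → Set) → Set
  CanRotate Fix = ∀ ρ → Fix ρ → let open Embedding ρ in ∀ {a b q t p u E m₁ m₂} →
    (a , b) ∈ ES → S a ≡ true → S b ≡ true → p ∈ sg a b →
    (q , t) ∈ ES → S q ≡ true → S t ≡ false → sg q t ≡ m₁ ++ u ∷ m₂ →
    Chain H (p ∷ E ∷ʳ u) → Unique E → (∀ {x} → x ∈ E → ¬ Occupied x) →
    Σ (Embedding N ES) λ ρ′ → Fix ρ′ × (∀ {x} → InR ρ x → InR ρ′ x) ×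
      (∀ {x y} → Fwd ρ′ x y → Fwd ρ x y ⊎ InQ ρ x) × (∀ {x} → x ∈ vm q ∷ m₁ → InQ ρ′ x)

  module _ (outward : ∀ {u v} → (u , v) ∈ ES → S v ≡ true → S u ≡ true)
           (branch : ∀ {v} → v < N → ∃ λ u₁ → ∃₂ λ u₂ u₃ →
              Edge ES v u₁ × Edge ES v u₂ × Edge ES v u₃ × u₁ ≢ u₂ × u₁ ≢ u₃ × u₂ ≢ u₃) where

    module _ (ρ : Embedding N ES) where
      open Embedding ρ

      classify : ∀ {x} → Occupied x → InQ ρ x ⊎ InR ρ x ⊎ InP ρ x
      classify (inj₁ (w , l , e)) with S w in s
      ... | true = inj₁ (inj₁ (w , l , s , e))
      ... | false = inj₂ (inj₁ (inj₁ (w , l , s , e)))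
      classify (inj₂ (u , v , e , p)) with S u in s | S v in t
      ... | true | true = inj₁ (inj₂ (u , v , e , s , t , p))
      ... | true | false = inj₂ (inj₂ (u , v , e , s , t , p))
      ... | false | false = inj₂ (inj₁ (inj₂ (u , v , e , s , t , p)))
      ... | false | true = ⊥-elim (true≢false (trans (sym (outward e t)) s))

      private
        first : ℕ → ℕ → Fin n
        first v u with sg v u
        ... | [] = vm u
        ... | x ∷ _ = x

        first-view : ∀ v u → first v u ∈ sg v u ⊎ (first v u ≡ vm u × sg v u ≡ [])
        first-view v u with sg v u
        ... | [] = inj₂ (refl , refl)
        ... | x ∷ _ = inj₁ (here refl)

        first-path : ∀ v u → ∃ λ r → path v u ≡ vm v ∷ first v u ∷ r
        first-path v u with sg v u
        ... | [] = _ , refl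
        ... | x ∷ _ = _ , refl

        first-adj : ∀ {v u} → Edge ES v u → Adj H (vm v) (first v u)
        first-adj {v} {u} e with path v u | first-path v u | path-chain e
        ... | _ | r , refl | a , _ = a

        first-inj : ∀ {v u u′} → Edge ES v u → Edge ES v u′ → u ≢ u′ → first v u ≢ first v u′
        first-inj {v} {u} {u′} e e′ ne eq with first-view v u | first-view v u′
        ... | inj₁ p | inj₁ p′ with owner e e′ p (subst (_∈ sg v u′) (sym eq) p′)
        ... | inj₁ (_ , q) = ne q
        ... | inj₂ (_ , q) = edge-≢ e (sym q)
        first-inj {v} {u} {u′} e e′ ne eq | inj₁ p | inj₂ (q , _) = vm∉ (proj₂ (edge-bound e′)) e (subst (_∈ sg v u) (trans eq q) p)
        first-inj {v} {u} {u′} e e′ ne eq | inj₂ (q , _) | inj₁ p = vm∉ (proj₂ (edge-bound e)) e′ (subst (_∈ sg v u′) (trans (sym eq) q) p)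
        first-inj {v} {u} {u′} e e′ ne eq | inj₂ (q , _) | inj₂ (q′ , _) = ne (vm-inj (proj₂ (edge-bound e)) (proj₂ (edge-bound e′)) (trans (sym q) (trans eq q′)))

      -- The three embedded edges at v begin with three different edges of `H`, and a cubic vertex
      -- has no others.
      branch-neighbour : ∀ {v y} → v < N → Adj H (vm v) y → ∃ λ u → Edge ES v u × y ≡ first v u
      branch-neighbour l a with branch l
      ... | u₁ , u₂ , u₃ , e₁ , e₂ , e₃ , n₁₂ , n₁₃ , n₂₃
        with cubic-neighbour H cubic ((first-inj e₁ e₂ n₁₂ ∷ first-inj e₁ e₃ n₁₃ ∷ []) ∷ (first-inj e₂ e₃ n₂₃ ∷ []) ∷ [] ∷ [])
               (first-adj e₁) (first-adj e₂) (first-adj e₃) a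
      ... | here q = u₁ , e₁ , q
      ... | there (here q) = u₂ , e₂ , q
      ... | there (there (here q)) = u₃ , e₃ , q

      -- At a branch vertex of Q every edge of `H` leads into Q or begins a leaving path and is
      -- forward. A residual step out of Q therefore starts inside a side of Q.
      leaves-Q-edge : ∀ {w y} → InQ ρ w → Adj H w y → ¬ Fwd ρ w y → ¬ InQ ρ y →
        ∃₂ λ u v → (u , v) ∈ ES × S u ≡ true × S v ≡ true × w ∈ sg u v
      leaves-Q-edge (inj₂ q) _ _ _ = q
      leaves-Q-edge {y = y} (inj₁ (w , l , s , refl)) a nf nq with branch-neighbour l a
      ... | u , e , refl with S u in t
      ... | true = ⊥-elim (nq (in-Q e (first-view w u)))
        where
        in-Q : Edge ES w u → first w u ∈ sg w u ⊎ (first w u ≡ vm u × sg w u ≡ []) → InQ ρ (first w u)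
        in-Q e (inj₂ (q , _)) = inj₁ (u , proj₂ (edge-bound e) , t , q)
        in-Q (inj₁ e) (inj₁ p) = inj₂ (w , u , e , s , t , p)
        in-Q (inj₂ e) (inj₁ p) = inj₂ (u , w , e , t , s , ∈-flip (inj₂ e) p)
      leaves-Q-edge {y = y} (inj₁ (w , l , s , refl)) a nf nq | u , inj₂ e , refl | false = ⊥-elim (true≢false (trans (sym (outward e s)) t))
      leaves-Q-edge {y = y} (inj₁ (w , l , s , refl)) a nf nq | u , inj₁ e , refl | false = ⊥-elim (nf (w , u , e , s , t ,
        subst (λ p → Consec p (vm w) (first w u)) (sym (proj₂ (first-path w u))) (inj₁ (refl , refl))))

      -- A branch vertex of R is entered from R, from the last interior vertex of a leaving path, or
      -- by a leaving path that is a single edge. The hypotheses on `p` exclude all three.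
      enters-R-edge : ∀ {p y} → InR ρ y → Adj H p y → ¬ Fwd ρ p y → ¬ InR ρ p → ¬ InP ρ p →
        ∃₂ λ u v → (u , v) ∈ ES × S u ≡ false × S v ≡ false × y ∈ sg u v
      enters-R-edge (inj₂ q) _ _ _ _ = q
      enters-R-edge {p} (inj₁ (w , l , s , refl)) a nf nr np with branch-neighbour l (adj-sym a)
      ... | u , e , refl with S u in t
      ... | false = ⊥-elim (nr (in-R e (first-view w u)))
        where
        in-R : Edge ES w u → first w u ∈ sg w u ⊎ (first w u ≡ vm u × sg w u ≡ []) → InR ρ (first w u)
        in-R e (inj₂ (q , _)) = inj₁ (u , proj₂ (edge-bound e) , t , q)
        in-R (inj₁ e) (inj₁ p) = inj₂ (w , u , e , s , t , p)
        in-R (inj₂ e) (inj₁ p) = inj₂ (u , w , e , t , s , ∈-flip (inj₂ e) p)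
      enters-R-edge {p} (inj₁ (w , l , s , refl)) a nf nr np | u , inj₁ e , refl | true = ⊥-elim (true≢false (trans (sym (outward e t)) s))
      enters-R-edge {p} (inj₁ (w , l , s , refl)) a nf nr np | u , inj₂ e , refl | true with first-view w u
      ... | inj₁ q = ⊥-elim (np (u , w , e , t , s , ∈-flip (inj₂ e) q))
      ... | inj₂ (q , empty) = ⊥-elim (nf (u , w , e , t , s , subst (λ z → Consec (vm u ∷ z ∷ʳ vm w) (first w u) (vm w))
          (sym (trans (rev (inj₂ e)) (cong reverse empty))) (inj₁ (q , refl))))

      -- The neighbours of `u` are its predecessor and successor on the path and the vertex `z`
      -- before it on the walk. Returning to `z` is excluded and the successor is a forward step, so
      -- the predecessor remains.
      turns-back : ∀ {q t m₁ u m₂ z y} → (q , t) ∈ ES → S q ≡ true → S t ≡ false → sg q t ≡ m₁ ++ u ∷ m₂ →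
        Adj H z u → ¬ Fwd ρ z u → ¬ InR ρ z → ¬ InP ρ z → Adj H u y → ¬ Fwd ρ u y → z ≢ y → y ∈ vm q ∷ m₁
      turns-back {q} {t} {m₁} {u} {m₂} {z} {y} e s s′ eq zu nf nr np uy nf′ z≢y
        with snoc-view (vm q) m₁ | cons-view m₂ (vm t)
      ... | pre , pred , eq₁ | succ , post , eq₂ = decide
        (cubic-neighbour H cubic ((pred≢succ ∷ (z≢pred ∘ sym) ∷ []) ∷ ((z≢succ ∘ sym) ∷ []) ∷ [] ∷ [])
           (adj-sym (fwd-adj ρ pred-u)) (fwd-adj ρ u-succ) (adj-sym zu) uy)
        where
        path≡ : path q t ≡ pre ++ pred ∷ u ∷ succ ∷ post
        path≡ = trans (cong (λ l → vm q ∷ l ∷ʳ vm t) eq) (trans (cong (vm q ∷_) (List.++-assoc m₁ _ _))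
          (trans (cong₂ (λ k l → k ++ u ∷ l) eq₁ eq₂) (List.++-assoc pre _ _)))
        unq : Unique (pred ∷ u ∷ succ ∷ post)
        unq = unique-++⁻ʳ pre (subst Unique path≡ (path-unique (inj₁ e)))
        pred-u : Fwd ρ pred u
        pred-u = q , t , e , s , s′ , subst (λ p → Consec p pred u) (sym path≡) (consec-++⁺ʳ pre (inj₁ (refl , refl)))
        u-succ : Fwd ρ u succ
        u-succ = q , t , e , s , s′ , subst (λ p → Consec p u succ) (sym path≡) (consec-++⁺ʳ pre (inj₂ (inj₁ (refl , refl))))
        pred≢succ : pred ≢ succ
        pred≢succ e = ∉-head unq (there (here e))
        z≢pred : z ≢ pred
        z≢pred refl = nf pred-u
        z≢succ : z ≢ succ
        z≢succ refl with ∈-∷ʳ⁻ m₂ (subst (succ ∈_) (sym eq₂) (here refl))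
        ... | inj₁ p = np (q , t , e , s , s′ , subst (succ ∈_) (sym eq) (∈-++⁺ʳ m₁ (there p)))
        ... | inj₂ refl = nr (inj₁ (t , proj₂ (bound e) , s′ , refl))
        decide : y ∈ pred ∷ succ ∷ z ∷ [] → y ∈ vm q ∷ m₁
        decide (here refl) = subst (y ∈_) (sym eq₁) (∈-∷ʳ pre)
        decide (there (here refl)) = ⊥-elim (nf′ u-succ)
        decide (there (there (here refl))) = ⊥-elim (z≢y refl)

      record Hit (w : Fin n) (ws : List (Fin n)) : Set where
        field
          E : List (Fin n)
          u : Fin n
          rest : List (Fin n)
          split : ws ≡ E ++ u ∷ rest
          chain : Chain H (w ∷ E ∷ʳ u)
          free : ∀ {x} → x ∈ E → ¬ Occupied x
          z : Fin n
          z∈ : z ∈ w ∷ E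
          z-u : Adj H z u
          z-u-residual : ¬ Fwd ρ z u
          walk : Walk ρ u rest
          hit : InR ρ u ⊎ InP ρ u

      firstHit : ∀ {w ws} → Walk ρ w ws → ¬ InR ρ w → All (λ x → ¬ InQ ρ x) ws → (Hit w ws → ⊥) → ⊥
      firstHit (end r) nr nqs k = nr r
      firstHit {w} (step {x = x} {ws = ws} a nf wk) nr (nq ∷ nqs) k = excluded-middle λ
        { (inj₁ occ) → k (now ([ (λ q → ⊥-elim (nq q)) , (λ h → h) ]′ (classify occ)))
        ; (inj₂ fr) → firstHit wk (fr ∘ R-occupied ρ) nqs (k ∘ later fr) }
        where
        now : InR ρ x ⊎ InP ρ x → Hit w (x ∷ ws)
        now h = record { E = [] ; u = x ; rest = ws ; split = refl ; chain = a , _ ; free = λ ()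
                       ; z = w ; z∈ = here refl ; z-u = a ; z-u-residual = nf ; walk = wk ; hit = h }
        later : ¬ Occupied x → Hit x ws → Hit w (x ∷ ws)
        later fr h = record
          { E = x ∷ h.E ; u = h.u ; rest = h.rest ; split = cong (x ∷_) h.split ; chain = a , h.chain
          ; free = λ { (here refl) → fr ; (there p) → h.free p }
          ; z = h.z ; z∈ = there h.z∈ ; z-u = h.z-u ; z-u-residual = h.z-u-residual ; walk = h.walk ; hit = h.hit }
          where module h = Hit h

    -- All new forward steps begin in the old Q, which the walk avoids.
    transfer : ∀ {ρ ρ′} → (∀ {x} → InR ρ x → InR ρ′ x) → (∀ {x y} → Fwd ρ′ x y → Fwd ρ x y ⊎ InQ ρ x) →
      ∀ {w ws} → Walk ρ w ws → All (λ x → ¬ InQ ρ x) (w ∷ ws) → Walk ρ′ w ws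
    transfer R⊆ F⊆ (end r) _ = end (R⊆ r)
    transfer R⊆ F⊆ (step a nf wk) (nq ∷ nqs) = step a ([ nf , nq ]′ ∘ F⊆) (transfer R⊆ F⊆ wk nqs)

    module _ (Fix : Embedding N ES → Set) (ear : NoEar Fix) (rotate : CanRotate Fix) where

      -- Induction on a bound for the length of the walk, for all embeddings at once because a
      -- rotation replaces ρ.
      no-walk : ∀ k ρ → Fix ρ → ∀ {w ws} → length ws ≤ k → InQ ρ w → Walk ρ w ws → Unique (w ∷ ws) → ⊥
      no-walk k ρ fx le q (end r) u = Q∩R ρ q r
      no-walk (suc k) ρ fx {w} {y ∷ ws} (s≤s le) q wk@(step a nf wk′) unq@(_ ∷ unq′) = excluded-middle λ
        -- A walk that returns to Q is cut down to the part after the return.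
        { (inj₁ again) → let z , z∈ , qz = find again ; zs , wk″ , u″ , le″ = walk-suffix ρ wk′ unq′ z∈ in
            no-walk k ρ fx (ℕ.≤-trans le″ le) qz wk″ u″
        ; (inj₂ never) → let nqs = All.¬Any⇒All¬ (y ∷ ws) never in
            firstHit ρ wk (Q∩R ρ q) nqs (meet nqs) }
        where
        open Embedding ρ
        find : ∀ {xs} → Any (InQ ρ) xs → ∃ λ z → z ∈ xs × InQ ρ z
        find (here px) = _ , here refl , px
        find (there p) = let z , z∈ , qz = find p in z , there z∈ , qz
        meet : All (λ x → ¬ InQ ρ x) (y ∷ ws) → Hit ρ w (y ∷ ws) → ⊥
        meet nqs@(nq ∷ _) h = on-hit h.hit
          where
          module h = Hit h
          not-RP : h.z ∈ w ∷ h.E → ¬ InR ρ h.z × ¬ InP ρ h.z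
          not-RP (here refl) = Q∩R ρ q , Q∩P ρ q
          not-RP (there p) = h.free p ∘ R-occupied ρ , h.free p ∘ P-occupied ρ
          unqE : Unique (w ∷ h.E ++ h.u ∷ h.rest)
          unqE = subst (λ l → Unique (w ∷ l)) h.split unq
          uniqE : Unique h.E
          uniqE = unique-++⁻ˡ h.E (unique-++⁻ʳ (w ∷ []) unqE)
          on-hit : InR ρ h.u ⊎ InP ρ h.u → ⊥
          on-hit (inj₁ r) with leaves-Q-edge ρ q a nf nq | enters-R-edge ρ r h.z-u h.z-u-residual (proj₁ (not-RP h.z∈)) (proj₂ (not-RP h.z∈))
          ... | _ , _ , e , s , t , p | _ , _ , e′ , s′ , t′ , p′ = ear ρ fx e s t p e′ s′ t′ p′ h.chain uniqE h.free
          on-hit (inj₂ pu@(q₀ , t₀ , e₀ , s₀ , t₀f , u∈)) with leaves-Q-edge ρ q a nf nq | ∈-∃++ u∈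
          ... | _ , _ , e , s , t , p | m₁ , m₂ , eq with rotate ρ fx e s t p e₀ s₀ t₀f eq h.chain uniqE h.free
          ... | ρ′ , fx′ , R⊆ , F⊆ , Q′ = continue h.rest h.walk h.split unqE
            where
            continue : ∀ rest → Walk ρ h.u rest → y ∷ ws ≡ h.E ++ h.u ∷ rest → Unique (w ∷ h.E ++ h.u ∷ rest) → ⊥
            -- A walk that stops at `u` would put `u` both in R and inside a leaving path.
            continue [] (end r) _ _ = R∩P ρ r pu
            continue (v ∷ vs) (step uv nf′ wk″) sp un =
              no-walk k ρ′ fx′ shorter (Q′ back) (transfer R⊆ F⊆ wk″ nq-rest) (unique-++⁻ʳ (h.u ∷ []) (unique-++⁻ʳ (w ∷ h.E) un))
              where
              back : v ∈ vm q₀ ∷ m₁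
              back = turns-back ρ e₀ s₀ t₀f eq h.z-u h.z-u-residual (proj₁ (not-RP h.z∈)) (proj₂ (not-RP h.z∈)) uv nf′
                λ { refl → unique-++-disjoint (w ∷ h.E) un h.z∈ (there (here refl)) }
              nq-rest : All (λ x → ¬ InQ ρ x) (v ∷ vs)
              nq-rest = All.++⁻ʳ (h.u ∷ []) (All.++⁻ʳ h.E (subst (All (λ x → ¬ InQ ρ x)) sp nqs))
              -- `u` and `v` are no longer counted: the new walk starts at `v`.
              shorter : length vs ≤ k
              shorter = ℕ.≤-trans (ℕ.≤-pred (ℕ.≤-trans (ℕ.n≤1+n _)
                (subst (suc (suc (length vs)) ≤_) (sym (trans (cong length sp) (List.length-++ h.E))) (ℕ.m≤n+m _ (length h.E))))) le

-- Decision procedures for concrete graphs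

∧-true : ∀ {a b} → a ∧ b ≡ true → a ≡ true × b ≡ true
∧-true {true} {true} e = refl , refl

∨-true : ∀ {a b} → a ∨ b ≡ true → a ≡ true ⊎ b ≡ true
∨-true {true} e = inj₁ refl
∨-true {false} e = inj₂ e

not-true : ∀ {a} → not a ≡ true → a ≡ true → ⊥
not-true {false} e ()

opaque
  -- opaque because checks on concrete edge lists become huge when they unfold with free variables in them
  every some : ∀ {A : Set} → (A → Bool) → List A → Bool
  every p [] = true
  every p (x ∷ xs) = p x ∧ every p xs
  some p [] = false
  some p (x ∷ xs) = p x ∨ some p xs

  every-sound : ∀ {A : Set} (p : A → Bool) {xs} → every p xs ≡ true → ∀ {x} → x ∈ xs → p x ≡ true
  every-sound p {y ∷ xs} e (here refl) = proj₁ (∧-true e)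
  every-sound p {y ∷ xs} e (there q) = every-sound p (proj₂ (∧-true {p y} e)) q

  some-sound : ∀ {A : Set} (p : A → Bool) xs → some p xs ≡ true → ∃ λ x → x ∈ xs × p x ≡ true
  some-sound p (y ∷ xs) e with p y in eq
  ... | true = y , here refl , eq
  ... | false = let x , x∈ , px = some-sound p xs e in x , there x∈ , px

  some-complete : ∀ {A : Set} (p : A → Bool) {x xs} → x ∈ xs → p x ≡ true → some p xs ≡ true
  some-complete p (here refl) e rewrite e = refl
  some-complete p {xs = y ∷ xs} (there q) e with p y
  ... | true = refl
  ... | false = some-complete p q e

elemᵇ : ℕ → List ℕ → Bool
elemᵇ v = some (v ≡ᵇ_)

memᵇ : ℕ → ℕ → Edges → Bool
memᵇ u v = some (λ (a , b) → (u ≡ᵇ a) ∧ (v ≡ᵇ b))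

memᵇ-sound : ∀ {u v} ES → memᵇ u v ES ≡ true → (u , v) ∈ ES
memᵇ-sound {u} {v} ES e with some-sound _ ES e
... | (a , b) , p , q with ∧-true {u ≡ᵇ a} q
... | q₁ , q₂ rewrite ≡ᵇ⇒≡′ u a q₁ | ≡ᵇ⇒≡′ v b q₂ = p

memᵇ-complete : ∀ {u v ES} → (u , v) ∈ ES → memᵇ u v ES ≡ true
memᵇ-complete {u} {v} p = some-complete _ p (cong₂ _∧_ (≡ᵇ-refl u) (≡ᵇ-refl v))

edgeᵇ : Edges → ℕ → ℕ → Bool
edgeᵇ ES u v = memᵇ u v ES ∨ memᵇ v u ES

edgeᵇ-sound : ∀ {u v} ES → edgeᵇ ES u v ≡ true → Edge ES u v
edgeᵇ-sound {u} {v} ES e = Sum.map (memᵇ-sound ES) (memᵇ-sound ES) (∨-true {memᵇ u v ES} e)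

routeᵇ : Edges → ℕ → ℕ → List ℕ → Bool
routeᵇ ES a b (u ∷ v ∷ []) = (a ≡ᵇ u) ∧ (b ≡ᵇ v) ∧ edgeᵇ ES u v
routeᵇ ES a b (u ∷ v ∷ w ∷ r) = (a ≡ᵇ u) ∧ edgeᵇ ES u v ∧ routeᵇ ES v b (v ∷ w ∷ r)
routeᵇ ES a b _ = false

routeᵇ-sound : ∀ ES a b r → routeᵇ ES a b r ≡ true → Route ES a b r
routeᵇ-sound ES a b (u ∷ v ∷ []) e with ∧-true {a ≡ᵇ u} e
... | e₁ , e₂ with ∧-true {b ≡ᵇ v} e₂
... | e₃ , e₄ rewrite ≡ᵇ⇒≡′ a u e₁ | ≡ᵇ⇒≡′ b v e₃ = one (edgeᵇ-sound ES e₄)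
routeᵇ-sound ES a b (u ∷ v ∷ w ∷ r) e = subst (λ a → Route ES a b (u ∷ v ∷ w ∷ r)) (sym (≡ᵇ⇒≡′ a u (proj₁ (∧-true e))))
  (edgeᵇ-sound ES (proj₁ (∧-true (proj₂ (∧-true {a ≡ᵇ u} e)))) ∷
   routeᵇ-sound ES v b (v ∷ w ∷ r) (proj₂ (∧-true {edgeᵇ ES u v} (proj₂ (∧-true {a ≡ᵇ u} e)))))

atomᵇ : Atom → Atom → Bool
atomᵇ (pt u) (pt v) = u ≡ᵇ v
atomᵇ (seg u v) (seg u′ v′) = (u ≡ᵇ u′) ∧ (v ≡ᵇ v′)
atomᵇ _ _ = false

atomᵇ-refl : ∀ a → atomᵇ a a ≡ true
atomᵇ-refl (pt u) = ≡ᵇ-refl u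
atomᵇ-refl (seg u v) rewrite ≡ᵇ-refl u = ≡ᵇ-refl v

opaque
  unfolding every

  uniqueᵇ : List Atom → Bool
  uniqueᵇ [] = true
  uniqueᵇ (x ∷ xs) = every (not ∘ atomᵇ x) xs ∧ uniqueᵇ xs

  uniqueᵇ-sound : ∀ xs → uniqueᵇ xs ≡ true → Unique xs
  uniqueᵇ-sound [] e = []
  uniqueᵇ-sound (x ∷ xs) e with ∧-true {every (not ∘ atomᵇ x) xs} e
  ... | e₁ , e₂ = unique-∷ (λ x∈ → not-true (every-sound (not ∘ atomᵇ x) e₁ x∈) (atomᵇ-refl x)) (uniqueᵇ-sound xs e₂)

opaque
  rerouteᵇ : ℕ → Edges → ℕ → Edges → (ℕ → ℕ) → (ℕ → ℕ → List ℕ) → Bool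
  rerouteᵇ N ES N′ ES′ φ route =
    every (λ (u , v) → (u <ᵇ N′) ∧ (v <ᵇ N′) ∧ not (u ≡ᵇ v) ∧ not (memᵇ v u ES′) ∧ routeᵇ ES (φ u) (φ v) (route u v)) ES′
    ∧ every (λ v → φ v <ᵇ N) (upTo N′)
    ∧ uniqueᵇ (concatMap (image φ route) (atoms N′ ES′))

<ᵇ-sound : ∀ {m n} → (m <ᵇ n) ≡ true → m < n
<ᵇ-sound {m} {n} e = ℕ.<ᵇ⇒< m n (subst T (sym e) _)

opaque
  unfolding rerouteᵇ

  rerouteᵇ-sound : ∀ {N ES N′ ES′ φ route} → rerouteᵇ N ES N′ ES′ φ route ≡ true → Reroute N ES N′ ES′ φ route
  rerouteᵇ-sound {N} {ES} {N′} {ES′} {φ} {route} e with ∧-true {every _ ES′} e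
  ... | e₁ , e₂ with ∧-true {every _ (upTo N′)} e₂
  ... | e₃ , e₄ = record
    { bound = λ p → <ᵇ-sound (proj₁ (local p)) , <ᵇ-sound (proj₁ (proj₂ (local p)))
    ; loopless = λ { {u} p refl → not-true (proj₁ (proj₂ (proj₂ (local p)))) (≡ᵇ-refl u) }
    ; oriented = λ p q → not-true (proj₁ (proj₂ (proj₂ (proj₂ (local p))))) (memᵇ-complete q)
    ; φ-bound = λ l → <ᵇ-sound (every-sound (λ v → φ v <ᵇ N) e₃ (∈-upTo⁺ l))
    ; routes = λ {u} {v} p → routeᵇ-sound ES (φ u) (φ v) (route u v) (proj₂ (proj₂ (proj₂ (proj₂ (local p)))))
    ; unique = uniqueᵇ-sound _ e₄
    }
    where
    local : ∀ {u v} → (u , v) ∈ ES′ → (u <ᵇ N′) ≡ true × (v <ᵇ N′) ≡ true × not (u ≡ᵇ v) ≡ true ×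
      not (memᵇ v u ES′) ≡ true × routeᵇ ES (φ u) (φ v) (route u v) ≡ true
    local {u} {v} p with ∧-true {u <ᵇ N′} (every-sound _ e₁ p)
    ... | a , b with ∧-true {v <ᵇ N′} b
    ... | c , d with ∧-true {not (u ≡ᵇ v)} d
    ... | f , g with ∧-true {not (memᵇ v u ES′)} g
    ... | h , i = a , c , f , h , i

sameᵇ : ℕ → ℕ → ℕ → ℕ → Bool
sameᵇ u v a b = ((u ≡ᵇ a) ∧ (v ≡ᵇ b)) ∨ ((u ≡ᵇ b) ∧ (v ≡ᵇ a))

-- The route replacing the edge ab once the edge w₁w₂ is deleted and its two ends are suppressed.
bypass : Edges → ℕ → ℕ → ℕ → ℕ → List ℕ
bypass ES w₁ w₂ a b =
  if live a b then a ∷ b ∷ []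
  else if live a w₁ ∧ live w₁ b then a ∷ w₁ ∷ b ∷ []
  else if live a w₂ ∧ live w₂ b then a ∷ w₂ ∷ b ∷ []
  -- The empty list is rejected by `routeᵇ`, so a certificate with a missing route fails its check.
  else []
  where
  live : ℕ → ℕ → Bool
  live u v = edgeᵇ ES u v ∧ not (sameᵇ u v w₁ w₂)

moves : List (ℕ × ℕ) → ℕ → ℕ
moves [] v = v
moves ((u , w) ∷ ms) v = if v ≡ᵇ u then w else moves ms v

-- The dodecahedron and its extensions as edge lists

dodecEdges : Edges
dodecEdges =
  (0 , 1) ∷ (1 , 2) ∷ (2 , 3) ∷ (3 , 4) ∷ (4 , 5) ∷ (5 , 6) ∷ (6 , 7) ∷ (7 , 8) ∷ (8 , 9) ∷ (0 , 9) ∷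
  (0 , 10) ∷ (1 , 11) ∷ (2 , 12) ∷ (3 , 13) ∷ (4 , 14) ∷ (5 , 15) ∷ (6 , 16) ∷ (7 , 17) ∷ (8 , 18) ∷ (9 , 19) ∷
  (10 , 12) ∷ (12 , 14) ∷ (14 , 16) ∷ (16 , 18) ∷ (10 , 18) ∷ (11 , 13) ∷ (13 , 15) ∷ (15 , 17) ∷ (17 , 19) ∷ (11 , 19) ∷ []

private
  listed : Fin 20 → Fin 20 → Bool
  listed u v = not (dodecahedron u v) ∨ edgeᵇ dodecEdges (toℕ u) (toℕ v)

opaque
  unfolding every some

  dodec-adj : ∀ u v → Adj dodecahedron u v → Edge dodecEdges (toℕ u) (toℕ v)
  dodec-adj u v a with ∨-true {not (dodecahedron u v)} (every-sound (listed u)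
    (every-sound (λ u → every (listed u) (allFin 20)) {allFin 20} refl (∈-allFin u)) (∈-allFin v))
  ... | inj₁ e₁ = ⊥-elim (not-true e₁ a)
  ... | inj₂ e₂ = edgeᵇ-sound dodecEdges e₂

-- `plus` puts the new vertices first and shifts the others by two; here they come last, so that old
-- vertices keep their numbers.
name : Fin 22 → ℕ
name 0F = 20
name 1F = 21
name (F.suc (F.suc v)) = toℕ v

-- Reduction modulo 20 makes the function total; `rowValid` checks that it leaves the ends of the
-- hop edges unchanged.
vertex : ℕ → Fin 20
vertex v = v mod 20

unname : ℕ → Fin 22
unname v = if v ≡ᵇ 20 then 0F else if v ≡ᵇ 21 then 1F else oldV (vertex v)

opaque
  unfolding every some

  name-unname : ∀ {v} → v < 22 → name (unname v) ≡ v
  name-unname l = ≡ᵇ⇒≡′ _ _ (every-sound (λ v → name (unname v) ≡ᵇ v) {upTo 22} refl (∈-upTo⁺ l))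

opaque
  unfolding every some

  unname-name : ∀ v → unname (name v) ≡ v
  unname-name v = toWitness {a? = F._≟_ _ _} (subst T (sym (every-sound (λ v → ⌊ unname (name v) F.≟ v ⌋) {allFin 22} refl (∈-allFin v))) _)

name-inj : ∀ {u v} → name u ≡ name v → u ≡ v
name-inj {u} {v} e = trans (sym (unname-name u)) (trans (cong unname e) (unname-name v))

opaque
  unfolding every some

  name-bound : ∀ v → name v < 22
  name-bound v = <ᵇ-sound (every-sound (λ v → name v <ᵇ 22) {allFin 22} refl (∈-allFin v))

unname-inj : ∀ {u v} → u < 22 → v < 22 → unname u ≡ unname v → u ≡ v
unname-inj l m e = trans (sym (name-unname l)) (trans (cong name e) (name-unname m))

-- The edges of the dodecahedron + (ab, cd), with 20 and 21 for the new vertices on ab and cd.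
plusEdges : ℕ × ℕ → ℕ × ℕ → Edges
plusEdges (a , b) (c , d) = (a , 20) ∷ (b , 20) ∷ (c , 21) ∷ (d , 21) ∷ (20 , 21) ∷
  trues (λ (u , v) → not (sameᵇ u v a b) ∧ not (sameᵇ u v c d)) dodecEdges

eqb-toℕ : ∀ {n} (u v : Fin n) → (toℕ u ≡ᵇ toℕ v) ≡ eqb u v
eqb-toℕ u v with u F.≟ v
... | yes refl = ≡ᵇ-refl (toℕ u)
... | no ne = ≢⇒≡ᵇ _ _ (ne ∘ F.toℕ-injective)

eqb-true : ∀ {n} {u v : Fin n} → eqb u v ≡ true → u ≡ v
eqb-true {u = u} {v} e with u F.≟ v
... | yes p = p

sameᵇ-toℕ : ∀ {n} (u v a b : Fin n) → sameᵇ (toℕ u) (toℕ v) (toℕ a) (toℕ b) ≡ sameb u v a b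
sameᵇ-toℕ u v a b rewrite eqb-toℕ u a | eqb-toℕ v b | eqb-toℕ u b | eqb-toℕ v a = refl

sameᵇ-swap : ∀ u v a b → sameᵇ v u a b ≡ sameᵇ u v a b
sameᵇ-swap u v a b = trans (cong₂ _∨_ (Bool.∧-comm (v ≡ᵇ a) _) (Bool.∧-comm (v ≡ᵇ b) _)) (Bool.∨-comm ((u ≡ᵇ b) ∧ (v ≡ᵇ a)) _)

module _ (a b c d : Fin 20) where
  private
    PE = plusEdges (toℕ a , toℕ b) (toℕ c , toℕ d)

    keep : ∀ {u v} → (u , v) ∈ dodecEdges → sameᵇ u v (toℕ a) (toℕ b) ≡ false → sameᵇ u v (toℕ c) (toℕ d) ≡ false → (u , v) ∈ PE
    keep {u} {v} e s t = there (there (there (there (there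
      (∈-trues⁺ (λ (u , v) → not (sameᵇ u v (toℕ a) (toℕ b)) ∧ not (sameᵇ u v (toℕ c) (toℕ d))) e (cong₂ (λ x y → not x ∧ not y) s t))))))

    x-edge : ∀ v → eqb v a ∨ eqb v b ≡ true → (toℕ v , 20) ∈ PE
    x-edge v e with ∨-true {eqb v a} e
    ... | inj₁ p rewrite eqb-true p = here refl
    ... | inj₂ p rewrite eqb-true p = there (here refl)

    y-edge : ∀ v → eqb v c ∨ eqb v d ≡ true → (toℕ v , 21) ∈ PE
    y-edge v e with ∨-true {eqb v c} e
    ... | inj₁ p rewrite eqb-true p = there (there (here refl))
    ... | inj₂ p rewrite eqb-true p = there (there (there (here refl)))

    not-false : ∀ {x} → not x ≡ true → x ≡ false
    not-false {false} e = refl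

  plus-adj : ∀ u v → Adj (plus dodecahedron a b c d) u v → Edge PE (name u) (name v)
  plus-adj 0F 1F e = inj₁ (there (there (there (there (here refl)))))
  plus-adj 0F (F.suc (F.suc v)) e = inj₂ (x-edge v e)
  plus-adj 1F 0F e = inj₂ (there (there (there (there (here refl)))))
  plus-adj 1F (F.suc (F.suc v)) e = inj₂ (y-edge v e)
  plus-adj (F.suc (F.suc u)) 0F e = inj₁ (x-edge u e)
  plus-adj (F.suc (F.suc u)) 1F e = inj₁ (y-edge u e)
  plus-adj (F.suc (F.suc u)) (F.suc (F.suc v)) e with ∧-true {dodecahedron u v} e
  ... | e₁ , e₂ with ∧-true {not (sameb u v a b)} e₂
  ... | e₃ , e₄ = Sum.map
      (λ p → keep p (trans (sameᵇ-toℕ u v a b) (not-false e₃)) (trans (sameᵇ-toℕ u v c d) (not-false e₄)))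
      (λ p → keep p (trans (sameᵇ-swap (toℕ u) (toℕ v) _ _) (trans (sameᵇ-toℕ u v a b) (not-false e₃)))
                    (trans (sameᵇ-swap (toℕ u) (toℕ v) _ _) (trans (sameᵇ-toℕ u v c d) (not-false e₄))))
      (dodec-adj u v e₁)

FaceIncident? : ∀ k u v → Dec (FaceIncident k u v)
FaceIncident? k u v = F.any? λ i →
  ((toℕ u ℕ.≟ face k i) ×-dec (toℕ v ℕ.≟ face k (next5 i))) ⊎-dec
  ((toℕ v ℕ.≟ face k i) ×-dec (toℕ u ℕ.≟ face k (next5 i)))

-- the part of IsJump that does not involve F
Free : Fin 20 → Fin 20 → Fin 20 → Fin 20 → Set
Free a b a′ b′ = Adj dodecahedron a b × Adj dodecahedron a′ b′ × ¬ SameEdge a b a′ b′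
  × (∀ k → ¬ (FaceIncident k a b × FaceIncident k a′ b′)) × Diverse dodecahedron a b a′ b′

SameEdge? : ∀ {n} (u v u′ v′ : Fin n) → Dec (SameEdge u v u′ v′)
SameEdge? u v u′ v′ = ((u F.≟ u′) ×-dec (v F.≟ v′)) ⊎-dec ((u F.≟ v′) ×-dec (v F.≟ u′))

Adj? : ∀ {n} (g : Graph n) u v → Dec (Adj g u v)
Adj? g u v = g u v Bool.≟ true

Free? : ∀ a b a′ b′ → Dec (Free a b a′ b′)
Free? a b c d = Adj? dodecahedron a b ×-dec Adj? dodecahedron c d ×-dec ¬? (SameEdge? a b c d)
  ×-dec F.all? (λ k → ¬? (FaceIncident? k a b ×-dec FaceIncident? k c d))
  ×-dec ¬? (a F.≟ b) ×-dec ¬? (a F.≟ c) ×-dec ¬? (a F.≟ d) ×-dec ¬? (b F.≟ c) ×-dec ¬? (b F.≟ d) ×-dec ¬? (c F.≟ d)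
  ×-dec ¬? (Adj? dodecahedron a c) ×-dec ¬? (Adj? dodecahedron a d) ×-dec ¬? (Adj? dodecahedron b c) ×-dec ¬? (Adj? dodecahedron b d)

-- Ears and rotations at a zigzag

-- The dodecahedron + (01, 23), where 0 1 2 3 is a zigzag path; the new vertices 20 and 21 complete
-- the quadrangle 1 2 21 20. The boundary edges of the quadrangle are listed as leaving it.
zigzagEdges : Edges
zigzagEdges =
  (1 , 20) ∷ (1 , 2) ∷ (2 , 21) ∷ (20 , 21) ∷
  (20 , 0) ∷ (1 , 11) ∷ (2 , 12) ∷ (21 , 3) ∷
  (0 , 9) ∷ (0 , 10) ∷ (3 , 4) ∷ (3 , 13) ∷ (4 , 5) ∷ (4 , 14) ∷ (5 , 6) ∷ (5 , 15) ∷ (6 , 7) ∷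
  (6 , 16) ∷ (7 , 8) ∷ (7 , 17) ∷ (8 , 9) ∷ (8 , 18) ∷ (9 , 19) ∷ (10 , 12) ∷ (10 , 18) ∷
  (11 , 13) ∷ (11 , 19) ∷ (12 , 14) ∷ (13 , 15) ∷ (14 , 16) ∷ (15 , 17) ∷ (16 , 18) ∷ (17 , 19) ∷ []

quad : ℕ → Bool
quad v = elemᵇ v (1 ∷ 2 ∷ 20 ∷ 21 ∷ [])

onFace : Fin 12 → ℕ → Bool
onFace k v = elemᵇ v (map (face k) (allFin 5))

Pair : Set
Pair = ℕ × ℕ

-- A row (q , g , w , e , f , ms) certifies that adding an ear from q to g to the zigzag graph, deleting
-- the edge w and suppressing its ends leaves dodecahedron + (e, f); ms lists the vertices that are renamed.
Row : Set
Row = Pair × Pair × Pair × Pair × Pair × List Pair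

-- One row for each of the 100 pairs of a side of Q and an edge of R, and a second one for (1 , 20),
-- (9 , 19) and for (2 , 21), (4 , 14): there each row moves a vertex of an admissible face that the
-- other row leaves in place.
rows : List Row
rows =
  ((1 , 20) , (0 , 9) , (0 , 23) , (0 , 10) , (2 , 3) , (0 , 22) ∷ []) ∷
  ((1 , 20) , (0 , 10) , (0 , 23) , (0 , 9) , (2 , 3) , (0 , 22) ∷ []) ∷
  ((1 , 20) , (3 , 4) , (20 , 21) , (0 , 1) , (3 , 4) , (20 , 22) ∷ (21 , 23) ∷ []) ∷
  ((1 , 20) , (3 , 13) , (20 , 21) , (0 , 1) , (3 , 13) , (20 , 22) ∷ (21 , 23) ∷ []) ∷
  ((1 , 20) , (4 , 5) , (20 , 21) , (0 , 1) , (4 , 5) , (20 , 22) ∷ (21 , 23) ∷ []) ∷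
  ((1 , 20) , (4 , 14) , (20 , 21) , (0 , 1) , (4 , 14) , (20 , 22) ∷ (21 , 23) ∷ []) ∷
  ((1 , 20) , (5 , 6) , (20 , 21) , (0 , 1) , (5 , 6) , (20 , 22) ∷ (21 , 23) ∷ []) ∷
  ((1 , 20) , (5 , 15) , (20 , 21) , (0 , 1) , (5 , 15) , (20 , 22) ∷ (21 , 23) ∷ []) ∷
  ((1 , 20) , (6 , 7) , (20 , 21) , (0 , 1) , (6 , 7) , (20 , 22) ∷ (21 , 23) ∷ []) ∷
  ((1 , 20) , (6 , 16) , (20 , 21) , (0 , 1) , (6 , 16) , (20 , 22) ∷ (21 , 23) ∷ []) ∷
  ((1 , 20) , (7 , 8) , (1 , 2) , (1 , 11) , (7 , 8) , (1 , 20) ∷ (2 , 21) ∷ (20 , 22) ∷ (21 , 23) ∷ []) ∷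
  ((1 , 20) , (7 , 17) , (20 , 21) , (0 , 1) , (7 , 17) , (20 , 22) ∷ (21 , 23) ∷ []) ∷
  ((1 , 20) , (8 , 9) , (0 , 9) , (0 , 10) , (2 , 3) , (0 , 22) ∷ (9 , 23) ∷ []) ∷
  ((1 , 20) , (8 , 18) , (20 , 21) , (0 , 1) , (8 , 18) , (20 , 22) ∷ (21 , 23) ∷ []) ∷
  ((1 , 20) , (9 , 19) , (0 , 9) , (0 , 10) , (2 , 3) , (0 , 22) ∷ (9 , 23) ∷ []) ∷
  ((1 , 20) , (9 , 19) , (11 , 19) , (2 , 12) , (11 , 13) , (1 , 20) ∷ (2 , 21) ∷ (11 , 22) ∷ (19 , 23) ∷ (20 , 2) ∷ (21 , 1) ∷ []) ∷
  ((1 , 20) , (10 , 12) , (1 , 2) , (1 , 11) , (10 , 12) , (1 , 20) ∷ (2 , 21) ∷ (20 , 22) ∷ (21 , 23) ∷ []) ∷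
  ((1 , 20) , (10 , 18) , (0 , 10) , (0 , 9) , (2 , 3) , (0 , 22) ∷ (10 , 23) ∷ []) ∷
  ((1 , 20) , (11 , 13) , (1 , 22) , (2 , 12) , (11 , 19) , (1 , 20) ∷ (2 , 21) ∷ (11 , 23) ∷ (20 , 2) ∷ (21 , 11) ∷ []) ∷
  ((1 , 20) , (11 , 19) , (1 , 22) , (2 , 12) , (11 , 13) , (1 , 20) ∷ (2 , 21) ∷ (11 , 23) ∷ (20 , 2) ∷ (21 , 11) ∷ []) ∷
  ((1 , 20) , (12 , 14) , (20 , 21) , (0 , 1) , (12 , 14) , (20 , 22) ∷ (21 , 23) ∷ []) ∷
  ((1 , 20) , (13 , 15) , (20 , 21) , (0 , 1) , (13 , 15) , (20 , 22) ∷ (21 , 23) ∷ []) ∷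
  ((1 , 20) , (14 , 16) , (20 , 21) , (0 , 1) , (14 , 16) , (20 , 22) ∷ (21 , 23) ∷ []) ∷
  ((1 , 20) , (15 , 17) , (20 , 21) , (0 , 1) , (15 , 17) , (20 , 22) ∷ (21 , 23) ∷ []) ∷
  ((1 , 20) , (16 , 18) , (1 , 2) , (1 , 11) , (16 , 18) , (1 , 20) ∷ (2 , 21) ∷ (20 , 22) ∷ (21 , 23) ∷ []) ∷
  ((1 , 20) , (17 , 19) , (20 , 21) , (0 , 1) , (17 , 19) , (20 , 22) ∷ (21 , 23) ∷ []) ∷
  ((1 , 2) , (0 , 9) , (1 , 20) , (0 , 10) , (2 , 3) , (0 , 23) ∷ (1 , 22) ∷ (20 , 0) ∷ []) ∷
  ((1 , 2) , (0 , 10) , (1 , 20) , (0 , 9) , (2 , 3) , (0 , 23) ∷ (1 , 22) ∷ (20 , 0) ∷ []) ∷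
  ((1 , 2) , (3 , 4) , (2 , 21) , (0 , 1) , (3 , 13) , (2 , 22) ∷ (3 , 23) ∷ (21 , 3) ∷ []) ∷
  ((1 , 2) , (3 , 13) , (2 , 21) , (0 , 1) , (3 , 4) , (2 , 22) ∷ (3 , 23) ∷ (21 , 3) ∷ []) ∷
  ((1 , 2) , (4 , 5) , (20 , 21) , (1 , 2) , (4 , 5) , (20 , 22) ∷ (21 , 23) ∷ []) ∷
  ((1 , 2) , (4 , 14) , (20 , 21) , (1 , 2) , (4 , 14) , (20 , 22) ∷ (21 , 23) ∷ []) ∷
  ((1 , 2) , (5 , 6) , (20 , 21) , (1 , 2) , (5 , 6) , (20 , 22) ∷ (21 , 23) ∷ []) ∷
  ((1 , 2) , (5 , 15) , (20 , 21) , (1 , 2) , (5 , 15) , (20 , 22) ∷ (21 , 23) ∷ []) ∷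
  ((1 , 2) , (6 , 7) , (20 , 21) , (1 , 2) , (6 , 7) , (20 , 22) ∷ (21 , 23) ∷ []) ∷
  ((1 , 2) , (6 , 16) , (20 , 21) , (1 , 2) , (6 , 16) , (20 , 22) ∷ (21 , 23) ∷ []) ∷
  ((1 , 2) , (7 , 8) , (20 , 21) , (1 , 2) , (7 , 8) , (20 , 22) ∷ (21 , 23) ∷ []) ∷
  ((1 , 2) , (7 , 17) , (20 , 21) , (1 , 2) , (7 , 17) , (20 , 22) ∷ (21 , 23) ∷ []) ∷
  ((1 , 2) , (8 , 9) , (20 , 21) , (1 , 2) , (8 , 9) , (20 , 22) ∷ (21 , 23) ∷ []) ∷
  ((1 , 2) , (8 , 18) , (20 , 21) , (1 , 2) , (8 , 18) , (20 , 22) ∷ (21 , 23) ∷ []) ∷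
  ((1 , 2) , (9 , 19) , (20 , 21) , (1 , 2) , (9 , 19) , (20 , 22) ∷ (21 , 23) ∷ []) ∷
  ((1 , 2) , (10 , 12) , (2 , 22) , (1 , 11) , (10 , 12) , (1 , 20) ∷ (2 , 21) ∷ (20 , 1) ∷ (21 , 23) ∷ []) ∷
  ((1 , 2) , (10 , 18) , (20 , 21) , (1 , 2) , (10 , 18) , (20 , 22) ∷ (21 , 23) ∷ []) ∷
  ((1 , 2) , (11 , 13) , (1 , 22) , (2 , 12) , (11 , 13) , (1 , 20) ∷ (2 , 21) ∷ (20 , 2) ∷ (21 , 23) ∷ []) ∷
  ((1 , 2) , (11 , 19) , (1 , 22) , (2 , 12) , (11 , 19) , (1 , 20) ∷ (2 , 21) ∷ (20 , 2) ∷ (21 , 23) ∷ []) ∷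
  ((1 , 2) , (12 , 14) , (2 , 22) , (1 , 11) , (12 , 14) , (1 , 20) ∷ (2 , 21) ∷ (20 , 1) ∷ (21 , 23) ∷ []) ∷
  ((1 , 2) , (13 , 15) , (20 , 21) , (1 , 2) , (13 , 15) , (20 , 22) ∷ (21 , 23) ∷ []) ∷
  ((1 , 2) , (14 , 16) , (20 , 21) , (1 , 2) , (14 , 16) , (20 , 22) ∷ (21 , 23) ∷ []) ∷
  ((1 , 2) , (15 , 17) , (20 , 21) , (1 , 2) , (15 , 17) , (20 , 22) ∷ (21 , 23) ∷ []) ∷
  ((1 , 2) , (16 , 18) , (20 , 21) , (1 , 2) , (16 , 18) , (20 , 22) ∷ (21 , 23) ∷ []) ∷
  ((1 , 2) , (17 , 19) , (20 , 21) , (1 , 2) , (17 , 19) , (20 , 22) ∷ (21 , 23) ∷ []) ∷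
  ((2 , 21) , (0 , 9) , (20 , 21) , (0 , 9) , (2 , 3) , (20 , 23) ∷ (21 , 22) ∷ []) ∷
  ((2 , 21) , (0 , 10) , (20 , 21) , (0 , 10) , (2 , 3) , (20 , 23) ∷ (21 , 22) ∷ []) ∷
  ((2 , 21) , (3 , 4) , (3 , 23) , (0 , 1) , (3 , 13) , (3 , 22) ∷ []) ∷
  ((2 , 21) , (3 , 13) , (3 , 23) , (0 , 1) , (3 , 4) , (3 , 22) ∷ []) ∷
  ((2 , 21) , (4 , 5) , (3 , 4) , (0 , 1) , (3 , 13) , (3 , 22) ∷ (4 , 23) ∷ []) ∷
  ((2 , 21) , (4 , 14) , (3 , 4) , (0 , 1) , (3 , 13) , (3 , 22) ∷ (4 , 23) ∷ []) ∷
  ((2 , 21) , (4 , 14) , (12 , 14) , (1 , 11) , (10 , 12) , (1 , 20) ∷ (2 , 21) ∷ (12 , 22) ∷ (14 , 23) ∷ (20 , 1) ∷ (21 , 2) ∷ []) ∷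
  ((2 , 21) , (5 , 6) , (1 , 2) , (2 , 12) , (5 , 6) , (1 , 20) ∷ (2 , 21) ∷ (20 , 22) ∷ (21 , 23) ∷ []) ∷
  ((2 , 21) , (5 , 15) , (20 , 21) , (2 , 3) , (5 , 15) , (20 , 22) ∷ (21 , 23) ∷ []) ∷
  ((2 , 21) , (6 , 7) , (20 , 21) , (2 , 3) , (6 , 7) , (20 , 22) ∷ (21 , 23) ∷ []) ∷
  ((2 , 21) , (6 , 16) , (20 , 21) , (2 , 3) , (6 , 16) , (20 , 22) ∷ (21 , 23) ∷ []) ∷
  ((2 , 21) , (7 , 8) , (20 , 21) , (2 , 3) , (7 , 8) , (20 , 22) ∷ (21 , 23) ∷ []) ∷
  ((2 , 21) , (7 , 17) , (20 , 21) , (2 , 3) , (7 , 17) , (20 , 22) ∷ (21 , 23) ∷ []) ∷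
  ((2 , 21) , (8 , 9) , (20 , 21) , (2 , 3) , (8 , 9) , (20 , 22) ∷ (21 , 23) ∷ []) ∷
  ((2 , 21) , (8 , 18) , (20 , 21) , (2 , 3) , (8 , 18) , (20 , 22) ∷ (21 , 23) ∷ []) ∷
  ((2 , 21) , (9 , 19) , (20 , 21) , (2 , 3) , (9 , 19) , (20 , 22) ∷ (21 , 23) ∷ []) ∷
  ((2 , 21) , (10 , 12) , (2 , 22) , (1 , 11) , (12 , 14) , (1 , 20) ∷ (2 , 21) ∷ (12 , 23) ∷ (20 , 1) ∷ (21 , 12) ∷ []) ∷
  ((2 , 21) , (10 , 18) , (20 , 21) , (2 , 3) , (10 , 18) , (20 , 22) ∷ (21 , 23) ∷ []) ∷
  ((2 , 21) , (11 , 13) , (1 , 2) , (2 , 12) , (11 , 13) , (1 , 20) ∷ (2 , 21) ∷ (20 , 22) ∷ (21 , 23) ∷ []) ∷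
  ((2 , 21) , (11 , 19) , (20 , 21) , (2 , 3) , (11 , 19) , (20 , 22) ∷ (21 , 23) ∷ []) ∷
  ((2 , 21) , (12 , 14) , (2 , 22) , (1 , 11) , (10 , 12) , (1 , 20) ∷ (2 , 21) ∷ (12 , 23) ∷ (20 , 1) ∷ (21 , 12) ∷ []) ∷
  ((2 , 21) , (13 , 15) , (3 , 13) , (0 , 1) , (3 , 4) , (3 , 22) ∷ (13 , 23) ∷ []) ∷
  ((2 , 21) , (14 , 16) , (20 , 21) , (2 , 3) , (14 , 16) , (20 , 22) ∷ (21 , 23) ∷ []) ∷
  ((2 , 21) , (15 , 17) , (1 , 2) , (2 , 12) , (15 , 17) , (1 , 20) ∷ (2 , 21) ∷ (20 , 22) ∷ (21 , 23) ∷ []) ∷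
  ((2 , 21) , (16 , 18) , (20 , 21) , (2 , 3) , (16 , 18) , (20 , 22) ∷ (21 , 23) ∷ []) ∷
  ((2 , 21) , (17 , 19) , (20 , 21) , (2 , 3) , (17 , 19) , (20 , 22) ∷ (21 , 23) ∷ []) ∷
  ((20 , 21) , (0 , 9) , (20 , 22) , (0 , 9) , (2 , 3) , (20 , 23) ∷ []) ∷
  ((20 , 21) , (0 , 10) , (20 , 22) , (0 , 10) , (2 , 3) , (20 , 23) ∷ []) ∷
  ((20 , 21) , (3 , 4) , (21 , 22) , (0 , 1) , (3 , 4) , (21 , 23) ∷ []) ∷
  ((20 , 21) , (3 , 13) , (21 , 22) , (0 , 1) , (3 , 13) , (21 , 23) ∷ []) ∷
  ((20 , 21) , (4 , 5) , (21 , 22) , (0 , 1) , (4 , 5) , (21 , 23) ∷ []) ∷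
  ((20 , 21) , (4 , 14) , (21 , 22) , (0 , 1) , (4 , 14) , (21 , 23) ∷ []) ∷
  ((20 , 21) , (5 , 6) , (21 , 22) , (0 , 1) , (5 , 6) , (21 , 23) ∷ []) ∷
  ((20 , 21) , (5 , 15) , (21 , 22) , (0 , 1) , (5 , 15) , (21 , 23) ∷ []) ∷
  ((20 , 21) , (6 , 7) , (21 , 22) , (0 , 1) , (6 , 7) , (21 , 23) ∷ []) ∷
  ((20 , 21) , (6 , 16) , (21 , 22) , (0 , 1) , (6 , 16) , (21 , 23) ∷ []) ∷
  ((20 , 21) , (7 , 8) , (20 , 22) , (2 , 3) , (7 , 8) , (20 , 21) ∷ (21 , 23) ∷ []) ∷
  ((20 , 21) , (7 , 17) , (21 , 22) , (0 , 1) , (7 , 17) , (21 , 23) ∷ []) ∷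
  ((20 , 21) , (8 , 9) , (20 , 22) , (2 , 3) , (8 , 9) , (20 , 21) ∷ (21 , 23) ∷ []) ∷
  ((20 , 21) , (8 , 18) , (21 , 22) , (0 , 1) , (8 , 18) , (21 , 23) ∷ []) ∷
  ((20 , 21) , (9 , 19) , (20 , 22) , (2 , 3) , (9 , 19) , (20 , 21) ∷ (21 , 23) ∷ []) ∷
  ((20 , 21) , (10 , 12) , (2 , 21) , (1 , 11) , (12 , 14) , (1 , 20) ∷ (2 , 22) ∷ (12 , 23) ∷ (20 , 1) ∷ (21 , 12) ∷ []) ∷
  ((20 , 21) , (10 , 18) , (20 , 22) , (2 , 3) , (10 , 18) , (20 , 21) ∷ (21 , 23) ∷ []) ∷
  ((20 , 21) , (11 , 13) , (1 , 20) , (2 , 12) , (11 , 19) , (1 , 22) ∷ (2 , 21) ∷ (11 , 23) ∷ (20 , 2) ∷ (21 , 11) ∷ []) ∷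
  ((20 , 21) , (11 , 19) , (20 , 22) , (2 , 3) , (11 , 19) , (20 , 21) ∷ (21 , 23) ∷ []) ∷
  ((20 , 21) , (12 , 14) , (21 , 22) , (0 , 1) , (12 , 14) , (21 , 23) ∷ []) ∷
  ((20 , 21) , (13 , 15) , (21 , 22) , (0 , 1) , (13 , 15) , (21 , 23) ∷ []) ∷
  ((20 , 21) , (14 , 16) , (21 , 22) , (0 , 1) , (14 , 16) , (21 , 23) ∷ []) ∷
  ((20 , 21) , (15 , 17) , (21 , 22) , (0 , 1) , (15 , 17) , (21 , 23) ∷ []) ∷
  ((20 , 21) , (16 , 18) , (20 , 22) , (2 , 3) , (16 , 18) , (20 , 21) ∷ (21 , 23) ∷ []) ∷
  ((20 , 21) , (17 , 19) , (21 , 22) , (0 , 1) , (17 , 19) , (21 , 23) ∷ []) ∷ []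

_==_ : Pair → Pair → Bool
(a , b) == (c , d) = (a ≡ᵇ c) ∧ (b ≡ᵇ d)

direct : List ℕ → ℕ → ℕ → Bool
direct (a ∷ b ∷ []) u v = (a ≡ᵇ u) ∧ (b ≡ᵇ v)
direct _ _ _ = false

rowRoute : Row → ℕ → ℕ → List ℕ
rowRoute (q , g , w , e , f , ms) u v = bypass (addEar 22 q g zigzagEdges) (proj₁ w) (proj₂ w) (moves ms u) (moves ms v)

rowValid : Row → Bool
rowValid r@(q , g , w , e@(e₁ , e₂) , f@(f₁ , f₂) , ms) =
  rerouteᵇ 24 (addEar 22 q g zigzagEdges) 22 (plusEdges e f) (moves ms) (rowRoute r)
  ∧ every (λ v → toℕ (vertex v) ≡ᵇ v) (e₁ ∷ e₂ ∷ f₁ ∷ f₂ ∷ [])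
  ∧ ⌊ Free? (vertex e₁) (vertex e₂) (vertex f₁) (vertex f₂) ⌋

-- Fixing F takes more than fixed vertices: each edge of the face must survive as a one-edge route.
-- The last three tests are the conditions on a hop that involve F.
rowFixes : Fin 12 → Row → Bool
rowFixes k r@(q , g , w , e@(e₁ , e₂) , f@(f₁ , f₂) , ms) =
  every (λ i → moves ms (face k i) ≡ᵇ face k i) (allFin 5)
  ∧ every (λ (u , v) → not (onFace k u ∧ onFace k v) ∨ (memᵇ u v (plusEdges e f) ∧ direct (rowRoute r u v) u v)) dodecEdges
  ∧ not (onFace k e₁ ∧ onFace k e₂) ∧ not (onFace k f₁ ∧ onFace k f₂)
  ∧ not ((onFace k e₁ ∨ onFace k e₂) ∧ (onFace k f₁ ∨ onFace k f₂))

-- The clauses of `IsHop` that involve F, for the hop 01, 23 and F the boundary of face k.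
admissible : Fin 12 → Bool
admissible k = not (onFace k 0 ∧ onFace k 1) ∧ not (onFace k 2 ∧ onFace k 3)
  ∧ not ((onFace k 0 ∨ onFace k 1) ∧ (onFace k 2 ∨ onFace k 3))

opaque
  unfolding every some uniqueᵇ rerouteᵇ

  rows-valid : every rowValid rows ≡ true
  rows-valid = refl

-- Edges of the fixed face are exempt: their paths are single edges of `H`, so no ear can end inside
-- them.
covered : Fin 12 → Pair → Pair → Bool
covered k q@(a , b) g@(c , d) =
  not (admissible k) ∨ not (quad a ∧ quad b) ∨ quad c ∨ quad d ∨ (onFace k c ∧ onFace k d)
  ∨ some (λ r → (q == proj₁ r) ∧ (g == proj₁ (proj₂ r)) ∧ rowFixes k r) rows

opaque
  unfolding every some

  all-covered : every (λ k → every (λ q → every (covered k q) zigzagEdges) zigzagEdges) (allFin 12) ≡ true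
  all-covered = refl

==-sound : ∀ {p q} → (p == q) ≡ true → p ≡ q
==-sound {a , b} {c , d} e = cong₂ _,_ (≡ᵇ⇒≡′ a c (proj₁ (∧-true e))) (≡ᵇ⇒≡′ b d (proj₂ (∧-true {a ≡ᵇ c} e)))

direct-sound : ∀ r {u v} → direct r u v ≡ true → r ≡ u ∷ v ∷ []
direct-sound (a ∷ b ∷ []) e = cong₂ (λ x y → x ∷ y ∷ []) (≡ᵇ⇒≡′ a _ (proj₁ (∧-true e))) (≡ᵇ⇒≡′ b _ (proj₂ (∧-true {a ≡ᵇ _} e)))

-- A rotation swings the quadrangle along an ear from its edge ab to the boundary edge qt, so that it
-- absorbs the part of qt between q and the end of the ear: the edge w is deleted, ms are the renamed vertices.
rotation : ℕ → ℕ → ℕ → Pair × List Pair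
rotation a b q =
  if (a ≡ᵇ q) ∨ (b ≡ᵇ q) then ((q , 22) , (q , 23) ∷ [])
  -- Here `q` lies off ab, so in the quadrangle it is adjacent to exactly one end of ab, and the
  -- side between them is deleted.
  else if edgeᵇ zigzagEdges q a then ((q , a) , (q , 23) ∷ (a , 22) ∷ [])
  else ((q , b) , (q , 23) ∷ (b , 22) ∷ [])

rotationMap : ℕ → ℕ → ℕ → ℕ → ℕ
rotationMap a b q = moves (proj₂ (rotation a b q))

rotationRoute : ℕ → ℕ → ℕ → ℕ → ℕ → ℕ → List ℕ
rotationRoute a b q t u v = bypass (addEar 22 (a , b) (q , t) zigzagEdges)
  (proj₁ (proj₁ (rotation a b q))) (proj₂ (proj₁ (rotation a b q))) (rotationMap a b q u) (rotationMap a b q v)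

steps : List ℕ → Edges
steps (u ∷ v ∷ r) = (u , v) ∷ steps (v ∷ r)
steps _ = []

-- The legs from which a rotated leaving path may be made: an old leaving path, the part of qt
-- beyond the foot 23, or the part of ab from the foot 22 to an end, which lies in the old Q. This
-- matches the condition on `Fwd` in `CanRotate`.
residualStep : ℕ → ℕ → ℕ → Pair → Bool
residualStep a b t (s , s′) =
  (memᵇ s s′ zigzagEdges ∧ quad s ∧ not (quad s′)) ∨ ((s ≡ᵇ 23) ∧ (s′ ≡ᵇ t)) ∨ ((s ≡ᵇ 22) ∧ ((s′ ≡ᵇ a) ∨ (s′ ≡ᵇ b)))

-- The rotation suppresses `q`, and the piece of qt from `q` to the foot 23 becomes a leg of a side
-- of the new quadrangle.
through : ℕ → List ℕ → Bool
through q (x ∷ y ∷ z ∷ []) = ((x ≡ᵇ 23) ∧ (y ≡ᵇ q)) ∨ ((y ≡ᵇ q) ∧ (z ≡ᵇ 23))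
through q _ = false

rotationValid : Pair → Pair → Bool
rotationValid (a , b) (q , t) =
  rerouteᵇ 24 (addEar 22 (a , b) (q , t) zigzagEdges) 22 zigzagEdges (rotationMap a b q) route
  ∧ every (λ v → quad v ∨ (rotationMap a b q v ≡ᵇ v)) (upTo 22)
  ∧ every (λ (u , v) → quad u ∨ quad v ∨ direct (route u v) u v) zigzagEdges
  ∧ every (λ (u , v) → not (quad u) ∨ quad v ∨ every (residualStep a b t) (steps (route u v))) zigzagEdges
  ∧ some (λ (u , v) → quad u ∧ quad v ∧ through q (route u v)) zigzagEdges
  where
  route : ℕ → ℕ → List ℕ
  route = rotationRoute a b q t

private
  rotationOK : Pair → Pair → Bool
  rotationOK e@(a , b) g@(q , t) = not (quad a) ∨ not (quad b) ∨ not (quad q) ∨ quad t ∨ rotationValid e g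

opaque
  unfolding every some uniqueᵇ rerouteᵇ

  rotations-valid : every (λ e → every (rotationOK e) zigzagEdges) zigzagEdges ≡ true
  rotations-valid = refl

false-∨ : ∀ {a b} → a ≡ false → a ∨ b ≡ true → b ≡ true
false-∨ refl e = e

not-∨ : ∀ {a b} → a ≡ true → not a ∨ b ≡ true → b ≡ true
not-∨ refl e = e

rotation-valid : ∀ {a b q t} → (a , b) ∈ zigzagEdges → quad a ≡ true → quad b ≡ true →
  (q , t) ∈ zigzagEdges → quad q ≡ true → quad t ≡ false → rotationValid (a , b) (q , t) ≡ true
rotation-valid {a} {b} {q} {t} e sa sb g sq st =
  false-∨ st (not-∨ sq (not-∨ sb (not-∨ sa
    (every-sound (rotationOK (a , b)) (every-sound (λ e → every (rotationOK e) zigzagEdges) rotations-valid e) g))))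

opaque
  unfolding every some

  zigzag-bound : ∀ {u v} → (u , v) ∈ zigzagEdges → u < 22 × v < 22
  zigzag-bound {u} {v} p = <ᵇ-sound {u} (proj₁ (∧-true e)) , <ᵇ-sound {v} (proj₂ (∧-true {u <ᵇ 22} e))
    where
    e : (u <ᵇ 22) ∧ (v <ᵇ 22) ≡ true
    e = every-sound (λ (u , v) → (u <ᵇ 22) ∧ (v <ᵇ 22)) {zigzagEdges} refl p

  zigzag-outward : ∀ {u v} → (u , v) ∈ zigzagEdges → quad v ≡ true → quad u ≡ true
  zigzag-outward {u} {v} p s = not-∨ s (every-sound (λ (u , v) → not (quad v) ∨ quad u) {zigzagEdges} refl p)

  zigzag-oriented : ∀ {u v} → (u , v) ∈ zigzagEdges → (v , u) ∉ zigzagEdges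
  zigzag-oriented p q = not-true (every-sound (λ (u , v) → not (memᵇ v u zigzagEdges)) {zigzagEdges} refl p) (memᵇ-complete q)

  zigzag-loopless : ∀ {u v} → (u , v) ∈ zigzagEdges → u ≢ v
  zigzag-loopless {u} p refl = not-true (every-sound (λ (u , v) → not (u ≡ᵇ v)) {zigzagEdges} refl p) (≡ᵇ-refl u)

  dodec⇒zigzag : ∀ {u v} → (u , v) ∈ dodecEdges → quad u ≡ false → quad v ≡ false → (u , v) ∈ zigzagEdges
  dodec⇒zigzag p s t = memᵇ-sound zigzagEdges (false-∨ t (false-∨ s
    (every-sound (λ (u , v) → quad u ∨ quad v ∨ memᵇ u v zigzagEdges) {dodecEdges} refl p)))

  zigzag⇒dodec : ∀ {u v} → (u , v) ∈ zigzagEdges → quad u ≡ false → quad v ≡ false → (u , v) ∈ dodecEdges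
  zigzag⇒dodec p s t = memᵇ-sound dodecEdges (false-∨ t (false-∨ s
    (every-sound (λ (u , v) → quad u ∨ quad v ∨ memᵇ u v dodecEdges) {zigzagEdges} refl p)))

private
  neighbours : ℕ → Edges → List ℕ
  neighbours v [] = []
  neighbours v ((a , b) ∷ ES) =
    if v ≡ᵇ a then b ∷ neighbours v ES else if v ≡ᵇ b then a ∷ neighbours v ES else neighbours v ES

  branching : ℕ → List ℕ → Bool
  branching v (x ∷ y ∷ z ∷ _) = edgeᵇ zigzagEdges v x ∧ edgeᵇ zigzagEdges v y ∧ edgeᵇ zigzagEdges v z
    ∧ not (x ≡ᵇ y) ∧ not (x ≡ᵇ z) ∧ not (y ≡ᵇ z)
  branching v _ = false

  ≢-sound : ∀ {x y} → not (x ≡ᵇ y) ≡ true → x ≢ y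
  ≢-sound {x} e refl = not-true e (≡ᵇ-refl x)

  branching-sound : ∀ v l → branching v l ≡ true → ∃ λ u₁ → ∃₂ λ u₂ u₃ →
    Edge zigzagEdges v u₁ × Edge zigzagEdges v u₂ × Edge zigzagEdges v u₃ × u₁ ≢ u₂ × u₁ ≢ u₃ × u₂ ≢ u₃
  branching-sound v (x ∷ y ∷ z ∷ _) e with ∧-true {edgeᵇ zigzagEdges v x} e
  ... | e₁ , e with ∧-true {edgeᵇ zigzagEdges v y} e
  ... | e₂ , e with ∧-true {edgeᵇ zigzagEdges v z} e
  ... | e₃ , e with ∧-true {not (x ≡ᵇ y)} e
  ... | e₄ , e with ∧-true {not (x ≡ᵇ z)} e
  ... | e₅ , e₆ = x , y , z , edgeᵇ-sound _ e₁ , edgeᵇ-sound _ e₂ , edgeᵇ-sound _ e₃ , ≢-sound e₄ , ≢-sound e₅ , ≢-sound e₆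

opaque
  unfolding every some

  zigzag-branch : ∀ {v} → v < 22 → ∃ λ u₁ → ∃₂ λ u₂ u₃ →
    Edge zigzagEdges v u₁ × Edge zigzagEdges v u₂ × Edge zigzagEdges v u₃ × u₁ ≢ u₂ × u₁ ≢ u₃ × u₂ ≢ u₃
  zigzag-branch {v} l = branching-sound v (neighbours v zigzagEdges)
    (every-sound (λ v → branching v (neighbours v zigzagEdges)) {upTo 22} refl (∈-upTo⁺ l))

-- `c` runs around face k. The tables know F only through k, and this is the dictionary between the
-- two.
record Bounds (c : Fin 5 → Fin 20) (k : Fin 12) : Set where
  field
    on : ∀ i → onFace k (toℕ (c i)) ≡ true
    covers : ∀ {v} → onFace k (toℕ v) ≡ true → InVF c v
    chordless : ∀ {u v} → (u , v) ∈ dodecEdges → onFace k u ≡ true → onFace k v ≡ true →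
      ∃ λ i → (u ≡ toℕ (c i) × v ≡ toℕ (c (next5 i))) ⊎ (v ≡ toℕ (c i) × u ≡ toℕ (c (next5 i)))

opaque
  unfolding every some

  private
    avoids : ∀ k → every (λ v → not (admissible k) ∨ not (onFace k v) ∨ not (quad v)) (upTo 22) ≡ true
    avoids k = every-sound (λ k → every (λ v → not (admissible k) ∨ not (onFace k v) ∨ not (quad v)) (upTo 22)) {allFin 12} refl (∈-allFin k)

-- A face through 1 contains the edge 01 or the edge 12. The first may not lie in F, and the second
-- would give both hop edges an end in F; likewise at 2. So F is disjoint from Q.
admissible-avoids : ∀ {k v} → admissible k ≡ true → v < 22 → onFace k v ≡ true → quad v ≡ false
admissible-avoids {k} {v} ad l o = not-false (not-∨ o (not-∨ ad
  (every-sound (λ v → not (admissible k) ∨ not (onFace k v) ∨ not (quad v)) (avoids k) (∈-upTo⁺ l))))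
  where
  not-false : ∀ {b} → not b ≡ true → b ≡ false
  not-false {false} _ = refl

-- Rotations of an embedding of the zigzag graph in `H`

module Zigzag {n} (H : Graph n) (simple : IsSimple H) (cubic : IsCubic H) (conn : IsCyclicallyConnected 5 H)
    (c : Fin 5 → Fin 20) (cc : IsCircuit5 dodecahedron c) (k : Fin 12) (bounds : Bounds c k) (adm : admissible k ≡ true)
    (d : Fin 5 → Fin n) (dc : IsCircuit5 H d) where
  open Topological H (proj₁ simple)
  open Augmentation H simple cubic 22 zigzagEdges quad
  module B = Bounds bounds

  Fixing : ∀ {N ES} → Embedding N ES → Set
  Fixing ρ = ∀ i → vm (toℕ (c i)) ≡ d i × sg (toℕ (c i)) (toℕ (c (next5 i))) ≡ []
    where open Embedding ρ

  c<22 : ∀ i → toℕ (c i) < 22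
  c<22 i = ℕ.<-≤-trans (F.toℕ<n (c i)) (ℕ.m≤m+n 20 2)

  c-off : ∀ i → quad (toℕ (c i)) ≡ false
  c-off i = admissible-avoids {k} adm (c<22 i) (B.on i)

  c-dodec : ∀ i → Edge dodecEdges (toℕ (c i)) (toℕ (c (next5 i)))
  c-dodec i = dodec-adj _ _ (proj₂ cc i)

  c-zigzag : ∀ i → Edge zigzagEdges (toℕ (c i)) (toℕ (c (next5 i)))
  c-zigzag i = Sum.map (λ e → dodec⇒zigzag e (c-off i) (c-off (next5 i))) (λ e → dodec⇒zigzag e (c-off (next5 i)) (c-off i)) (c-dodec i)

  module _ (ρ : Embedding 22 zigzagEdges) {a b q t p u l₁ l₂ m₁ m₂} (X : EarAdded ρ a b q t p u l₁ l₂ m₁ m₂) where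
    private
      module ρ = Embedding ρ
      module X = EarAdded X
      module ρ₂ = Embedding X.embedding
      big = addEar 22 (a , b) (q , t) zigzagEdges

    module _ {ES φ route} (R : Reroute 24 big 22 ES φ route) where
      private
        ρ₃ = rerouted X.embedding R
        module ρ₃ = Embedding ρ₃

      rerouted-direct : ∀ {u v} → u < 22 → v < 22 → (u , v) ∈ ES → direct (route u v) u v ≡ true → ρ₃.sg u v ≡ ρ.sg u v
      rerouted-direct {u} {v} l m e dir = trans (rerouted-sg X.embedding R e)
        (trans (cong (trace X.embedding) (direct-sound (route u v) dir)) (X.sg-old l m))

      rerouted-empty : ∀ {u v} → u < 22 → v < 22 → (u , v) ∈ ES → direct (route u v) u v ≡ true →
        Edge zigzagEdges u v → ρ.sg u v ≡ [] → ρ₃.sg u v ≡ [] × ρ₃.sg v u ≡ []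
      rerouted-empty l m e dir z empty = r₁ , trans (ρ₃.rev (inj₁ e)) (cong reverse r₁)
        where r₁ = trans (rerouted-direct l m e dir) empty

      -- On the face every route is a single edge, so the new path is the old one, which `Fixing ρ`
      -- makes trivial. The circuit may traverse a listed edge in either direction.
      rerouted-fixing : Fixing ρ → (∀ i → φ (toℕ (c i)) ≡ toℕ (c i)) →
        (∀ {u v} → (u , v) ∈ dodecEdges → onFace k u ≡ true → onFace k v ≡ true → (u , v) ∈ ES × direct (route u v) u v ≡ true) →
        Fixing ρ₃
      rerouted-fixing fx φ-fix keeps i = trans (cong ρ₂.vm (φ-fix i)) (trans (X.vm-old (c<22 i)) (proj₁ (fx i))) , empty (c-dodec i)
        where
        i′ = next5 i
        empty : Edge dodecEdges (toℕ (c i)) (toℕ (c i′)) → ρ₃.sg (toℕ (c i)) (toℕ (c i′)) ≡ []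
        empty (inj₁ e) = let e′ , dir = keeps e (B.on i) (B.on i′) in
          proj₁ (rerouted-empty (c<22 i) (c<22 i′) e′ dir (c-zigzag i) (proj₂ (fx i)))
        empty (inj₂ e) = let e′ , dir = keeps e (B.on i′) (B.on i) in
          proj₂ (rerouted-empty (c<22 i′) (c<22 i) e′ dir (swap (c-zigzag i)) (trans (ρ.rev (c-zigzag i)) (cong reverse (proj₂ (fx i)))))

    -- A step of `H` along a composite path belongs to one leg of the route; this carries
    -- `residualStep`, which speaks of legs, to `Fwd`, which speaks of steps.
    consec-trace : ∀ {a b r x y} → Route big a b r → Consec (ρ₂.vm a ∷ trace X.embedding r ∷ʳ ρ₂.vm b) x y →
      ∃₂ λ s s′ → (s , s′) ∈ steps r × Edge big s s′ × Consec (ρ₂.path s s′) x y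
    consec-trace (one e) cs = _ , _ , here refl , e , cs
    consec-trace {a} {b} {r = u ∷ v ∷ w ∷ r} {x} {y} (e ∷ rt) cs
      with consec-++⁻ (ρ₂.vm u ∷ ρ₂.sg u v) (subst (λ l → Consec (ρ₂.vm u ∷ l) x y) (List.++-assoc (ρ₂.sg u v) (ρ₂.vm v ∷ trace X.embedding (v ∷ w ∷ r)) (ρ₂.vm b ∷ [])) cs)
    ... | inj₁ c₁ = _ , _ , here refl , e , c₁
    ... | inj₂ c₂ with consec-trace rt c₂
    ... | s , s′ , p , e′ , c′ = s , s′ , there p , e′ , c′

    module _ (ab : (a , b) ∈ zigzagEdges) (sa : quad a ≡ true) (sb : quad b ≡ true) (p∈ : p ∈ ρ.sg a b)
             (eq₁ : ρ.sg a b ≡ l₁ ++ p ∷ l₂)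
             (qt : (q , t) ∈ zigzagEdges) (sq : quad q ≡ true) (st : quad t ≡ false) (eq : ρ.sg q t ≡ m₁ ++ u ∷ m₂) where
      private
        φ = rotationMap a b q
        route = rotationRoute a b q t
        valid = rotation-valid ab sa sb qt sq st
        v₁ = ∧-true {rerouteᵇ 24 big 22 zigzagEdges φ route} valid
        R : Reroute 24 big 22 zigzagEdges φ route
        R = rerouteᵇ-sound (proj₁ v₁)
        v₂ = ∧-true {every (λ v → quad v ∨ (φ v ≡ᵇ v)) (upTo 22)} (proj₂ v₁)
        v₃ = ∧-true {every (λ (u , v) → quad u ∨ quad v ∨ direct (route u v) u v) zigzagEdges} (proj₂ v₂)
        v₄ = ∧-true {every (λ (u , v) → not (quad u) ∨ quad v ∨ every (residualStep a b t) (steps (route u v))) zigzagEdges} (proj₂ v₃)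

        φ-fix : ∀ {v} → v < 22 → quad v ≡ false → φ v ≡ v
        φ-fix {v} l s = ≡ᵇ⇒≡′ (φ v) v (false-∨ s (every-sound (λ v → quad v ∨ (φ v ≡ᵇ v)) (proj₁ v₂) (∈-upTo⁺ l)))

        direct-route : ∀ {u v} → (u , v) ∈ zigzagEdges → quad u ≡ false → quad v ≡ false → direct (route u v) u v ≡ true
        direct-route e s t = false-∨ t (false-∨ s (every-sound (λ (u , v) → quad u ∨ quad v ∨ direct (route u v) u v) (proj₁ v₃) e))

        residual : ∀ {u v} → (u , v) ∈ zigzagEdges → quad u ≡ true → quad v ≡ false → ∀ {s} → s ∈ steps (route u v) → residualStep a b t s ≡ true
        residual {u} {v} e s t₁ = every-sound (residualStep a b t) {steps (route u v)} (false-∨ t₁ (not-∨ s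
          (every-sound (λ (u , v) → not (quad u) ∨ quad v ∨ every (residualStep a b t) (steps (route u v))) (proj₁ v₄) e)))

      rotated : Embedding 22 zigzagEdges
      rotated = rerouted X.embedding R

      rotated-fixing : Fixing ρ → Fixing rotated
      rotated-fixing fx = rerouted-fixing R fx (λ i → φ-fix (c<22 i) (c-off i)) λ e o o′ →
        let off = off-face e o o′ ; e′ = dodec⇒zigzag e (proj₁ off) (proj₂ off) in
        e′ , direct-route e′ (proj₁ off) (proj₂ off)
        where
        off-face : ∀ {u v} → (u , v) ∈ dodecEdges → onFace k u ≡ true → onFace k v ≡ true → quad u ≡ false × quad v ≡ false
        off-face e o o′ with B.chordless e o o′
        ... | i , inj₁ (refl , refl) = c-off i , c-off (next5 i)
        ... | i , inj₂ (refl , refl) = c-off (next5 i) , c-off i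

      rotated-InR : ∀ {x} → InR ρ x → InR rotated x
      rotated-InR (inj₁ (w , l , s , e)) = inj₁ (w , l , s , trans e (sym (trans (cong ρ₂.vm (φ-fix l s)) (X.vm-old l))))
      rotated-InR {x} (inj₂ (u , v , e , s , t , x∈)) = inj₂ (u , v , e , s , t ,
        subst (x ∈_) (sym (rerouted-direct R (proj₁ (zigzag-bound e)) (proj₂ (zigzag-bound e)) e (direct-route e s t))) x∈)

      private
        not-false : ∀ {z} → not z ≡ true → z ≡ false
        not-false {false} _ = refl

        old-step : ∀ {s w x y} → (s , w) ∈ zigzagEdges → quad s ≡ true → quad w ≡ false → Consec (ρ₂.path s w) x y → Fwd ρ x y
        old-step {s} {w} {x} {y} e s′ t′ cs = s , w , e , s′ , t′ ,
          subst (λ l → Consec l x y) (trans (cong₂ (λ y z → y ∷ ρ₂.sg s w ∷ʳ z) (X.vm-old l) (X.vm-old m)) (cong (λ z → ρ.vm s ∷ z ∷ʳ ρ.vm w) (X.sg-old l m))) cs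
          where
          l = proj₁ (zigzag-bound e)
          m = proj₂ (zigzag-bound e)

        tail-step : ∀ {s w x y} → s ≡ 23 → w ≡ t → Consec (ρ₂.path s w) x y → Fwd ρ x y
        tail-step {x = x} {y} refl refl cs = q , t , qt , sq , st , subst (λ l → Consec l x y) (sym path≡)
          (consec-++⁺ʳ (ρ.vm q ∷ m₁) (subst (λ l → Consec l x y)
            (trans (cong₂ (λ y z → y ∷ ρ₂.sg 23 t ∷ʳ z) X.vm-1+N (X.vm-old (proj₂ (zigzag-bound qt)))) (cong (λ z → u ∷ z ∷ʳ ρ.vm t) X.sg-d)) cs))
          where
          path≡ : ρ.path q t ≡ (ρ.vm q ∷ m₁) ++ u ∷ (m₂ ∷ʳ ρ.vm t)
          path≡ = cong (ρ.vm q ∷_) (trans (cong (_∷ʳ ρ.vm t) eq) (List.++-assoc m₁ _ _))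

        left-step : ∀ {s w x y} → s ≡ 22 → w ≡ a → Edge big s w → Consec (ρ₂.path s w) x y → InQ ρ x
        left-step {x = x} refl refl e cs = inj₂ (a , b , ab , sa , sb , within (consec-fst (ρ₂.vm 22 ∷ ρ₂.sg 22 a) cs))
          where
          within : x ∈ ρ₂.vm 22 ∷ ρ₂.sg 22 a → x ∈ ρ.sg a b
          within (here refl) = subst (_∈ ρ.sg a b) (sym X.vm-N) p∈
          within (there x∈) = subst (x ∈_) (sym eq₁) (∈-++⁺ˡ (subst (x ∈_) X.sg-a (ρ₂.∈-flip e x∈)))

        right-step : ∀ {s w x y} → s ≡ 22 → w ≡ b → Consec (ρ₂.path s w) x y → InQ ρ x
        right-step {x = x} refl refl cs = inj₂ (a , b , ab , sa , sb , within (consec-fst (ρ₂.vm 22 ∷ ρ₂.sg 22 b) cs))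
          where
          within : x ∈ ρ₂.vm 22 ∷ ρ₂.sg 22 b → x ∈ ρ.sg a b
          within (here refl) = subst (_∈ ρ.sg a b) (sym X.vm-N) p∈
          within (there x∈) = subst (x ∈_) (sym eq₁) (∈-++⁺ʳ l₁ (there (subst (x ∈_) X.sg-b x∈)))

        residual-Fwd : ∀ s w → Edge big s w → residualStep a b t (s , w) ≡ true → ∀ {x y} → Consec (ρ₂.path s w) x y → Fwd ρ x y ⊎ InQ ρ x
        residual-Fwd s w e res cs = [ old , [ tail , near ]′ ∘ ∨-true {(s ≡ᵇ 23) ∧ (w ≡ᵇ t)} ]′ (∨-true {memᵇ s w zigzagEdges ∧ quad s ∧ not (quad w)} res)
          where
          old : memᵇ s w zigzagEdges ∧ quad s ∧ not (quad w) ≡ true → _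
          old h = inj₁ (old-step (memᵇ-sound zigzagEdges (proj₁ (∧-true h))) (proj₁ h₂) (not-false (proj₂ h₂)) cs)
            where
            h₂ = ∧-true {quad s} (proj₂ (∧-true {memᵇ s w zigzagEdges} h))
          tail : (s ≡ᵇ 23) ∧ (w ≡ᵇ t) ≡ true → _
          tail h = inj₁ (tail-step (≡ᵇ⇒≡′ s 23 (proj₁ (∧-true h))) (≡ᵇ⇒≡′ w t (proj₂ (∧-true {s ≡ᵇ 23} h))) cs)
          near : (s ≡ᵇ 22) ∧ ((w ≡ᵇ a) ∨ (w ≡ᵇ b)) ≡ true → _
          near h = inj₂ ([ (λ i → left-step s≡22 (≡ᵇ⇒≡′ w a i) e cs) , (λ i → right-step s≡22 (≡ᵇ⇒≡′ w b i) cs) ]′ (∨-true {w ≡ᵇ a} (proj₂ (∧-true {s ≡ᵇ 22} h))))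
            where
            s≡22 = ≡ᵇ⇒≡′ s 22 (proj₁ (∧-true h))

      rotated-Fwd : ∀ {x y} → Fwd rotated x y → Fwd ρ x y ⊎ InQ ρ x
      rotated-Fwd {x} {y} (u′ , v′ , e , s′ , t′ , cs) =
        let s , w , sw∈ , sw , cs′ = consec-trace (Reroute.routes R e) (subst (λ l → Consec (ρ₂.vm (φ u′) ∷ l ∷ʳ ρ₂.vm (φ v′)) x y) (rerouted-sg X.embedding R e) cs)
        in residual-Fwd s w sw (residual e s′ t′ sw∈) cs′

      private
        at-q : ρ₂.vm q ≡ ρ.vm q
        at-q = X.vm-old (proj₁ (zigzag-bound qt))

        before : ∀ {x y z w} → y ≡ 23 → z ≡ q → Edge big y z → x ∈ ρ.vm q ∷ m₁ → x ∈ ρ₂.sg y z ++ ρ₂.vm z ∷ ρ₂.sg z w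
        before refl refl yz (here refl) = ∈-++⁺ʳ (ρ₂.sg 23 q) (here (sym at-q))
        before {x} refl refl yz (there i) = ∈-++⁺ˡ (ρ₂.∈-flip (swap yz) (subst (x ∈_) (sym X.sg-c) i))

        after : ∀ {x y z w} → z ≡ q → w ≡ 23 → x ∈ ρ.vm q ∷ m₁ → x ∈ ρ₂.sg y z ++ ρ₂.vm z ∷ ρ₂.sg z w
        after {y = y} refl refl (here refl) = ∈-++⁺ʳ (ρ₂.sg y q) (here (sym at-q))
        after {x} {y} refl refl (there i) = ∈-++⁺ʳ (ρ₂.sg y q) (there (subst (x ∈_) (sym X.sg-c) i))

        on-route : ∀ {a b r x} → Route big a b r → through q r ≡ true → x ∈ ρ.vm q ∷ m₁ → x ∈ trace X.embedding r
        on-route {r = y ∷ z ∷ w ∷ []} (yz ∷ one zw) th x∈ =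
          [ (λ h → before (≡ᵇ⇒≡′ y 23 (proj₁ (∧-true h))) (≡ᵇ⇒≡′ z q (proj₂ (∧-true {y ≡ᵇ 23} h))) yz x∈)
          , (λ h → after (≡ᵇ⇒≡′ z q (proj₁ (∧-true h))) (≡ᵇ⇒≡′ w 23 (proj₂ (∧-true {z ≡ᵇ q} h))) x∈) ]′
          (∨-true {(y ≡ᵇ 23) ∧ (z ≡ᵇ q)} th)

      rotated-InQ : ∀ {x} → x ∈ ρ.vm q ∷ m₁ → InQ rotated x
      rotated-InQ {x} x∈ =
        let (u′ , v′) , e , h = some-sound (λ (u , v) → quad u ∧ quad v ∧ through q (route u v)) zigzagEdges (proj₂ v₄)
            su , h′ = ∧-true {quad u′} h
            sv , th = ∧-true {quad v′} h′
        in inj₂ (u′ , v′ , e , su , sv , subst (x ∈_) (sym (rerouted-sg X.embedding R e)) (on-route (Reroute.routes R e) th x∈))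

memRow : ∀ {r} → r ∈ rows → rowValid r ≡ true
memRow = every-sound rowValid rows-valid

private
  adjacent : Pair → Bool
  adjacent (u , v) = plus dodecahedron 0F 1F 2F 3F (unname u) (unname v)

opaque
  unfolding every some uniqueᵇ

  zigzag-adj : ∀ {u v} → (u , v) ∈ zigzagEdges → Adj (plus dodecahedron 0F 1F 2F 3F) (unname u) (unname v)
  zigzag-adj = every-sound adjacent {zigzagEdges} refl

  private
    ring : List ℕ
    ring = 1 ∷ 2 ∷ 21 ∷ 20 ∷ 1 ∷ []

    ring-route : Route zigzagEdges 1 1 (1 ∷ 2 ∷ 21 ∷ 20 ∷ 1 ∷ [])
    ring-route = routeᵇ-sound zigzagEdges 1 1 ring refl

    ring-quad : All (λ v → quad v ≡ true) (1 ∷ 2 ∷ 21 ∷ 20 ∷ 1 ∷ [])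
    ring-quad = refl ∷ refl ∷ refl ∷ refl ∷ refl ∷ []

    ring-unique : Unique (pt 1 ∷ interior (1 ∷ 2 ∷ 21 ∷ 20 ∷ 1 ∷ []))
    ring-unique = uniqueᵇ-sound (pt 1 ∷ interior ring) refl

    -- The leaving edges are 20 0, 1 11, 2 12 and 21 3, one too few for cyclic 5-connectivity.
    four : length (trues (λ (u , v) → quad u ∧ not (quad v)) zigzagEdges) ≤ 4
    four = s≤s (s≤s (s≤s (s≤s z≤n)))

module ZigzagHop {n} (H : Graph n) (simple : IsSimple H) (cubic : IsCubic H) (conn : IsCyclicallyConnected 5 H)
    (c : Fin 5 → Fin 20) (cc : IsCircuit5 dodecahedron c) (k : Fin 12) (bounds : Bounds c k) (adm : admissible k ≡ true)
    (d : Fin 5 → Fin n) (dc : IsCircuit5 H d)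
    (jump-free : ∀ a b a′ b′ → IsJump c a b a′ b′ → ¬ FContains H d (plus dodecahedron a b a′ b′) (oldV ∘ c)) where
  open Topological H (proj₁ simple)
  open Augmentation H simple cubic 22 zigzagEdges quad
  open Zigzag H simple cubic conn c cc k bounds adm d dc

  private
    not-both : ∀ {a b} → not (a ∧ b) ≡ true → a ≡ true → b ≡ true → ⊥
    not-both e refl refl = not-true e refl

    isJump : ∀ {e₁ e₂ f₁ f₂} → toℕ (vertex e₁) ≡ e₁ → toℕ (vertex e₂) ≡ e₂ → toℕ (vertex f₁) ≡ f₁ → toℕ (vertex f₂) ≡ f₂ →
      Free (vertex e₁) (vertex e₂) (vertex f₁) (vertex f₂) →
      not (onFace k e₁ ∧ onFace k e₂) ≡ true → not (onFace k f₁ ∧ onFace k f₂) ≡ true →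
      not ((onFace k e₁ ∨ onFace k e₂) ∧ (onFace k f₁ ∨ onFace k f₂)) ≡ true →
      IsJump c (vertex e₁) (vertex e₂) (vertex f₁) (vertex f₂)
    isJump {e₁} {e₂} {f₁} {f₂} q₁ q₂ q₃ q₄ (a₁ , a₂ , ne , nf , div) ee ff ef =
      (a₁ , a₂ , ne , no-edge q₁ q₂ ee , no-edge q₃ q₄ ff , (λ (h , h′) → not-both ef (has-end q₁ q₂ h) (has-end q₃ q₄ h′)) , nf) , div
      where
      on-face : ∀ {u} → toℕ (vertex u) ≡ u → ∀ {i} → vertex u ≡ c i → onFace k u ≡ true
      on-face q {i} e = trans (cong (onFace k) (trans (sym q) (cong toℕ e))) (B.on i)
      no-edge : ∀ {u v} → toℕ (vertex u) ≡ u → toℕ (vertex v) ≡ v → not (onFace k u ∧ onFace k v) ≡ true → ¬ InEF c (vertex u) (vertex v)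
      no-edge q q′ e (i , inj₁ (x , y)) = not-both e (on-face q x) (on-face q′ y)
      no-edge q q′ e (i , inj₂ (x , y)) = not-both e (on-face q x) (on-face q′ y)
      has-end : ∀ {u v} → toℕ (vertex u) ≡ u → toℕ (vertex v) ≡ v → HasEndIn c (vertex u) (vertex v) → onFace k u ∨ onFace k v ≡ true
      has-end q q′ (inj₁ (i , e)) rewrite on-face q e = refl
      has-end {u} q q′ (inj₂ (i , e)) rewrite on-face q′ e = Bool.∨-zeroʳ (onFace k u)

    -- The row turns the ear into an embedding of dodecahedron + (e, f) that fixes F, and its other
    -- tests make (e, f) a jump.
    row-contradiction : ∀ {a b g h w e₁ e₂ f₁ f₂ ms p q l₁ l₂ m₁ m₂} (ρ : Embedding 22 zigzagEdges) → Fixing ρ →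
      EarAdded ρ a b g h p q l₁ l₂ m₁ m₂ →
      rowValid ((a , b) , (g , h) , w , (e₁ , e₂) , (f₁ , f₂) , ms) ≡ true →
      rowFixes k ((a , b) , (g , h) , w , (e₁ , e₂) , (f₁ , f₂) , ms) ≡ true → ⊥
    row-contradiction {a} {b} {g} {h} {w} {e₁} {e₂} {f₁} {f₂} {ms} ρ fx X valid fixes =
      jump-free _ _ _ _ (isJump (named (here refl)) (named (there (here refl))) (named (there (there (here refl)))) (named (there (there (there (here refl)))))
          (toWitness (subst T (sym (proj₂ v₂)) _)) (proj₁ f₃) (proj₁ f₄) (proj₂ f₄))
        (toFContains (proj₁ simple) ρ₃ name name-bound name-inj (λ {u} {v} → edges {u} {v}) (λ i → proj₁ (fixed i)) (λ i → proj₂ (fixed i)))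
      where
      row : Row
      row = (a , b) , (g , h) , w , (e₁ , e₂) , (f₁ , f₂) , ms
      PE = plusEdges (e₁ , e₂) (f₁ , f₂)
      v₁ = ∧-true {rerouteᵇ 24 (addEar 22 (a , b) (g , h) zigzagEdges) 22 PE (moves ms) (rowRoute row)} valid
      v₂ = ∧-true {every (λ v → toℕ (vertex v) ≡ᵇ v) (e₁ ∷ e₂ ∷ f₁ ∷ f₂ ∷ [])} (proj₂ v₁)
      f₁′ = ∧-true {every (λ i → moves ms (face k i) ≡ᵇ face k i) (allFin 5)} fixes
      keep : Pair → Bool
      keep (u , v) = not (onFace k u ∧ onFace k v) ∨ (memᵇ u v PE ∧ direct (rowRoute row u v) u v)
      f₂′ = ∧-true {every keep dodecEdges} (proj₂ f₁′)
      f₃ = ∧-true {not (onFace k e₁ ∧ onFace k e₂)} (proj₂ f₂′)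
      f₄ = ∧-true {not (onFace k f₁ ∧ onFace k f₂)} (proj₂ f₃)
      named : ∀ {v} → v ∈ e₁ ∷ e₂ ∷ f₁ ∷ f₂ ∷ [] → toℕ (vertex v) ≡ v
      named {v} p = ≡ᵇ⇒≡′ (toℕ (vertex v)) v (every-sound (λ v → toℕ (vertex v) ≡ᵇ v) (proj₁ v₂) p)
      R : Reroute 24 (addEar 22 (a , b) (g , h) zigzagEdges) 22 PE (moves ms) (rowRoute row)
      R = rerouteᵇ-sound (proj₁ v₁)
      ρ₃ = rerouted (EarAdded.embedding X) R
      kept : ∀ {u v} → (u , v) ∈ dodecEdges → onFace k u ≡ true → onFace k v ≡ true → (u , v) ∈ PE × direct (rowRoute row u v) u v ≡ true
      kept {u} {v} e o o′ with ∨-true {not (onFace k u ∧ onFace k v)} (every-sound keep (proj₁ f₂′) e)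
      ... | inj₁ n = ⊥-elim (not-both n o o′)
      ... | inj₂ y = memᵇ-sound PE (proj₁ (∧-true y)) , proj₂ (∧-true {memᵇ u v PE} y)
      unmoved : ∀ {v} → onFace k v ≡ true → moves ms v ≡ v
      unmoved {v} o =
        let u , u∈ , e = some-sound (v ≡ᵇ_) (map (face k) (allFin 5)) o
            i , _ , u≡ = ∈-map⁻ (face k) {xs = allFin 5} u∈
        in subst (λ v → moves ms v ≡ v) (sym (trans (≡ᵇ⇒≡′ v u e) u≡))
             (≡ᵇ⇒≡′ _ _ (every-sound (λ i → moves ms (face k i) ≡ᵇ face k i) (proj₁ f₁′) (∈-allFin i)))
      fixed : Fixing ρ₃
      fixed = rerouted-fixing ρ X R fx (λ i → unmoved (B.on i)) kept
      edges : ∀ {u v} → Adj (plus dodecahedron (vertex e₁) (vertex e₂) (vertex f₁) (vertex f₂)) u v → Edge PE (name u) (name v)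
      edges {u} {v} adj = subst (λ es → Edge es (name u) (name v))
        (cong₂ plusEdges (cong₂ _,_ (named (here refl)) (named (there (here refl)))) (cong₂ _,_ (named (there (there (here refl)))) (named (there (there (there (here refl)))))))
        (plus-adj (vertex e₁) (vertex e₂) (vertex f₁) (vertex f₂) u v adj)

  ear-contradiction : NoEar Fixing
  ear-contradiction ρ fx {a} {b} {g} {h} ab sa sb p∈ gh sg′ sh q∈ chain uniq free
    with ∈-∃++ p∈ | ∈-∃++ q∈
  ... | l₁ , l₂ , eq₁ | m₁ , m₂ , eq₂
    with ∨-true {onFace k g ∧ onFace k h} (false-∨ sh (false-∨ sg′ (not-∨ (cong₂ _∧_ sa sb) (not-∨ adm
           (every-sound (covered k (a , b)) (every-sound (λ q → every (covered k q) zigzagEdges)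
             (every-sound (λ k → every (λ q → every (covered k q) zigzagEdges) zigzagEdges) all-covered (∈-allFin k)) ab) gh)))))
  ... | inj₂ found with some-sound _ rows found
  ... | (a′b′ , g′h′ , w , (e₁ , e₂) , (f₁ , f₂) , ms) , r∈ , ok with ∧-true {(a , b) == a′b′} ok
  ... | same₁ , ok′ with ∧-true {(g , h) == g′h′} ok′
  ... | same₂ , fixes with ==-sound {a , b} {a′b′} same₁ | ==-sound {g , h} {g′h′} same₂
  ... | refl | refl = row-contradiction {w = w} {e₁} {e₂} {f₁} {f₂} {ms} ρ fx
    (earAdded ρ ab gh (λ { refl → true≢false (trans (sym sa) sg′) }) eq₁ eq₂ chain uniq free) (memRow {(a , b) , (g , h) , w , (e₁ , e₂) , (f₁ , f₂) , ms} r∈) fixes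
  -- Here gh lies on the fixed face, so `fx` empties the interior of its path and leaves no place
  -- for the foot.
  ear-contradiction ρ fx {a} {b} {g} {h} ab sa sb p∈ gh sg′ sh q∈ chain uniq free
      | _ , _ , _ | _ , _ , _ | inj₁ both
    with B.chordless (zigzag⇒dodec gh sg′ sh) (proj₁ (∧-true both)) (proj₂ (∧-true {onFace k g} both))
  ... | i , inj₁ (refl , refl) with subst (_ ∈_) (proj₂ (fx i)) q∈
  ... | ()
  ear-contradiction ρ fx {a} {b} {g} {h} ab sa sb p∈ gh sg′ sh q∈ chain uniq free
      | _ , _ , _ | _ , _ , _ | inj₁ both
      | i , inj₂ (refl , refl) with subst (_ ∈_) (proj₂ (fx i)) (Embedding.∈-flip ρ (inj₁ gh) q∈)
  ... | ()

  private
    rotate : CanRotate Fixing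
    rotate ρ fx ab sa sb p∈ qt sq st eq chain uniq free with ∈-∃++ p∈
    ... | l₁ , l₂ , eq₁ = rotated ρ X ab sa sb p∈ eq₁ qt sq st eq , rotated-fixing ρ X ab sa sb p∈ eq₁ qt sq st eq fx ,
      rotated-InR ρ X ab sa sb p∈ eq₁ qt sq st eq , rotated-Fwd ρ X ab sa sb p∈ eq₁ qt sq st eq ,
      rotated-InQ ρ X ab sa sb p∈ eq₁ qt sq st eq
      where X = earAdded ρ ab qt (λ { refl → true≢false (trans (sym sb) st) }) eq₁ eq chain uniq free

  no-embedding : ∀ ρ → ¬ Fixing ρ
  no-embedding ρ fx = residual-walk ρ conn four ring-route (s≤s (s≤s (s≤s (s≤s z≤n)))) ring-quad ring-unique d dc
    (λ i → inj₁ (toℕ (c i) , c<22 i , c-off i , sym (proj₁ (fx i))))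
    λ w ws q wk u → no-walk zigzag-outward zigzag-branch Fixing ear-contradiction rotate (length ws) ρ fx ℕ.≤-refl q wk u

  no-hop : ¬ FContains H d (plus dodecahedron 0F 1F 2F 3F) (oldV ∘ c)
  no-hop (η , fv , fe) = no-embedding ρ λ i → trans (cong η.vmap (unname-name (oldV (c i)))) (fv i) , empty i (c-zigzag i)
    where
    module η = HomEmb η
    ρ = fromHomEmb (proj₁ simple) η unname zigzag-bound zigzag-loopless zigzag-oriented unname-inj zigzag-adj
    module ρ = Embedding ρ
    pmap≡ : ∀ i → η.pmap (unname (toℕ (c i))) (unname (toℕ (c (next5 i)))) ≡ d i ∷ d (next5 i) ∷ []
    pmap≡ i = trans (cong₂ η.pmap (unname-name (oldV (c i))) (unname-name (oldV (c (next5 i))))) (fe i)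
    fromHomEmb-empty : ∀ {u v x y} → (u , v) ∈ zigzagEdges → η.pmap (unname u) (unname v) ≡ x ∷ y ∷ [] → ρ.sg u v ≡ []
    fromHomEmb-empty = fromHomEmb-sg (proj₁ simple) η unname zigzag-bound zigzag-loopless zigzag-oriented unname-inj zigzag-adj
    empty : ∀ i → Edge zigzagEdges (toℕ (c i)) (toℕ (c (next5 i))) → ρ.sg (toℕ (c i)) (toℕ (c (next5 i))) ≡ []
    empty i (inj₁ e) = fromHomEmb-empty e (pmap≡ i)
    empty i (inj₂ e) = trans (ρ.sg-rev e) (cong reverse (fromHomEmb-empty e
      (trans (sym (List.reverse-involutive _)) (cong reverse (trans (sym (η.psym _ _ (zigzag-adj e))) (pmap≡ i))))))

-- Symmetries of the dodecahedron

-- Faces are given by a table, so their preservation is recorded separately. The inverse is carried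
-- along because hops are moved forward and jumps back.
record Symmetry : Set where
  field
    to from : Fin 20 → Fin 20
    to-from : ∀ v → to (from v) ≡ v
    from-to : ∀ v → from (to v) ≡ v
    adj-to : ∀ {u v} → Adj dodecahedron u v → Adj dodecahedron (to u) (to v)
    adj-from : ∀ {u v} → Adj dodecahedron u v → Adj dodecahedron (from u) (from v)
    face-to : ∀ k → ∃ λ k′ → ∀ {u v} → FaceIncident k u v → FaceIncident k′ (to u) (to v)
    face-from : ∀ k → ∃ λ k′ → ∀ {u v} → FaceIncident k u v → FaceIncident k′ (from u) (from v)

  to-inj : ∀ {u v} → to u ≡ to v → u ≡ v
  to-inj {u} {v} e = trans (sym (from-to u)) (trans (cong from e) (from-to v))

  adj-back : ∀ {u v} → Adj dodecahedron (to u) (to v) → Adj dodecahedron u v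
  adj-back {u} {v} a = subst₂ (Adj dodecahedron) (from-to u) (from-to v) (adj-from a)

idˢ : Symmetry
idˢ = record { to = λ v → v ; from = λ v → v ; to-from = λ _ → refl ; from-to = λ _ → refl ; adj-to = λ a → a ; adj-from = λ a → a
             ; face-to = λ k → k , λ f → f ; face-from = λ k → k , λ f → f }

_⁻¹ : Symmetry → Symmetry
g ⁻¹ = record { to = from ; from = to ; to-from = from-to ; from-to = to-from ; adj-to = adj-from ; adj-from = adj-to
              ; face-to = face-from ; face-from = face-to }
  where open Symmetry g

infixr 9 _∘ˢ_
_∘ˢ_ : Symmetry → Symmetry → Symmetry
g ∘ˢ h = record
  { to = g.to ∘ h.to ; from = h.from ∘ g.from
  ; to-from = λ v → trans (cong g.to (h.to-from (g.from v))) (g.to-from v)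
  ; from-to = λ v → trans (cong h.from (g.from-to (h.to v))) (h.from-to v)
  ; adj-to = g.adj-to ∘ h.adj-to ; adj-from = h.adj-from ∘ g.adj-from
  ; face-to = λ k → let k′ , f = h.face-to k ; k″ , f′ = g.face-to k′ in k″ , f′ ∘ f
  ; face-from = λ k → let k′ , f = g.face-from k ; k″ , f′ = h.face-from k′ in k″ , f′ ∘ f
  }
  where
  module g = Symmetry g
  module h = Symmetry h

private
  nth : List ℕ → ℕ → ℕ
  nth [] _ = 0
  nth (x ∷ xs) zero = x
  nth (x ∷ xs) (suc n) = nth xs n

  table : List ℕ → Fin 20 → Fin 20
  table l v = vertex (nth l (toℕ v))

  inverseᵇ : (f g : Fin 20 → Fin 20) → Bool
  inverseᵇ f g = every (λ v → eqb (f (g v)) v) (allFin 20)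

  homᵇ : (Fin 20 → Fin 20) → Fin 20 → Fin 20 → Bool
  homᵇ f u v = not (dodecahedron u v) ∨ dodecahedron (f u) (f v)

  corner : Fin 12 → Fin 5 → Fin 20
  corner k i = vertex (face k i)

  sideᵇ : (Fin 20 → Fin 20) → Fin 12 → Fin 12 → Fin 5 → Bool
  sideᵇ f k k′ i = ⌊ FaceIncident? k′ (f (corner k i)) (f (corner k (next5 i))) ⌋

  goodᵇ : (Fin 20 → Fin 20) → Bool
  goodᵇ f = every (λ u → every (homᵇ f u) (allFin 20)) (allFin 20)
    ∧ every (λ k → some (λ k′ → every (sideᵇ f k k′) (allFin 5)) (allFin 12)) (allFin 12)

  good-adj : ∀ f → goodᵇ f ≡ true → ∀ {u v} → Adj dodecahedron u v → Adj dodecahedron (f u) (f v)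
  good-adj f e {u} {v} a = not-∨ a (every-sound (homᵇ f u) (every-sound (λ u → every (homᵇ f u) (allFin 20)) (proj₁ (∧-true e)) (∈-allFin u)) (∈-allFin v))

  opaque
    unfolding every some

    corner-toℕ : ∀ k i → toℕ (corner k i) ≡ face k i
    corner-toℕ k i = ≡ᵇ⇒≡′ _ _ (every-sound (λ i → toℕ (corner k i) ≡ᵇ face k i)
      (every-sound (λ k → every (λ i → toℕ (corner k i) ≡ᵇ face k i) (allFin 5)) {allFin 12} refl (∈-allFin k)) (∈-allFin i))

  is-corner : ∀ {u k i} → toℕ u ≡ face k i → u ≡ corner k i
  is-corner {u} {k} {i} e = F.toℕ-injective (trans e (sym (corner-toℕ k i)))

  incident-flip : ∀ k {u v} → FaceIncident k u v → FaceIncident k v u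
  incident-flip k (i , p) = i , swap p

  good-face : ∀ f → goodᵇ f ≡ true → ∀ k → ∃ λ k′ → ∀ {u v} → FaceIncident k u v → FaceIncident k′ (f u) (f v)
  good-face f e k with some-sound (λ k′ → every (sideᵇ f k k′) (allFin 5)) (allFin 12)
    (every-sound (λ k → some (λ k′ → every (sideᵇ f k k′) (allFin 5)) (allFin 12)) (proj₂ (∧-true {every (λ u → every (homᵇ f u) (allFin 20)) (allFin 20)} e)) (∈-allFin k))
  ... | k′ , _ , sides = k′ , incident
    where
    side : ∀ i → FaceIncident k′ (f (corner k i)) (f (corner k (next5 i)))
    side i = toWitness (subst T (sym (every-sound (sideᵇ f k k′) sides (∈-allFin i))) _)
    incident : ∀ {u v} → FaceIncident k u v → FaceIncident k′ (f u) (f v)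
    incident (i , inj₁ (p , q)) rewrite is-corner {k = k} {i} p | is-corner {k = k} {next5 i} q = side i
    incident (i , inj₂ (p , q)) rewrite is-corner {k = k} {i} p | is-corner {k = k} {next5 i} q = incident-flip k′ (side i)

  symmetricᵇ : List ℕ → List ℕ → Bool
  symmetricᵇ l m = inverseᵇ (table l) (table m) ∧ inverseᵇ (table m) (table l) ∧ goodᵇ (table l) ∧ goodᵇ (table m)

  symmetry : ∀ l m → symmetricᵇ l m ≡ true → Symmetry
  symmetry l m e = record
    { to = table l ; from = table m
    ; to-from = λ v → eqb-true (every-sound _ (proj₁ e₁) (∈-allFin v))
    ; from-to = λ v → eqb-true (every-sound _ (proj₁ e₂) (∈-allFin v))
    ; adj-to = good-adj (table l) (proj₁ e₃) ; adj-from = good-adj (table m) (proj₂ e₃)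
    ; face-to = good-face (table l) (proj₁ e₃) ; face-from = good-face (table m) (proj₂ e₃)
    }
    where
    e₁ = ∧-true {inverseᵇ (table l) (table m)} e
    e₂ = ∧-true {inverseᵇ (table m) (table l)} (proj₂ e₁)
    e₃ = ∧-true {goodᵇ (table l)} (proj₂ e₂)

private
  -- `turn` is a rotary reflection of order ten that exchanges the opposite faces 10 and 11,
  -- `mirror` is a reflection that preserves each of them, and `tilt` carries face 10 to face 0.
  turnTable turnTable⁻¹ mirrorTable tiltTable tiltTable⁻¹ : List ℕ
  turnTable = 1 ∷ 2 ∷ 3 ∷ 4 ∷ 5 ∷ 6 ∷ 7 ∷ 8 ∷ 9 ∷ 0 ∷ 11 ∷ 12 ∷ 13 ∷ 14 ∷ 15 ∷ 16 ∷ 17 ∷ 18 ∷ 19 ∷ 10 ∷ []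
  turnTable⁻¹ = 9 ∷ 0 ∷ 1 ∷ 2 ∷ 3 ∷ 4 ∷ 5 ∷ 6 ∷ 7 ∷ 8 ∷ 19 ∷ 10 ∷ 11 ∷ 12 ∷ 13 ∷ 14 ∷ 15 ∷ 16 ∷ 17 ∷ 18 ∷ []
  mirrorTable = 0 ∷ 9 ∷ 8 ∷ 7 ∷ 6 ∷ 5 ∷ 4 ∷ 3 ∷ 2 ∷ 1 ∷ 10 ∷ 19 ∷ 18 ∷ 17 ∷ 16 ∷ 15 ∷ 14 ∷ 13 ∷ 12 ∷ 11 ∷ []
  tiltTable = 9 ∷ 19 ∷ 11 ∷ 13 ∷ 3 ∷ 4 ∷ 14 ∷ 16 ∷ 18 ∷ 8 ∷ 0 ∷ 17 ∷ 1 ∷ 15 ∷ 2 ∷ 5 ∷ 12 ∷ 6 ∷ 10 ∷ 7 ∷ []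
  tiltTable⁻¹ = 10 ∷ 12 ∷ 14 ∷ 4 ∷ 5 ∷ 15 ∷ 17 ∷ 19 ∷ 9 ∷ 0 ∷ 18 ∷ 2 ∷ 16 ∷ 3 ∷ 6 ∷ 13 ∷ 7 ∷ 11 ∷ 8 ∷ 1 ∷ []

  opaque
    unfolding every some

    turn-symmetric : symmetricᵇ turnTable turnTable⁻¹ ≡ true
    turn-symmetric = refl

    mirror-symmetric : symmetricᵇ mirrorTable mirrorTable ≡ true
    mirror-symmetric = refl

    tilt-symmetric : symmetricᵇ tiltTable tiltTable⁻¹ ≡ true
    tilt-symmetric = refl

turn mirror tilt : Symmetry
turn = symmetry turnTable turnTable⁻¹ turn-symmetric
mirror = symmetry mirrorTable mirrorTable mirror-symmetric
tilt = symmetry tiltTable tiltTable⁻¹ tilt-symmetric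

private
  turns : ℕ → Symmetry
  turns zero = idˢ
  turns (suc i) = turn ∘ˢ turns i

opaque
  -- all 120 of them: turn and mirror generate the stabiliser of an antipodal pair of faces
  symmetries : List Symmetry
  symmetries = cartesianProductWith _∘ˢ_
    (cartesianProductWith _∘ˢ_ (map turns (upTo 10)) (idˢ ∷ mirror ∷ []))
    -- One representative for each of the six pairs of opposite faces: the pair that it carries to
    -- the faces 10 and 11.
    (idˢ ∷ map (λ j → tilt ∘ˢ turns j) (upTo 5))

private
  zigzagᵇ : Fin 20 → Fin 20 → Fin 20 → Fin 20 → Symmetry → Bool
  zigzagᵇ x y z w g = (toℕ (to x) ≡ᵇ 0) ∧ (toℕ (to y) ≡ᵇ 1) ∧ (toℕ (to z) ≡ᵇ 2) ∧ (toℕ (to w) ≡ᵇ 3)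
    where open Symmetry g

  cofacial? : ∀ x y z w k → Dec (FaceIncident k x y × FaceIncident k z w)
  cofacial? x y z w k = FaceIncident? k x y ×-dec FaceIncident? k z w

  cofacialᵇ : Fin 20 → Fin 20 → Fin 20 → Fin 20 → Bool
  cofacialᵇ x y z w = some (λ k → ⌊ cofacial? x y z w k ⌋) (allFin 12)

  -- At y and at z a walk turns left or right. Equal turns keep the outer edges on one face,
  -- opposite turns give a zigzag, and the 120 symmetries are transitive on directed zigzags. A walk
  -- that doubles back has equal or cofacial outer edges.
  walkᵇ : Fin 20 → Fin 20 → Fin 20 → Fin 20 → Bool
  walkᵇ x y z w = not (dodecahedron x y) ∨ not (dodecahedron y z) ∨ not (dodecahedron z w) ∨
    sameb x y z w ∨ some (zigzagᵇ x y z w) symmetries ∨ cofacialᵇ x y z w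

  everywhere : (Fin 20 → Bool) → Bool
  everywhere p = every p (allFin 20)

  everywhere-sound : ∀ p → everywhere p ≡ true → ∀ v → p v ≡ true
  everywhere-sound p e v = every-sound p e (∈-allFin v)

opaque
  unfolding every some symmetries

  -- The guards recur at every level so that the inner loops are evaluated only behind actual walks.
  walks : everywhere (λ x → everywhere λ y → not (dodecahedron x y) ∨ everywhere λ z → not (dodecahedron y z) ∨ everywhere λ w → walkᵇ x y z w) ≡ true
  walks = refl

private
  sameb-sound : ∀ {x y z w : Fin 20} → sameb x y z w ≡ true → SameEdge x y z w
  sameb-sound {x} {y} {z} {w} e = Sum.map
    (λ e → eqb-true (proj₁ (∧-true e)) , eqb-true (proj₂ (∧-true {eqb x z} e)))
    (λ e → eqb-true (proj₁ (∧-true e)) , eqb-true (proj₂ (∧-true {eqb x w} e)))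
    (∨-true {eqb x z ∧ eqb y w} e)

  cofacial-sound : ∀ {x y z w} → cofacialᵇ x y z w ≡ true → ∃ λ k → FaceIncident k x y × FaceIncident k z w
  cofacial-sound {x} {y} {z} {w} e with some-sound (λ k → ⌊ cofacial? x y z w k ⌋) (allFin 12) e
  ... | k , _ , p = k , toWitness {a? = cofacial? x y z w k} (subst T (sym p) _)

  sharedᵇ : Fin 20 → Fin 20 → Fin 20 → Bool
  sharedᵇ x y w = not (dodecahedron x y) ∨ not (dodecahedron y w) ∨ sameb x y y w ∨ cofacialᵇ x y y w

  opaque
    unfolding every some

    shared : everywhere (λ x → everywhere λ y → everywhere (sharedᵇ x y)) ≡ true
    shared = refl

-- In a cubic plane graph any two of the three edges at a vertex bound a common face. So the two
-- edges of a hop never share an end.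
incident-edges-cofacial : ∀ {x y w} → Adj dodecahedron x y → Adj dodecahedron y w → ¬ SameEdge x y y w →
  ∃ λ k → FaceIncident k x y × FaceIncident k y w
incident-edges-cofacial {x} {y} {w} xy yw ne
  with ∨-true {sameb x y y w} (not-∨ yw (not-∨ xy (everywhere-sound (sharedᵇ x y)
         (everywhere-sound (λ y → everywhere (sharedᵇ x y)) (everywhere-sound _ shared x) y) w)))
... | inj₁ s = ⊥-elim (ne (sameb-sound s))
... | inj₂ f = cofacial-sound f

IsZigzag : Symmetry → Fin 20 → Fin 20 → Fin 20 → Fin 20 → Set
IsZigzag g x y z w = to x ≡ 0F × to y ≡ 1F × to z ≡ 2F × to w ≡ 3F
  where open Symmetry g

private
  zigzag-sound : ∀ {x y z w} g → zigzagᵇ x y z w g ≡ true → IsZigzag g x y z w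
  zigzag-sound {x} {y} {z} {w} g p = number {u = 0F} (proj₁ p₁) , number {u = 1F} (proj₁ p₂) , number {u = 2F} (proj₁ p₃) , number {u = 3F} (proj₂ p₃)
    where
    open Symmetry g
    p₁ = ∧-true {toℕ (to x) ≡ᵇ 0} p
    p₂ = ∧-true {toℕ (to y) ≡ᵇ 1} (proj₂ p₁)
    p₃ = ∧-true {toℕ (to z) ≡ᵇ 2} (proj₂ p₂)
    number : ∀ {v u : Fin 20} → (toℕ v ≡ᵇ toℕ u) ≡ true → v ≡ u
    number e = F.toℕ-injective (≡ᵇ⇒≡′ _ _ e)

  from-y : Fin 20 → Fin 20 → Bool
  from-y x y = everywhere λ z → not (dodecahedron y z) ∨ everywhere (walkᵇ x y z)

  from-x : Fin 20 → Bool
  from-x x = everywhere λ y → not (dodecahedron x y) ∨ from-y x y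

standardise : ∀ {x y z w} → Adj dodecahedron x y → Adj dodecahedron y z → Adj dodecahedron z w → ¬ SameEdge x y z w →
  (∀ k → ¬ (FaceIncident k x y × FaceIncident k z w)) → ∃ λ g → IsZigzag g x y z w
standardise {x} {y} {z} {w} xy yz zw ne nf =
  [ (λ s → ⊥-elim (ne (sameb-sound s)))
  , [ (λ s → let g , _ , p = some-sound (zigzagᵇ x y z w) symmetries s in g , zigzag-sound g p)
    , (λ f → let k , p = cofacial-sound {x} {y} {z} {w} f in ⊥-elim (nf k p)) ]′ ∘ ∨-true {some (zigzagᵇ x y z w) symmetries} ]′
  (∨-true {sameb x y z w} (not-∨ zw (not-∨ yz (not-∨ xy at-xyzw))))
  where
  at-xyzw : walkᵇ x y z w ≡ true
  at-xyzw = everywhere-sound (walkᵇ x y z) (not-∨ yz (everywhere-sound (λ z → not (dodecahedron y z) ∨ everywhere (walkᵇ x y z))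
    (not-∨ xy (everywhere-sound (λ y → not (dodecahedron x y) ∨ from-y x y)
      (everywhere-sound from-x walks x) y)) z)) w

-- Five-circuits of the dodecahedron are face boundaries

private
  boundsᵇ : Fin 12 → List (Fin 20) → List (Fin 20 × Fin 20) → Bool
  boundsᵇ k vs es = every (onFace k ∘ toℕ) vs
    ∧ everywhere (λ v → not (onFace k (toℕ v)) ∨ some (eqb v) vs)
    ∧ every (λ (u , v) → not (onFace k u ∧ onFace k v) ∨ some (λ (x , y) → sameᵇ u v (toℕ x) (toℕ y)) es) dodecEdges

  step : Fin 20 → (Fin 20 → Bool) → Bool
  step u p = everywhere λ v → not (dodecahedron u v) ∨ p v

  step-sound : ∀ u v p → step u p ≡ true → Adj dodecahedron u v → p v ≡ true
  step-sound u v p e a = not-∨ a (everywhere-sound (λ v → not (dodecahedron u v) ∨ p v) e v)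

  sides : (Fin 5 → Fin 20) → List (Fin 20 × Fin 20)
  sides c = map (λ i → c i , c (next5 i)) (allFin 5)

  pentagon : Fin 20 → Fin 20 → Fin 20 → Fin 20 → Fin 20 → Fin 5 → Fin 20
  pentagon p q r s t 0F = p
  pentagon p q r s t 1F = q
  pentagon p q r s t 2F = r
  pentagon p q r s t 3F = s
  pentagon p q r s t 4F = t

  boundsᵇ′ : (Fin 5 → Fin 20) → Fin 12 → Bool
  boundsᵇ′ c k = boundsᵇ k (map c (allFin 5)) (sides c)

  -- Closed walks of length five are enumerated vertex by vertex, pruned by adjacency; girth five
  -- makes each of them a circuit.
  from₅ : (p q r s t : Fin 20) → Bool
  from₅ p q r s t = not (dodecahedron t p) ∨ some (boundsᵇ′ (pentagon p q r s t)) (allFin 12)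

  from₄ : (p q r s : Fin 20) → Bool
  from₄ p q r s = step s (from₅ p q r s)

  from₃ : (p q r : Fin 20) → Bool
  from₃ p q r = step r (from₄ p q r)

  from₂ : (p q : Fin 20) → Bool
  from₂ p q = step q (from₃ p q)

  from₁ : Fin 20 → Bool
  from₁ p = step p (from₂ p)

  opaque
    unfolding every some

    pentagons : everywhere from₁ ≡ true
    pentagons = refl

  bounds-sound : ∀ c k → boundsᵇ′ c k ≡ true → Bounds c k
  bounds-sound c k e = record
    { on = λ i → every-sound (onFace k ∘ toℕ) (proj₁ e₁) (∈-map⁺ c (∈-allFin i))
    ; covers = λ {v} o → covered-by v (not-∨ o (everywhere-sound (λ v → not (onFace k (toℕ v)) ∨ some (eqb v) vs) (proj₁ e₂) v))
    ; chordless = λ {u} {v} uv o o′ → side u v (not-∨ (cong₂ _∧_ o o′) (every-sound chordᵇ (proj₂ e₂) uv))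
    }
    where
    vs = map c (allFin 5)
    onSide : ℕ → ℕ → Fin 20 × Fin 20 → Bool
    onSide u v (x , y) = sameᵇ u v (toℕ x) (toℕ y)
    chordᵇ : Pair → Bool
    chordᵇ (u , v) = not (onFace k u ∧ onFace k v) ∨ some (onSide u v) (sides c)
    e₁ = ∧-true {every (onFace k ∘ toℕ) vs} e
    e₂ = ∧-true {everywhere (λ v → not (onFace k (toℕ v)) ∨ some (eqb v) vs)} (proj₂ e₁)
    covered-by : ∀ v → some (eqb v) vs ≡ true → InVF c v
    covered-by v e = let x , x∈ , same = some-sound (eqb v) vs e ; i , _ , x≡ = ∈-map⁻ c {xs = allFin 5} x∈ in
      i , trans (eqb-true same) x≡
    side : ∀ u v → some (onSide u v) (sides c) ≡ true →
      ∃ λ i → (u ≡ toℕ (c i) × v ≡ toℕ (c (next5 i))) ⊎ (v ≡ toℕ (c i) × u ≡ toℕ (c (next5 i)))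
    side u v e with some-sound (onSide u v) (sides c) e
    ... | xy , xy∈ , same with ∈-map⁻ (λ i → c i , c (next5 i)) {xs = allFin 5} xy∈
    ... | i , _ , refl = i , Sum.map
      (λ h → ≡ᵇ⇒≡′ u _ (proj₁ (∧-true h)) , ≡ᵇ⇒≡′ v _ (proj₂ (∧-true {u ≡ᵇ toℕ (c i)} h)))
      (λ h → ≡ᵇ⇒≡′ v _ (proj₂ (∧-true {u ≡ᵇ toℕ (c (next5 i))} h)) , ≡ᵇ⇒≡′ u _ (proj₁ (∧-true h)))
      (∨-true {(u ≡ᵇ toℕ (c i)) ∧ (v ≡ᵇ toℕ (c (next5 i)))} same)

circuit-bounds : ∀ c → IsCircuit5 dodecahedron c → ∃ λ k → Bounds c k
-- `c` and its `pentagon` agree definitionally at each of the five arguments, so the test found for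
-- the one is a test for the other.
circuit-bounds c (_ , adj) = let k , _ , e = some-sound (boundsᵇ′ (pentagon p q r s t)) (allFin 12) found in k , bounds-sound c k e
  where
  p = c 0F
  q = c 1F
  r = c 2F
  s = c 3F
  t = c 4F
  found : some (boundsᵇ′ (pentagon p q r s t)) (allFin 12) ≡ true
  found = not-∨ {dodecahedron t p} (adj 4F) (step-sound s t (from₅ p q r s) (step-sound r s (from₄ p q r) (step-sound q r (from₃ p q) (step-sound p q (from₂ p)
    (everywhere-sound from₁ pentagons p) (adj 0F)) (adj 1F)) (adj 2F)) (adj 3F))

-- Transport of containments and jumps along symmetries

private
  lift : (Fin 20 → Fin 20) → Fin 22 → Fin 22
  lift f 0F = 0F
  lift f 1F = 1F
  lift f (F.suc (F.suc v)) = oldV (f v)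

  eqb-refl : ∀ (u : Fin 20) → eqb u u ≡ true
  eqb-refl u with u F.≟ u
  ... | yes _ = refl
  ... | no ne = ⊥-elim (ne refl)

module _ (g : Symmetry) where
  open Symmetry g

  private
    eqb-to : ∀ u v → eqb (to u) (to v) ≡ eqb u v
    eqb-to u v with u F.≟ v
    ... | yes refl = eqb-refl (to u)
    ... | no ne with to u F.≟ to v
    ... | yes e = ⊥-elim (ne (to-inj e))
    ... | no _ = refl

    sameb-to : ∀ u v a b → sameb (to u) (to v) (to a) (to b) ≡ sameb u v a b
    sameb-to u v a b rewrite eqb-to u a | eqb-to v b | eqb-to u b | eqb-to v a = refl

    lift-inj : ∀ {u v} → lift to u ≡ lift to v → u ≡ v
    lift-inj {0F} {0F} e = refl
    lift-inj {1F} {1F} e = refl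
    lift-inj {0F} {1F} ()
    lift-inj {0F} {F.suc (F.suc v)} ()
    lift-inj {1F} {0F} ()
    lift-inj {1F} {F.suc (F.suc v)} ()
    lift-inj {F.suc (F.suc u)} {0F} ()
    lift-inj {F.suc (F.suc u)} {1F} ()
    lift-inj {F.suc (F.suc u)} {F.suc (F.suc v)} e = cong oldV (to-inj (F.suc-injective (F.suc-injective e)))

    lift-adj : ∀ {a b a′ b′} u v → Adj (plus dodecahedron a b a′ b′) u v →
      Adj (plus dodecahedron (to a) (to b) (to a′) (to b′)) (lift to u) (lift to v)
    lift-adj 0F 1F e = refl
    lift-adj 1F 0F e = refl
    lift-adj {a} {b} 0F (F.suc (F.suc v)) e rewrite eqb-to v a | eqb-to v b = e
    lift-adj {a′ = a′} {b′} 1F (F.suc (F.suc v)) e rewrite eqb-to v a′ | eqb-to v b′ = e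
    lift-adj {a} {b} (F.suc (F.suc u)) 0F e rewrite eqb-to u a | eqb-to u b = e
    lift-adj {a′ = a′} {b′} (F.suc (F.suc u)) 1F e rewrite eqb-to u a′ | eqb-to u b′ = e
    lift-adj {a} {b} {a′} {b′} (F.suc (F.suc u)) (F.suc (F.suc v)) e
      rewrite sameb-to u v a b | sameb-to u v a′ b′ =
      cong₂ _∧_ (adj-to (proj₁ (∧-true e))) (proj₂ (∧-true {dodecahedron u v} e))

  FContains-pull : ∀ {n} {H : Graph n} {d c c′ a b a′ b′} → (∀ i → to (c i) ≡ c′ i) →
    FContains H d (plus dodecahedron (to a) (to b) (to a′) (to b′)) (oldV ∘ c′) →
    FContains H d (plus dodecahedron a b a′ b′) (oldV ∘ c)
  FContains-pull eq = FContains-relabel (lift to) lift-inj (λ {u} {v} → lift-adj u v) (λ i → cong oldV (eq i))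

  IsJump-push : ∀ {c c′ a b a′ b′} → (∀ i → to (c i) ≡ c′ i) → IsJump c a b a′ b′ → IsJump c′ (to a) (to b) (to a′) (to b′)
  IsJump-push {c} {c′} eq ((ab , a′b′ , ne , e₁ , e₂ , ends , faces) , (n₁ , n₂ , n₃ , n₄ , n₅ , n₆ , m₁ , m₂ , m₃ , m₄)) =
    (adj-to ab , adj-to a′b′ , ne ∘ same , e₁ ∘ edge , e₂ ∘ edge , (λ (h , h′) → ends (end h , end h′)) , no-face) ,
    (n₁ ∘ to-inj , n₂ ∘ to-inj , n₃ ∘ to-inj , n₄ ∘ to-inj , n₅ ∘ to-inj , n₆ ∘ to-inj ,
     m₁ ∘ adj-back , m₂ ∘ adj-back , m₃ ∘ adj-back , m₄ ∘ adj-back)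
    where
    same : ∀ {x y z w} → SameEdge (to x) (to y) (to z) (to w) → SameEdge x y z w
    same = Sum.map (λ (p , q) → to-inj p , to-inj q) (λ (p , q) → to-inj p , to-inj q)
    pull : ∀ {x i} → to x ≡ c′ i → x ≡ c i
    pull {x} {i} e = to-inj (trans e (sym (eq i)))
    edge : ∀ {x y} → InEF c′ (to x) (to y) → InEF c x y
    edge (i , s) = i , Sum.map (λ (p , q) → pull p , pull q) (λ (p , q) → pull p , pull q) s
    end : ∀ {x y} → HasEndIn c′ (to x) (to y) → HasEndIn c x y
    end = Sum.map (λ (i , p) → i , pull p) (λ (i , p) → i , pull p)
    no-face : ∀ k → ¬ (FaceIncident k _ _ × FaceIncident k _ _)
    no-face k (p , q) = let k′ , f = face-from k in faces k′ (back k′ f p , back k′ f q)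
      where
      back : ∀ k′ {x y} → (∀ {u v} → FaceIncident k u v → FaceIncident k′ (from u) (from v)) → FaceIncident k (to x) (to y) → FaceIncident k′ x y
      back k′ {x} {y} f p = subst₂ (FaceIncident k′) (from-to x) (from-to y) (f p)

-- Reduction of arbitrary hops to zigzags

private
  dodec-sym : ∀ {u v} → Adj dodecahedron u v → Adj dodecahedron v u
  dodec-sym {u} {v} a = trans (Bool.∨-comm (dirAdjℕ (toℕ v) (toℕ u)) (dirAdjℕ (toℕ u) (toℕ v))) a

  dodec-irrefl : ∀ {u} → ¬ Adj dodecahedron u u
  dodec-irrefl {u} a = loop (dodec-adj u u a)
    where
    opaque
      unfolding every

      loopless : ∀ {v} → (v , v) ∉ dodecEdges
      loopless {v} p = not-true (every-sound (λ (u , v) → not (u ≡ᵇ v)) {dodecEdges} refl p) (≡ᵇ-refl v)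

    loop : ∀ {v} → ¬ Edge dodecEdges v v
    loop (inj₁ e) = loopless e
    loop (inj₂ e) = loopless e

  sameb-comm : ∀ (u v a b : Fin 20) → sameb u v b a ≡ sameb u v a b
  sameb-comm u v a b = Bool.∨-comm (eqb u b ∧ eqb v a) (eqb u a ∧ eqb v b)

  plus-flip : ∀ {a b a′ b′} u v → Adj (plus dodecahedron b a a′ b′) u v → Adj (plus dodecahedron a b a′ b′) u v
  plus-flip 0F 1F e = e
  plus-flip {a} {b} 0F (F.suc (F.suc v)) e = trans (Bool.∨-comm (eqb v a) (eqb v b)) e
  plus-flip 1F 0F e = e
  plus-flip 1F (F.suc (F.suc v)) e = e
  plus-flip {a} {b} (F.suc (F.suc u)) 0F e = trans (Bool.∨-comm (eqb u a) (eqb u b)) e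
  plus-flip (F.suc (F.suc u)) 1F e = e
  plus-flip {a} {b} (F.suc (F.suc u)) (F.suc (F.suc v)) e rewrite sameb-comm u v a b = e

  exchange : Fin 22 → Fin 22
  exchange 0F = 1F
  exchange 1F = 0F
  exchange (F.suc (F.suc v)) = F.suc (F.suc v)

  exchange-involutive : ∀ u → exchange (exchange u) ≡ u
  exchange-involutive 0F = refl
  exchange-involutive 1F = refl
  exchange-involutive (F.suc (F.suc u)) = refl

  exchange-inj : ∀ {u v} → exchange u ≡ exchange v → u ≡ v
  exchange-inj {u} {v} e = trans (sym (exchange-involutive u)) (trans (cong exchange e) (exchange-involutive v))

  plus-swap : ∀ {a b a′ b′} u v → Adj (plus dodecahedron a′ b′ a b) u v → Adj (plus dodecahedron a b a′ b′) (exchange u) (exchange v)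
  plus-swap 0F 1F e = e
  plus-swap 0F (F.suc (F.suc v)) e = e
  plus-swap 1F 0F e = e
  plus-swap 1F (F.suc (F.suc v)) e = e
  plus-swap (F.suc (F.suc u)) 0F e = e
  plus-swap (F.suc (F.suc u)) 1F e = e
  plus-swap {a} {b} {a′} {b′} (F.suc (F.suc u)) (F.suc (F.suc v)) e =
    trans (cong (dodecahedron u v ∧_) (Bool.∧-comm (not (sameb u v a b)) (not (sameb u v a′ b′)))) e

  same-flip : ∀ {n} {a b a′ b′ : Fin n} → SameEdge b a a′ b′ → SameEdge a b a′ b′
  same-flip (inj₁ (p , q)) = inj₂ (q , p)
  same-flip (inj₂ (p , q)) = inj₁ (q , p)

  same-sym : ∀ {n} {a b a′ b′ : Fin n} → SameEdge a′ b′ a b → SameEdge a b a′ b′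
  same-sym (inj₁ (p , q)) = inj₁ (sym p , sym q)
  same-sym (inj₂ (p , q)) = inj₂ (sym q , sym p)

  plus-cong : ∀ {n} {H : Graph n} {d cG x y z w x′ y′ z′ w′} → x ≡ x′ → y ≡ y′ → z ≡ z′ → w ≡ w′ →
    FContains H d (plus dodecahedron x y z w) cG → FContains H d (plus dodecahedron x′ y′ z′ w′) cG
  plus-cong refl refl refl refl e = e

  not-both : ∀ {a b} → (a ≡ true → b ≡ true → ⊥) → not (a ∧ b) ≡ true
  not-both {true} {true} k = ⊥-elim (k refl refl)
  not-both {true} {false} k = refl
  not-both {false} k = refl

module _ (c : Fin 5 → Fin 20) (cc : IsCircuit5 dodecahedron c)
    {n} (H : Graph n) (simple : IsSimple H) (cubic : IsCubic H) (conn : IsCyclicallyConnected 5 H)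
    (d : Fin 5 → Fin n) (dc : IsCircuit5 H d)
    (jump-free : ∀ a b a′ b′ → IsJump c a b a′ b′ → ¬ FContains H d (plus dodecahedron a b a′ b′) (oldV ∘ c)) where
  private
    HopIn : Fin 20 → Fin 20 → Fin 20 → Fin 20 → Set
    HopIn x y z w = IsHop c x y z w × FContains H d (plus dodecahedron x y z w) (oldV ∘ c)

    flip : ∀ {x y z w} → HopIn x y z w → HopIn y x z w
    flip {x} {y} ((xy , zw , ne , e₁ , e₂ , ends , faces) , emb) =
      (dodec-sym {x} {y} xy , zw , ne ∘ same-flip , (λ (i , s) → e₁ (i , same-flip s)) , e₂ , (λ (h , h′) → ends (swap h , h′)) ,
        λ k (p , q) → faces k (incident-flip k p , q)) ,
      FContains-relabel (λ v → v) (λ e → e) (λ {u} {v} → plus-flip u v) (λ _ → refl) emb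

    exchanged : ∀ {x y z w} → HopIn x y z w → HopIn z w x y
    exchanged ((xy , zw , ne , e₁ , e₂ , ends , faces) , emb) =
      (zw , xy , ne ∘ same-sym , e₂ , e₁ , (λ (h , h′) → ends (h′ , h)) , λ k (p , q) → faces k (q , p)) ,
      FContains-relabel exchange exchange-inj (λ {u} {v} → plus-swap u v) (λ _ → refl) emb

    flip₂ : ∀ {x y z w} → HopIn x y z w → HopIn x y w z
    flip₂ {x} {y} {z} {w} h = exchanged {w} {z} {x} {y} (flip {z} {w} {x} {y} (exchanged {x} {y} {z} {w} h))

    no-shared-end : ∀ {x y z w} → HopIn x y z w → y ≢ z
    no-shared-end {x} {y} {z} {w} ((xy , zw , ne , _ , _ , _ , faces) , _) refl =
      let k , p = incident-edges-cofacial {x} {y} {w} xy zw ne in faces k p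

    module _ (g : Symmetry) (k : Fin 12) (bounds : Bounds (Symmetry.to g ∘ c) k) where
      open Symmetry g
      private
        c′ : Fin 5 → Fin 20
        c′ = to ∘ c

        cc′ : IsCircuit5 dodecahedron c′
        cc′ = (λ i j e → proj₁ cc i j (to-inj e)) , adj-to ∘ proj₂ cc

        module B = Bounds bounds

        back : ∀ {u v} → to u ≡ v → u ≡ from v
        back {u} e = trans (sym (from-to u)) (cong from e)

        pull : ∀ {u v} i → to u ≡ v → toℕ v ≡ toℕ (c′ i) → u ≡ c i
        pull i e q = to-inj (trans e (F.toℕ-injective q))

        end : ∀ {u v} → to u ≡ v → onFace k (toℕ v) ≡ true → InVF c u
        end e o = let i , q = B.covers o in i , to-inj (trans e q)

        side : ∀ {u v u′ v′} → to u ≡ u′ → to v ≡ v′ → (toℕ u′ , toℕ v′) ∈ dodecEdges →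
          onFace k (toℕ u′) ≡ true → onFace k (toℕ v′) ≡ true → InEF c u v
        side p q e o o′ with B.chordless e o o′
        ... | i , inj₁ (r , s) = i , inj₁ (pull i p r , pull (next5 i) q s)
        ... | i , inj₂ (r , s) = i , inj₂ (pull (next5 i) p s , pull i q r)

        some-end : ∀ {u v u′ v′} → to u ≡ u′ → to v ≡ v′ → onFace k (toℕ u′) ∨ onFace k (toℕ v′) ≡ true → HasEndIn c u v
        some-end {u′ = u′} p q o = Sum.map (end p) (end q) (∨-true {onFace k (toℕ u′)} o)

        zigzag-admissible : ∀ {x y z w} → IsHop c x y z w → IsZigzag g x y z w → admissible k ≡ true
        zigzag-admissible (_ , _ , _ , e₁ , e₂ , ends , _) (x↦0 , y↦1 , z↦2 , w↦3) =
          cong₂ _∧_ (not-both {onFace k 0} {onFace k 1} (λ o o′ → e₁ (side x↦0 y↦1 (here refl) o o′)))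
            (cong₂ _∧_ (not-both {onFace k 2} {onFace k 3} (λ o o′ → e₂ (side z↦2 w↦3 (there (there (here refl))) o o′)))
              (not-both {onFace k 0 ∨ onFace k 1} {onFace k 2 ∨ onFace k 3} (λ o o′ → ends (some-end x↦0 y↦1 o , some-end z↦2 w↦3 o′))))

        -- A jump for `c′` moves back along `g ⁻¹` to a jump for `c`, so condition (i) travels with
        -- the symmetry.
        jump-free′ : ∀ a b a′ b′ → IsJump c′ a b a′ b′ → ¬ FContains H d (plus dodecahedron a b a′ b′) (oldV ∘ c′)
        jump-free′ a b a′ b′ jump emb = jump-free (from a) (from b) (from a′) (from b′)
          (IsJump-push (g ⁻¹) {c′} {c} {a} {b} {a′} {b′} (from-to ∘ c) jump)
          (FContains-pull g {c = c} {c′} {from a} {from b} {from a′} {from b′} (λ _ → refl)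
            (plus-cong (sym (to-from a)) (sym (to-from b)) (sym (to-from a′)) (sym (to-from b′)) emb))

        straighten : ∀ {x y z w} → IsZigzag g x y z w → FContains H d (plus dodecahedron x y z w) (oldV ∘ c) →
          FContains H d (plus dodecahedron 0F 1F 2F 3F) (oldV ∘ c′)
        straighten (x↦0 , y↦1 , z↦2 , w↦3) emb = FContains-pull (g ⁻¹) {c = c′} {c} {0F} {1F} {2F} {3F} (from-to ∘ c)
          (plus-cong (back x↦0) (back y↦1) (back z↦2) (back w↦3) emb)

      no-zigzag : ∀ {x y z w} → HopIn x y z w → ¬ IsZigzag g x y z w
      no-zigzag {x} {y} {z} {w} (hop , emb) zigzag = ZigzagHop.no-hop H simple cubic conn c′ cc′ k bounds
        (zigzag-admissible {x} {y} {z} {w} hop zigzag) d dc jump-free′ (straighten zigzag emb)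

    -- An edge yz makes x y z w a walk whose outer edges are not cofacial, hence a zigzag that some
    -- symmetry puts at 0 1 2 3. The circuit `c` moves along and again bounds a face.
    no-adjacent-ends : ∀ {x y z w} → HopIn x y z w → ¬ Adj dodecahedron y z
    no-adjacent-ends {x} {y} {z} {w} h@((xy , zw , ne , _ , _ , _ , faces) , _) yz =
      let g , zigzag = standardise {x} {y} {z} {w} xy yz zw ne faces
          open Symmetry g
          k , bounds = circuit-bounds (to ∘ c) ((λ i j e → proj₁ cc i j (to-inj e)) , adj-to ∘ proj₂ cc)
      in no-zigzag g k bounds h zigzag

  -- Either edge of the hop may be reversed. In all four readings the two inner ends are distinct
  -- and not adjacent; together this is diversity, so the hop would be a jump.
  hop-free : ∀ a b a′ b′ → IsHop c a b a′ b′ → ¬ FContains H d (plus dodecahedron a b a′ b′) (oldV ∘ c)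
  hop-free a b a′ b′ hop@(ab , a′b′ , _) emb = jump-free a b a′ b′ (hop ,
    loopless a b ab , no-shared-end {b} {a} h₁ , no-shared-end {b} {a} h₁₂ , no-shared-end {a} {b} h , no-shared-end {a} {b} h₂ , loopless a′ b′ a′b′ ,
    no-adjacent-ends {b} {a} h₁ , no-adjacent-ends {b} {a} h₁₂ , no-adjacent-ends {a} {b} h , no-adjacent-ends {a} {b} h₂) emb
    where
    loopless : ∀ u v → Adj dodecahedron u v → u ≢ v
    loopless u u uu refl = dodec-irrefl {u} uu
    h : HopIn a b a′ b′
    h = hop , emb
    h₁ : HopIn b a a′ b′
    h₁ = flip {a} {b} {a′} {b′} h
    h₂ : HopIn a b b′ a′
    h₂ = flip₂ {a} {b} {a′} {b′} h
    h₁₂ : HopIn b a b′ a′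
    h₁₂ = flip₂ {b} {a} {a′} {b′} h₁

theorem9p4 : (c : Fin 5 → Fin 20) → IsCircuit5 dodecahedron c →
    (n : ℕ) (H : Graph n) → IsSimple H → IsCubic H → IsCyclicallyConnected 5 H →
    (d : Fin 5 → Fin n) → IsCircuit5 H d →
    (∀ a b a' b' → IsJump c a b a' b' →
    ¬ FContains H d (plus dodecahedron a b a' b') (λ i → oldV (c i))) →
    (∀ (X : Fin n → Bool) →
    (∀ v → X v ≡ true → ¬ InVF d v) →
    cutSize H X ≡ 5 →
    ¬ (∀ v → ¬ InVF d v → X v ≡ true) →
    ¬ Σ (HomEmb dodecahedron H) (λ η → Fixes η c d ×
    (∀ v → ¬ InVF c v → X (HomEmb.vmap η v) ≡ true))) →
    ∀ a b a' b' → IsHop c a b a' b' →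
    ¬ FContains H d (plus dodecahedron a b a' b') (λ i → oldV (c i))
theorem9p4 c cc n H simple cubic conn d dc jump-free _ = hop-free c cc H simple cubic conn d dc jump-free
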